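{- Each of the problems Strongly Connected Spanning Subgraph (SCSpS), Minimum Equivalent Graph (MEG), and $2$-Edge Connected Spanning Subgraph ($2$-ECSS) on $n$-vertex graphs can be solved in $O^*(2^n)$ time.
   Context: SCSpS: the input is a directed graph $D=(V,A)$ and an integer $t$; the question is whether there is a set $X\subseteq A$ with $|X|\le t$ such that $(V,X)$ is strongly connected. MEG: the input is a directed graph $D=(V,E)$ and an integer $t$; the question is whether there is a set $X\subseteq E$ with $|X|\le t$ such that for all $u,v\in V$, if there is a directed path from $u$ to $v$ in $D$, then there is a directed path from $u$ to $v$ in $(V,X)$. $2$-ECSS: the input is an undirected graph $G=(V,E)$ and an integer $t$; the question is whether there is a set $X\subseteq E$ with $|X|\le t$ such that $(V,X)$ is $2$-edge connected (connected, and still connected after the deletion of any single edge). The notation $O^*(\cdot)$ hides factors polynomial in the input size. -}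

module Defs where

open import Data.Bool.Base using (Bool; if_then_else_)
open import Data.Fin.Base using (Fin; combine) renaming (_<_ to _<ᶠ_)
open import Data.Fin.Subset using (Subset; _∈_; _⊆_; ∣_∣; _-_)
open import Data.Integer.Base as ℤ using (ℤ; +_; -[1+_])
open import Data.List.Base using (List; []; _∷_; map)
open import Data.Nat.Base using (ℕ; zero; suc; _+_; _*_; _∸_; _/_; _^_; _≤_; _≡ᵇ_)
open import Data.Nat.ListAction using (sum)
open import Data.Nat.Logarithm using (⌊log₂_⌋)
open import Data.Product.Base using (_×_; _,_; ∃-syntax)
open import Data.Sum.Base using (_⊎_)
open import Data.Vec.Base using (toList)
open import Relation.Binary.Construct.Closure.ReflexiveTransitive using (Star)
open import Relation.Binary.PropositionalEquality using (_≡_; _≢_)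
open import Relation.Nullary.Negation.Core using (¬_)

------------------------------------------------------------------------
-- Random access machine with logarithmic cost
--
-- Structured programs over the instruction set of Aho, Hopcroft and
-- Ullman's RAM.  A state has registers, addressed by constants of the
-- program, and a memory, addressed by computed values.  Both are infinite
-- and hold arbitrary natural numbers, and every operation is charged for
-- the bit lengths of the numbers it handles, so that long numbers cannot be
-- used to obtain computation for free.

data Op : Set where
  add sub mul div : Op

data Expr : Set where
  lit  : ℕ → Expr
  reg  : ℕ → Expr
  load : Expr → Expr
  bin  : Op → Expr → Expr → Expr

infix  6 _≔_ [_]≔_
infixr 5 _⨾_

data Cmd : Set where
  skip  : Cmd
  _≔_   : ℕ → Expr → Cmd
  [_]≔_ : Expr → Expr → Cmd
  _⨾_   : Cmd → Cmd → Cmd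
  ifnz  : Expr → Cmd → Cmd → Cmd
  while : Expr → Cmd → Cmd

record State : Set where
  constructor ⟪_,_⟫
  field
    regs : ℕ → ℕ
    mem  : ℕ → ℕ

open State public

_[_↦_] : (ℕ → ℕ) → ℕ → ℕ → (ℕ → ℕ)
(f [ i ↦ v ]) j = if i ≡ᵇ j then v else f j

-- Subtraction is truncated, and division by zero gives zero.
⟦_⟧ : Op → ℕ → ℕ → ℕ
⟦ add ⟧ m n       = m + n
⟦ sub ⟧ m n       = m ∸ n
⟦ mul ⟧ m n       = m * n
⟦ div ⟧ m zero    = 0
⟦ div ⟧ m (suc n) = m / suc n

eval : Expr → State → ℕ
eval (lit k)       s = k
eval (reg i)       s = regs s i
eval (load e)      s = mem s (eval e s)
eval (bin o e₁ e₂) s = ⟦ o ⟧ (eval e₁ s) (eval e₂ s)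

-- Bit length of the binary representation; ⌊log₂ 0 ⌋ is 0, so zero has
-- length 1 and every operation below costs at least 1.
len : ℕ → ℕ
len m = suc ⌊log₂ m ⌋

evalCost : Expr → State → ℕ
evalCost (lit k)       s = len k
evalCost (reg i)       s = len (regs s i)
evalCost (load e)      s = evalCost e s + (len (eval e s) + len (eval (load e) s))
evalCost (bin o e₁ e₂) s =
  evalCost e₁ s + evalCost e₂ s + (len (eval e₁ s) + len (eval e₂ s))

-- ⟨ c , s ⟩⇓ s′ ∣ k : started in s, the command c halts in s′ at total
-- cost k.  The rules are syntax-directed, so s′ and k are determined by c
-- and s.
infix 4 ⟨_,_⟩⇓_∣_

data ⟨_,_⟩⇓_∣_ : Cmd → State → State → ℕ → Set where
  ⇓skip : ∀ {s} → ⟨ skip , s ⟩⇓ s ∣ 1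

  ⇓reg : ∀ {i e s} →
    ⟨ i ≔ e , s ⟩⇓ ⟪ regs s [ i ↦ eval e s ] , mem s ⟫
      ∣ evalCost e s + len (eval e s)

  ⇓mem : ∀ {a e s} →
    ⟨ [ a ]≔ e , s ⟩⇓ ⟪ regs s , mem s [ eval a s ↦ eval e s ] ⟫
      ∣ evalCost a s + evalCost e s + (len (eval a s) + len (eval e s))

  ⇓seq : ∀ {c₁ c₂ s s′ s″ k₁ k₂} →
    ⟨ c₁ , s ⟩⇓ s′ ∣ k₁ → ⟨ c₂ , s′ ⟩⇓ s″ ∣ k₂ →
    ⟨ c₁ ⨾ c₂ , s ⟩⇓ s″ ∣ k₁ + k₂

  ⇓then : ∀ {e c₁ c₂ s s′ k} →
    eval e s ≢ 0 → ⟨ c₁ , s ⟩⇓ s′ ∣ k →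
    ⟨ ifnz e c₁ c₂ , s ⟩⇓ s′ ∣ evalCost e s + len (eval e s) + k

  ⇓else : ∀ {e c₁ c₂ s s′ k} →
    eval e s ≡ 0 → ⟨ c₂ , s ⟩⇓ s′ ∣ k →
    ⟨ ifnz e c₁ c₂ , s ⟩⇓ s′ ∣ evalCost e s + len (eval e s) + k

  ⇓exit : ∀ {e c s} →
    eval e s ≡ 0 →
    ⟨ while e c , s ⟩⇓ s ∣ evalCost e s + len (eval e s)

  ⇓loop : ∀ {e c s s′ s″ k₁ k₂} →
    eval e s ≢ 0 → ⟨ c , s ⟩⇓ s′ ∣ k₁ → ⟨ while e c , s′ ⟩⇓ s″ ∣ k₂ →
    ⟨ while e c , s ⟩⇓ s″ ∣ evalCost e s + len (eval e s) + (k₁ + k₂)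

------------------------------------------------------------------------
-- Decision problems and O*

record Problem : Set₁ where
  field
    Instance : Set
    order    : Instance → ℕ          -- the parameter n
    encode   : Instance → List ℕ
    Yes      : Instance → Set

nth : List ℕ → ℕ → ℕ
nth []       _       = 0
nth (x ∷ xs) zero    = x
nth (x ∷ xs) (suc i) = nth xs i

-- The input occupies memory cells 0, 1, 2, …; everything else is zero.
initial : List ℕ → State
initial xs = ⟪ (λ _ → 0) , nth xs ⟫

-- The answer is left in register 0.
Answers : Set → State → Set
Answers P s = (regs s 0 ≡ 1 × P) ⊎ (regs s 0 ≡ 0 × ¬ P)

inputSize : List ℕ → ℕ
inputSize xs = sum (map len xs)

-- A single program decides all instances, in time at most
-- c · (1 + input size)ᵈ · f(n).
SolvableInTimeO* : (ℕ → ℕ) → Problem → Set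
SolvableInTimeO* f Π =
  ∃[ prog ] ∃[ c ] ∃[ d ] ∀ (x : Instance) →
    ∃[ s ] ∃[ k ]
      ⟨ prog , initial (encode x) ⟩⇓ s ∣ k
      × Answers (Yes x) s
      × k ≤ c * suc (inputSize (encode x)) ^ d * f (order x)
  where open Problem Π

------------------------------------------------------------------------
-- Graphs on the vertex set Fin n

-- A set of ordered pairs of vertices, (u , v) being numbered combine u v.
PairSet : ℕ → Set
PairSet n = Subset (n * n)

module _ (n : ℕ) where

  Arc : PairSet n → Fin n → Fin n → Set
  Arc X u v = combine u v ∈ X

  DiPath : PairSet n → Fin n → Fin n → Set
  DiPath X = Star (Arc X)

  StronglyConnected : PairSet n → Set
  StronglyConnected X = ∀ u v → DiPath X u v

  -- An undirected edge {u , v} is represented by the one pair (u , v) with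
  -- u < v, so that the cardinality of a set of pairs is the number of edges.
  IsEdgeSet : PairSet n → Set
  IsEdgeSet E = ∀ (u v : Fin n) → combine u v ∈ E → u <ᶠ v

  Adjacent : PairSet n → Fin n → Fin n → Set
  Adjacent X u v = combine u v ∈ X ⊎ combine v u ∈ X

  Connected : PairSet n → Set
  Connected X = ∀ u v → Star (Adjacent X) u v

  TwoEdgeConnected : PairSet n → Set
  TwoEdgeConnected X = Connected X × (∀ e → e ∈ X → Connected (X - e))

------------------------------------------------------------------------
-- The three problems

record DigraphInstance : Set where
  field
    n : ℕ
    A : PairSet n
    t : ℤ

record GraphInstance : Set where
  field
    n         : ℕ
    E         : PairSet n
    isEdgeSet : IsEdgeSet n E
    t         : ℤ

bit : Bool → ℕ
bit b = if b then 1 else 0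

-- Sign (1 for negative) and absolute value.
encodeℤ : ℤ → ℕ × ℕ
encodeℤ (+ k)    = 0 , k
encodeℤ -[1+ k ] = 1 , suc k

-- The number of vertices, the integer t, and the n × n adjacency matrix in
-- row-major order (strictly upper triangular for undirected graphs).
encodeGraph : (n : ℕ) → PairSet n → ℤ → List ℕ
encodeGraph n X t with encodeℤ t
... | sgn , abs = n ∷ sgn ∷ abs ∷ map bit (toList X)

SCSpS : Problem
SCSpS = record
  { Instance = DigraphInstance
  ; order    = n
  ; encode   = λ x → encodeGraph (n x) (A x) (t x)
  ; Yes      = λ x → ∃[ X ] X ⊆ A x × (+ ∣ X ∣) ℤ.≤ t x × StronglyConnected (n x) X
  }
  where open DigraphInstance

MEG : Problem
MEG = record
  { Instance = DigraphInstance
  ; order    = n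
  ; encode   = λ x → encodeGraph (n x) (A x) (t x)
  ; Yes      = λ x → ∃[ X ] X ⊆ A x × (+ ∣ X ∣) ℤ.≤ t x ×
                 (∀ u v → DiPath (n x) (A x) u v → DiPath (n x) X u v)
  }
  where open DigraphInstance

2-ECSS : Problem
2-ECSS = record
  { Instance = GraphInstance
  ; order    = n
  ; encode   = λ x → encodeGraph (n x) (E x) (t x)
  ; Yes      = λ x → ∃[ X ] X ⊆ E x × (+ ∣ X ∣) ℤ.≤ t x × TwoEdgeConnected (n x) X
  }
  where open GraphInstance

{-# OPTIONS --safe #-}

module Submission where

-- A strongly connected digraph on T arises from a single vertex by adding
-- ears, and its number of arcs is |T| - 1 plus the number of ears.  An ear is
-- grown vertex by vertex, its end vertex w ∈ T being guessed in advance, so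
-- a state (T, current vertex, w, number of arcs) suffices, and there are only
-- 2ⁿ · poly(n) of them.  For MEG the process starts from one representative
-- per strong component and uses arcs inside components only; each covering
-- pair of components costs one further arc.  For 2-ECSS the graph is read as
-- a symmetric digraph and an ear may not run back along its first edge; the
-- resulting subgraphs are the strongly connected orientations (Robbins).
-- The RAM program is compiled from a small language of arithmetic terms with
-- bounded sums, whose cost is polynomial in the bit lengths, and truth values
-- of predicates are computed as 0/1-valued terms.

open import Defs
open import Data.Bool.Base using (Bool; true; false; if_then_else_)
open import Data.Empty using (⊥-elim)
open import Data.Fin.Base using (Fin; suc; zero; toℕ; fromℕ<; combine) renaming (_<_ to _<ᶠ_)
open import Data.Fin.Induction using (<-wellFounded; spo-wellFounded; spo-noetherian)
open import Data.Fin.Properties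
  using (any?; toℕ<n; toℕ-fromℕ<; toℕ-injective; toℕ-combine; fromℕ<-cong; fromℕ<-toℕ; combine-injective)
  renaming (_≟_ to _≟ᶠ_; _<?_ to _<ᶠ?_; <-cmp to <ᶠ-cmp; <-asym to <ᶠ-asym)
open import Data.Fin.Subset
  using (Subset; _∈_; _∉_; _⊆_; ∣_∣; _-_; _─_; _∪_; ⁅_⁆; ⊤) renaming (⊥ to ∅)
open import Data.Fin.Subset.Properties
open import Data.Integer.Base as ℤ using (ℤ; -[1+_])
open import Data.Integer.Properties using (drop‿+≤+)
open import Data.List.Base using (List; []; _∷_; length; map; _++_; foldr)
open import Data.List.Membership.Propositional using () renaming (_∈_ to _∈ˡ_; _∉_ to _∉ˡ_)
open import Data.List.Membership.Propositional.Properties using (∈-++⁺ˡ; ∈-++⁺ʳ; ∈-++⁻; ∈-map⁺; ∈-map⁻)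
open import Data.List.Properties using (length-map; length-++)
open import Data.List.Relation.Unary.All as All using (All; []; _∷_)
import Data.List.Relation.Unary.All.Properties as All
open import Data.List.Relation.Unary.AllPairs using ([]; _∷_)
open import Data.List.Relation.Unary.Any using (here; there)
open import Data.List.Relation.Unary.Unique.Propositional using (Unique)
import Data.List.Relation.Unary.Unique.Propositional.Properties as Unique
open import Data.Nat.Base
open import Data.Nat.DivMod
  using (m/n≤m; m/n/o≡m/[n*o]; m*n/n≡m; m*n%n≡0; m<n⇒m/n≡0; m<n⇒m%n≡m; n/1≡n; +-distrib-/)
open import Data.Nat.Logarithm using (⌊log₂⌋-mono-≤; ⌊log₂[2^n]⌋≡n)
open import Data.Nat.Properties
open import Data.Product.Base using (_×_; _,_; Σ-syntax; ∃-syntax; proj₁; proj₂; uncurry)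
open import Data.Product.Properties using (≡-dec)
open import Data.Sum.Base using (_⊎_; inj₁; inj₂; [_,_]′; swap)
open import Data.Unit.Base using (tt) renaming (⊤ to Unit)
open import Data.Vec.Base using (tabulate; toList; _∷_; []; here; there)
open import Data.Vec.Properties using ([]=⇒lookup; lookup⇒[]=; lookup∘tabulate; length-toList)
open import Function.Base using (flip; id; _∘_)
open import Induction.WellFounded using (Acc; acc)
open import Relation.Binary.Construct.Closure.ReflexiveTransitive
  using (Star; ε; _◅_; _◅◅_; reverse; kleisliStar) renaming (map to star-map)
open import Relation.Binary.Definitions using (tri<; tri≈; tri>)
open import Relation.Binary.PropositionalEquality
open import Relation.Binary.Structures using (IsStrictPartialOrder)
open import Relation.Nullary.Decidable using (dec-true)
open import Relation.Nullary.Decidable.Core using (Dec; yes; no; ¬?; _×-dec_; does; decidable-stable)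
open import Relation.Nullary.Negation.Core using (¬_)

-- Terms over a random access memory and their compilation

-- While an ear is open, the subgraph is not yet strongly connected, so the invariants are
-- conditional: connectivity holds once some path from the current vertex to the guessed end is
-- supplied. Ears without an inner vertex never occur, since they would join vertices that are
-- connected already. The factor 2ⁿ comes only from the number of entries of the ear table. One
-- entry has polynomial cost because sums are bounded by polynomials in n, and n is at most the
-- input size, as the input contains an n × n matrix. In the Warshall table and the ear table the
-- stage (bound on inner vertices, number of arcs) is the leading digit of the index, so filling by
-- increasing index reads only finished entries. The combinatorial arguments need reachability to be
-- decidable; the decision is read off the table that the program itself has filled.

infixl 6 _⊕_
infixl 7 _⊗_

data Poly : Set where
  𝕂       : ℕ → Poly
  𝕏       : Poly
  _⊕_ _⊗_ : Poly → Poly → Poly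

⟦_⟧ₚ : Poly → ℕ → ℕ
⟦ 𝕂 c ⟧ₚ   z = c
⟦ 𝕏 ⟧ₚ     z = z
⟦ p ⊕ q ⟧ₚ z = ⟦ p ⟧ₚ z + ⟦ q ⟧ₚ z
⟦ p ⊗ q ⟧ₚ z = ⟦ p ⟧ₚ z * ⟦ q ⟧ₚ z

poly-mono : ∀ p {m n} → m ≤ n → ⟦ p ⟧ₚ m ≤ ⟦ p ⟧ₚ n
poly-mono (𝕂 c)   m≤n = ≤-refl
poly-mono 𝕏       m≤n = m≤n
poly-mono (p ⊕ q) m≤n = +-mono-≤ (poly-mono p m≤n) (poly-mono q m≤n)
poly-mono (p ⊗ q) m≤n = *-mono-≤ (poly-mono p m≤n) (poly-mono q m≤n)

poly-bound : ∀ p → ∃[ c ] ∃[ d ] ∀ z → 1 ≤ z → ⟦ p ⟧ₚ z ≤ c * z ^ d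
poly-bound (𝕂 c)   = c , 0 , λ z _ → ≤-reflexive (sym (*-identityʳ c))
poly-bound 𝕏       = 1 , 1 , λ z _ → ≤-reflexive (sym (trans (+-identityʳ (z * 1)) (*-identityʳ z)))
poly-bound (p ⊕ q) with poly-bound p | poly-bound q
... | c , d , p≤ | c′ , d′ , q≤ = c + c′ , d + d′ , λ { z@(suc _) 1≤z → begin
    ⟦ p ⟧ₚ z + ⟦ q ⟧ₚ z                     ≤⟨ +-mono-≤ (p≤ z 1≤z) (q≤ z 1≤z) ⟩
    c * z ^ d + c′ * z ^ d′                 ≤⟨ +-mono-≤ (*-monoʳ-≤ c (^-monoʳ-≤ z (m≤m+n d d′)))
                                                        (*-monoʳ-≤ c′ (^-monoʳ-≤ z (m≤n+m d′ d))) ⟩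
    c * z ^ (d + d′) + c′ * z ^ (d + d′)    ≡⟨ *-distribʳ-+ (z ^ (d + d′)) c c′ ⟨
    (c + c′) * z ^ (d + d′)                 ∎ }
  where open ≤-Reasoning
poly-bound (p ⊗ q) with poly-bound p | poly-bound q
... | c , d , p≤ | c′ , d′ , q≤ = c * c′ , d + d′ , λ z 1≤z → begin
    ⟦ p ⟧ₚ z * ⟦ q ⟧ₚ z             ≤⟨ *-mono-≤ (p≤ z 1≤z) (q≤ z 1≤z) ⟩
    c * z ^ d * (c′ * z ^ d′)       ≡⟨ [m*n]*[o*p]≡[m*o]*[n*p] c (z ^ d) c′ (z ^ d′) ⟩
    c * c′ * (z ^ d * z ^ d′)       ≡⟨ cong (c * c′ *_) (sym (^-distribˡ-+-* z d d′)) ⟩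
    c * c′ * z ^ (d + d′)           ∎
  where open ≤-Reasoning

n≤2^n : ∀ n → n ≤ 2 ^ n
n≤2^n zero    = z≤n
n≤2^n (suc n) = begin
    suc n             ≡⟨ +-comm 1 n ⟩
    n + 1             ≤⟨ +-mono-≤ (n≤2^n n) (m^n>0 2 n) ⟩
    2 ^ n + 2 ^ n     ≡⟨ cong (2 ^ n +_) (+-identityʳ (2 ^ n)) ⟨
    2 ^ suc n         ∎
  where open ≤-Reasoning

len≤ : ∀ {v w} → v ≤ 2 ^ w → len v ≤ suc w
len≤ {v} {w} v≤ = s≤s (≤-trans (⌊log₂⌋-mono-≤ v≤) (≤-reflexive (⌊log₂[2^n]⌋≡n w)))

len-id : ∀ v → len v ≤ suc v
len-id v = len≤ (n≤2^n v)

upd-same : ∀ (f : ℕ → ℕ) i {v} → (f [ i ↦ v ]) i ≡ v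
upd-same f i with i ≡ᵇ i | ≡⇒≡ᵇ i i refl
... | true | _ = refl

upd-other : ∀ (f : ℕ → ℕ) {i j v} → i ≢ j → (f [ i ↦ v ]) j ≡ f j
upd-other f {i} {j} i≢j with i ≡ᵇ j | ≡ᵇ⇒≡ i j
... | true  | eq = ⊥-elim (i≢j (eq tt))
... | false | _  = refl

Σ< : ℕ → (ℕ → ℕ) → ℕ
Σ< zero    f = 0
Σ< (suc n) f = f n + Σ< n f

-- The only iteration is a sum with polynomially many summands, so no term can take exponential
-- time. `let′` evaluates a shared value once, which keeps the decoding of an index and the count of
-- covering pairs out of inner loops.
data Tm : Set where
  lit : ℕ → Tm
  var : ℕ → Tm
  rd  : Tm → Tm
  bin : Op → Tm → Tm → Tm
  sum : ℕ → Poly → Tm → Tm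
  let′ : ℕ → Tm → Tm → Tm

-- A bound of a sum is a polynomial in the content of memory cell 0.
val : Tm → (ℕ → ℕ) → (ℕ → ℕ) → ℕ
val (lit c)      ρ m = c
val (var x)      ρ m = ρ x
val (rd e)       ρ m = m (val e ρ m)
val (bin o e e′) ρ m = ⟦ o ⟧ (val e ρ m) (val e′ ρ m)
val (sum x b e)  ρ m = Σ< (⟦ b ⟧ₚ (m 0)) λ i → val e (ρ [ x ↦ i ]) m
val (let′ x e e′) ρ m = val e′ (ρ [ x ↦ val e ρ m ]) m

polyExpr : Poly → Expr
polyExpr (𝕂 c)   = lit c
polyExpr 𝕏       = load (lit 0)
polyExpr (p ⊕ q) = bin add (polyExpr p) (polyExpr q)
polyExpr (p ⊗ q) = bin mul (polyExpr p) (polyExpr q)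

polyExpr-eval : ∀ p s → eval (polyExpr p) s ≡ ⟦ p ⟧ₚ (mem s 0)
polyExpr-eval (𝕂 c)   s = refl
polyExpr-eval 𝕏       s = refl
polyExpr-eval (p ⊕ q) s = cong₂ _+_ (polyExpr-eval p s) (polyExpr-eval q s)
polyExpr-eval (p ⊗ q) s = cong₂ _*_ (polyExpr-eval p s) (polyExpr-eval q s)

polyExprCost : Poly → Poly
polyExprCost (𝕂 c)   = 𝕂 (len c)
polyExprCost 𝕏       = 𝕂 1 ⊕ (𝕂 1 ⊕ (𝕂 1 ⊕ 𝕏))
polyExprCost (p ⊕ q) = polyExprCost p ⊕ polyExprCost q ⊕ ((𝕂 1 ⊕ p) ⊕ (𝕂 1 ⊕ q))
polyExprCost (p ⊗ q) = polyExprCost p ⊕ polyExprCost q ⊕ ((𝕂 1 ⊕ p) ⊕ (𝕂 1 ⊕ q))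

polyExpr-len : ∀ p s {z} → mem s 0 ≤ z → len (eval (polyExpr p) s) ≤ suc (⟦ p ⟧ₚ z)
polyExpr-len p s m0≤z rewrite polyExpr-eval p s =
  ≤-trans (len-id _) (s≤s (poly-mono p m0≤z))

polyExpr-cost : ∀ p s {z} → mem s 0 ≤ z → evalCost (polyExpr p) s ≤ ⟦ polyExprCost p ⟧ₚ z
polyExpr-cost (𝕂 c)   s m0≤z = ≤-refl
polyExpr-cost 𝕏       s m0≤z = s≤s (s≤s (≤-trans (len-id _) (s≤s m0≤z)))
polyExpr-cost (p ⊕ q) s m0≤z =
  +-mono-≤ (+-mono-≤ (polyExpr-cost p s m0≤z) (polyExpr-cost q s m0≤z))
           (+-mono-≤ (polyExpr-len p s m0≤z) (polyExpr-len q s m0≤z))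
polyExpr-cost (p ⊗ q) s m0≤z =
  +-mono-≤ (+-mono-≤ (polyExpr-cost p s m0≤z) (polyExpr-cost q s m0≤z))
           (+-mono-≤ (polyExpr-len p s m0≤z) (polyExpr-len q s m0≤z))

-- The names of a term are mapped to registers below k by η; the value ends
-- up in register k, and the registers below k are preserved.
comp : ℕ → (ℕ → ℕ) → Tm → Cmd
comp k η (lit c)       = k ≔ lit c
comp k η (var x)       = k ≔ reg (η x)
comp k η (rd e)        = comp k η e ⨾ k ≔ load (reg k)
comp k η (bin o e e′)  = comp k η e ⨾ comp (suc k) η e′ ⨾ k ≔ bin o (reg k) (reg (suc k))
comp k η (sum x b e)   =
  k ≔ polyExpr b ⨾
  suc k ≔ lit 0 ⨾
  while (reg k)
    ( k ≔ bin sub (reg k) (lit 1)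
    ⨾ comp (2 + k) (η [ x ↦ k ]) e
    ⨾ suc k ≔ bin add (reg (suc k)) (reg (2 + k)) ) ⨾
  k ≔ reg (suc k)
comp k η (let′ x e e′) =
  comp k η e ⨾ comp (suc k) (η [ x ↦ k ]) e′ ⨾ k ≔ reg (suc k)

_[_≔ₚ_] : (ℕ → Poly) → ℕ → Poly → (ℕ → Poly)
(β [ x ≔ₚ p ]) y = if x ≡ᵇ y then p else β y

-- A width is an exponent w such that the value is at most 2^w. `Poly` has no maximum, so a sum
-- takes its place; the extra 1 for `add` pays for the carry.
opWidth : Op → Poly → Poly → Poly
opWidth add p q = 𝕂 1 ⊕ (p ⊕ q)
opWidth sub p q = p
opWidth mul p q = p ⊕ q
opWidth div p q = p

width : Tm → (ℕ → Poly) → Poly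
width (lit c)       β = 𝕂 c
width (var x)       β = β x
width (rd e)        β = 𝕏
width (bin o e e′)  β = opWidth o (width e β) (width e′ β)
width (sum x b e)   β = b ⊕ width e (β [ x ≔ₚ b ])
width (let′ x e e′) β = width e′ (β [ x ≔ₚ width e β ])

Bits : Poly → ℕ → ℕ → Set
Bits p z v = v ≤ 2 ^ ⟦ p ⟧ₚ z

2^-mono : ∀ {a b} → a ≤ b → 2 ^ a ≤ 2 ^ b
2^-mono = ^-monoʳ-≤ 2

op-bits : ∀ o {p q z u v} → Bits p z u → Bits q z v → Bits (opWidth o p q) z (⟦ o ⟧ u v)
op-bits add {p} {q} {z} {u} {v} u≤ v≤ = begin
    u + v                           ≤⟨ +-mono-≤ u≤ v≤ ⟩
    2 ^ a + 2 ^ b                   ≤⟨ +-mono-≤ (2^-mono (m≤m+n a b)) (2^-mono (m≤n+m b a)) ⟩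
    2 ^ (a + b) + 2 ^ (a + b)       ≡⟨ cong (2 ^ (a + b) +_) (+-identityʳ _) ⟨
    2 ^ suc (a + b)                 ∎
  where
  open ≤-Reasoning
  a = ⟦ p ⟧ₚ z
  b = ⟦ q ⟧ₚ z
op-bits sub {u = u} {v} u≤ v≤ = ≤-trans (m∸n≤m u v) u≤
op-bits mul {p} {q} {z} u≤ v≤ =
  ≤-trans (*-mono-≤ u≤ v≤) (≤-reflexive (sym (^-distribˡ-+-* 2 (⟦ p ⟧ₚ z) (⟦ q ⟧ₚ z))))
op-bits div {u = u} {zero}  u≤ v≤ = z≤n
op-bits div {u = u} {suc v} u≤ v≤ = ≤-trans (m/n≤m u (suc v)) u≤

Σ<-bound : ∀ n f {b} → (∀ i → i < n → f i ≤ b) → Σ< n f ≤ n * b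
Σ<-bound zero    f f≤ = z≤n
Σ<-bound (suc n) f f≤ = +-mono-≤ (f≤ n ≤-refl) (Σ<-bound n f λ i i<n → f≤ i (m<n⇒m<1+n i<n))

-- Two scales: a cell may hold a number as large as 2^z, such as t or 2ⁿ, but n in cell 0 is itself
-- at most z. The second bound makes the number of loop rounds polynomial in z.
record MemOK (z : ℕ) (m : ℕ → ℕ) : Set where
  field
    cell  : ∀ a → m a ≤ 2 ^ z
    cell₀ : m 0 ≤ z

open MemOK public

bits-upd : ∀ {β ρ z x p v} → (∀ y → Bits (β y) z (ρ y)) → Bits p z v →
           ∀ y → Bits ((β [ x ≔ₚ p ]) y) z ((ρ [ x ↦ v ]) y)
bits-upd {x = x} ρ≤ v≤ y with x ≡ᵇ y
... | true  = v≤
... | false = ρ≤ y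

index-bits : ∀ b {z m i} → MemOK z m → i ≤ ⟦ b ⟧ₚ (m 0) → Bits b z i
index-bits b ok i≤ = ≤-trans i≤ (≤-trans (poly-mono b (cell₀ ok)) (n≤2^n _))

sum-bits : ∀ b {p z m} f → MemOK z m → (∀ i → i < ⟦ b ⟧ₚ (m 0) → Bits p z (f i)) →
           Bits (b ⊕ p) z (Σ< (⟦ b ⟧ₚ (m 0)) f)
sum-bits b {p} {z} {m} f ok f≤ = begin
    Σ< (⟦ b ⟧ₚ (m 0)) f                     ≤⟨ Σ<-bound _ f f≤ ⟩
    ⟦ b ⟧ₚ (m 0) * 2 ^ ⟦ p ⟧ₚ z             ≤⟨ *-monoˡ-≤ (2 ^ ⟦ p ⟧ₚ z) (index-bits b {i = ⟦ b ⟧ₚ (m 0)} ok ≤-refl) ⟩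
    2 ^ ⟦ b ⟧ₚ z * 2 ^ ⟦ p ⟧ₚ z             ≡⟨ ^-distribˡ-+-* 2 (⟦ b ⟧ₚ z) (⟦ p ⟧ₚ z) ⟨
    2 ^ ⟦ b ⊕ p ⟧ₚ z                        ∎
  where open ≤-Reasoning

val-bits : ∀ e {β ρ m z} → MemOK z m → (∀ y → Bits (β y) z (ρ y)) → Bits (width e β) z (val e ρ m)
val-bits (lit c)       ok ρ≤ = n≤2^n c
val-bits (var x)       ok ρ≤ = ρ≤ x
val-bits (rd e)        ok ρ≤ = cell ok _
val-bits (bin o e e′)  {β} ok ρ≤ =
  op-bits o {width e β} {width e′ β} (val-bits e ok ρ≤) (val-bits e′ ok ρ≤)
val-bits (sum x b e)   {β} {ρ} ok ρ≤ =
  sum-bits b {width e (β [ x ≔ₚ b ])} _ ok λ i i< → val-bits e ok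
    (bits-upd {β} {ρ} {x = x} {b} ρ≤ (index-bits b ok (<⇒≤ i<)))
val-bits (let′ x e e′) {β} {ρ} ok ρ≤ =
  val-bits e′ ok (bits-upd {β} {ρ} {x = x} {width e β} ρ≤ (val-bits e ok ρ≤))

len-bits : ∀ p {z v} → Bits p z v → len v ≤ ⟦ 𝕂 1 ⊕ p ⟧ₚ z
len-bits p = len≤

-- The summands follow the cost rules: loop test, decrement of the counter, body, addition to the
-- accumulator. The accumulator gets the width `b ⊕ w` of the whole sum.
iterCost : Poly → Poly → Poly → Poly
iterCost b w c =
  ((𝕂 1 ⊕ b) ⊕ (𝕂 1 ⊕ b)) ⊕
  (((𝕂 1 ⊕ b) ⊕ 𝕂 1 ⊕ ((𝕂 1 ⊕ b) ⊕ 𝕂 1) ⊕ (𝕂 1 ⊕ b)) ⊕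
   (c ⊕ ((𝕂 1 ⊕ (b ⊕ w)) ⊕ (𝕂 1 ⊕ w) ⊕ ((𝕂 1 ⊕ (b ⊕ w)) ⊕ (𝕂 1 ⊕ w)) ⊕ (𝕂 1 ⊕ (b ⊕ w)))))

cost : Tm → (ℕ → Poly) → Poly
cost (lit c)       β = 𝕂 (len c) ⊕ 𝕂 (len c)
cost (var x)       β = (𝕂 1 ⊕ β x) ⊕ (𝕂 1 ⊕ β x)
cost (rd e)        β = cost e β ⊕ ((𝕂 1 ⊕ w) ⊕ ((𝕂 1 ⊕ w) ⊕ (𝕂 1 ⊕ 𝕏)) ⊕ (𝕂 1 ⊕ 𝕏))
  where w = width e β
cost (bin o e e′)  β =
  cost e β ⊕ (cost e′ β ⊕ ((w ⊕ w′) ⊕ (w ⊕ w′) ⊕ (𝕂 1 ⊕ width (bin o e e′) β)))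
  where
  w  = 𝕂 1 ⊕ width e β
  w′ = 𝕂 1 ⊕ width e′ β
cost (sum x b e)   β =
  (polyExprCost b ⊕ (𝕂 1 ⊕ b)) ⊕
  (𝕂 2 ⊕ ((b ⊗ iterCost b w (cost e (β [ x ≔ₚ b ])) ⊕ 𝕂 2) ⊕ ((𝕂 1 ⊕ (b ⊕ w)) ⊕ (𝕂 1 ⊕ (b ⊕ w)))))
  where w = width e (β [ x ≔ₚ b ])
cost (let′ x e e′) β =
  cost e β ⊕ (cost e′ (β [ x ≔ₚ width e β ]) ⊕ ((𝕂 1 ⊕ w) ⊕ (𝕂 1 ⊕ w)))
  where w = width (let′ x e e′) β

record Env (k : ℕ) (η ρ r : ℕ → ℕ) : Set where
  constructor mkEnv
  field
    at : ∀ y → η y < k × r (η y) ≡ ρ y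

open Env

_≗[_]_ : (ℕ → ℕ) → ℕ → (ℕ → ℕ) → Set
r′ ≗[ k ] r = ∀ i → i < k → r′ i ≡ r i

≗-trans : ∀ {k r r′ r″} → r″ ≗[ k ] r′ → r′ ≗[ k ] r → r″ ≗[ k ] r
≗-trans p q i i<k = trans (p i i<k) (q i i<k)

≗-weaken : ∀ {k l r r′} → k ≤ l → r′ ≗[ l ] r → r′ ≗[ k ] r
≗-weaken k≤l p i i<k = p i (<-≤-trans i<k k≤l)

≗-upd : ∀ {k l r v} → k ≤ l → (r [ l ↦ v ]) ≗[ k ] r
≗-upd {r = r} k≤l i i<k = upd-other r (≢-sym (<⇒≢ (<-≤-trans i<k k≤l)))

env-≗ : ∀ {k η ρ r r′} → r′ ≗[ k ] r → Env k η ρ r → Env k η ρ r′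
at (env-≗ eq env) y with at env y
... | η< , r≡ = η< , trans (eq _ η<) r≡

env-upd : ∀ {k η ρ r} x {v} → Env k η ρ r → r k ≡ v → Env (suc k) (η [ x ↦ k ]) (ρ [ x ↦ v ]) r
at (env-upd x env rk) y with x ≡ᵇ y
... | true  = ≤-refl , rk
... | false with at env y
...   | η< , r≡ = m<n⇒m<1+n η< , r≡

env-weaken : ∀ {k l η ρ r} → k ≤ l → Env k η ρ r → Env l η ρ r
at (env-weaken k≤l env) y with at env y
... | η< , r≡ = <-≤-trans η< k≤l , r≡

Runs : Cmd → (ℕ → ℕ) → (ℕ → ℕ) → (ℕ → ℕ) → (ℕ → ℕ) → ℕ → Set
Runs c r m r′ m′ C = ∃[ k ] ⟨ c , ⟪ r , m ⟫ ⟩⇓ ⟪ r′ , m′ ⟫ ∣ k × k ≤ C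

runs-seq : ∀ {c c′ r m r′ m′ r″ m″ C C′} →
           Runs c r m r′ m′ C → Runs c′ r′ m′ r″ m″ C′ → Runs (c ⨾ c′) r m r″ m″ (C + C′)
runs-seq (_ , d , k≤) (_ , d′ , k≤′) = _ , ⇓seq d d′ , +-mono-≤ k≤ k≤′

runs-reg : ∀ {i e r m C C′} → evalCost e ⟪ r , m ⟫ ≤ C → len (eval e ⟪ r , m ⟫) ≤ C′ →
           Runs (i ≔ e) r m (r [ i ↦ eval e ⟪ r , m ⟫ ]) m (C + C′)
runs-reg p q = _ , ⇓reg , +-mono-≤ p q

Computes : ℕ → (ℕ → ℕ) → Tm → (ℕ → ℕ) → (ℕ → ℕ) → ℕ → ℕ → Set
Computes k η e r m v C = ∃[ r′ ] Runs (comp k η e) r m r′ m C × r′ ≗[ k ] r × r′ k ≡ v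

module _ {k z x : ℕ} {b : Poly} {η ρ m : ℕ → ℕ} {β : ℕ → Poly} (e : Tm) (ok : MemOK z m)
         (ρ≤ : ∀ y → Bits (β y) z (ρ y)) where

  private
    w = width e (β [ x ≔ₚ b ])
    c = cost e (β [ x ≔ₚ b ])

    f : ℕ → ℕ
    f i = val e (ρ [ x ↦ i ]) m

    body : Cmd
    body = k ≔ bin sub (reg k) (lit 1)
         ⨾ comp (2 + k) (η [ x ↦ k ]) e
         ⨾ suc k ≔ bin add (reg (suc k)) (reg (2 + k))

  -- The counter runs downwards because `Σ<` unfolds from its last summand. Accumulator plus
  -- outstanding sum, `a + Σ< j f`, stays constant, so its bound also bounds every intermediate
  -- accumulator.
  sum-loop :
    (∀ i r → Env (2 + k) (η [ x ↦ k ]) (ρ [ x ↦ i ]) r → i < ⟦ b ⟧ₚ (m 0) →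
      Computes (2 + k) (η [ x ↦ k ]) e r m (f i) (⟦ c ⟧ₚ z)) →
    ∀ j a r → j ≤ ⟦ b ⟧ₚ (m 0) → Env k η ρ r → r k ≡ j → r (suc k) ≡ a → Bits (b ⊕ w) z (a + Σ< j f) →
    ∃[ r′ ] Runs (while (reg k) body) r m r′ m (j * ⟦ iterCost b w c ⟧ₚ z + 2) ×
            r′ ≗[ k ] r × r′ (suc k) ≡ a + Σ< j f
  sum-loop comps zero a r j≤ env rk ra a≤ =
    r , (_ , ⇓exit rk , ≤-reflexive (cong₂ _+_ (cong len rk) (cong len rk))) ,
    (λ _ _ → refl) , trans ra (sym (+-identityʳ a))
  sum-loop comps (suc j) a r j< env rk ra a≤ = r₄ , (_ , ⇓loop rk≢0 d₃ d₄ , bound) , pres , out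
    where
    j≤   = <⇒≤ j<
    bj   = index-bits b {i = j} ok j≤
    bsj  = index-bits b {i = suc j} ok j<
    rk≢0 : r k ≢ 0
    rk≢0 eq with trans (sym rk) eq
    ... | ()
    r₁ = r [ k ↦ r k ∸ 1 ]
    r₁k : r₁ k ≡ j
    r₁k = trans (upd-same r k) (cong (_∸ 1) rk)
    env₁ : Env (2 + k) (η [ x ↦ k ]) (ρ [ x ↦ j ]) r₁
    env₁ = env-weaken (n≤1+n _) (env-upd x (env-≗ (≗-upd ≤-refl) env) r₁k)
    C₂ = comps j r₁ env₁ j<
    r₂ = proj₁ C₂
    pres₂ = proj₁ (proj₂ (proj₂ C₂))
    r₂v : r₂ (2 + k) ≡ f j
    r₂v = proj₂ (proj₂ (proj₂ C₂))
    r₂a : r₂ (suc k) ≡ a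
    r₂a = trans (pres₂ (suc k) ≤-refl) (trans (upd-other r (<⇒≢ (n<1+n k))) ra)
    r₂k : r₂ k ≡ j
    r₂k = trans (pres₂ k (m<n⇒m<1+n (n<1+n k))) r₁k
    r₃ = r₂ [ suc k ↦ r₂ (suc k) + r₂ (2 + k) ]
    r₃a : r₃ (suc k) ≡ a + f j
    r₃a = trans (upd-same r₂ (suc k)) (cong₂ _+_ r₂a r₂v)
    r₃k : r₃ k ≡ j
    r₃k = trans (upd-other r₂ (≢-sym (<⇒≢ (n<1+n k)))) r₂k
    pres₃ : r₃ ≗[ k ] r
    pres₃ = ≗-trans {r′ = r₂} (≗-upd (n≤1+n k))
              (≗-trans {r′ = r₁} (≗-weaken (≤-trans (n≤1+n k) (n≤1+n _)) pres₂) (≗-upd ≤-refl))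
    shift : a + f j + Σ< j f ≡ a + Σ< (suc j) f
    shift = +-assoc a (f j) (Σ< j f)
    rec = sum-loop comps j (a + f j) r₃ j≤ (env-≗ pres₃ env) r₃k r₃a
            (subst (Bits (b ⊕ w) z) (sym shift) a≤)
    r₄ = proj₁ rec
    ba : Bits (b ⊕ w) z a
    ba = ≤-trans (m≤m+n a _) a≤
    baf : Bits (b ⊕ w) z (a + f j)
    baf = ≤-trans (≤-trans (m≤m+n _ (Σ< j f)) (≤-reflexive shift)) a≤
    bf : Bits w z (f j)
    bf = val-bits e ok (bits-upd {β} {ρ} {x = x} {b} ρ≤ bj)
    lk : len (r k) ≤ ⟦ 𝕂 1 ⊕ b ⟧ₚ z
    lk = ≤-trans (≤-reflexive (cong len rk)) (len-bits b bsj)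
    run₃ : Runs body r m r₃ m _
    run₃ = runs-seq
      (runs-reg {C = ⟦ (𝕂 1 ⊕ b) ⊕ 𝕂 1 ⊕ ((𝕂 1 ⊕ b) ⊕ 𝕂 1) ⟧ₚ z} {C′ = ⟦ 𝕂 1 ⊕ b ⟧ₚ z}
        (+-mono-≤ (+-mono-≤ lk ≤-refl) (+-mono-≤ lk ≤-refl))
        (≤-trans (≤-reflexive (cong (λ v → len (v ∸ 1)) rk)) (len-bits b bj)))
      (runs-seq (proj₁ (proj₂ C₂)) (runs-reg
        {C = ⟦ (𝕂 1 ⊕ (b ⊕ w)) ⊕ (𝕂 1 ⊕ w) ⊕ ((𝕂 1 ⊕ (b ⊕ w)) ⊕ (𝕂 1 ⊕ w)) ⟧ₚ z}
        {C′ = ⟦ 𝕂 1 ⊕ (b ⊕ w) ⟧ₚ z}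
        (+-mono-≤ (+-mono-≤ la lf) (+-mono-≤ la lf))
        (≤-trans (≤-reflexive (cong len (cong₂ _+_ r₂a r₂v))) (len-bits (b ⊕ w) baf))))
      where
      la : len (r₂ (suc k)) ≤ ⟦ 𝕂 1 ⊕ (b ⊕ w) ⟧ₚ z
      la = ≤-trans (≤-reflexive (cong len r₂a)) (len-bits (b ⊕ w) ba)
      lf : len (r₂ (2 + k)) ≤ ⟦ 𝕂 1 ⊕ w ⟧ₚ z
      lf = ≤-trans (≤-reflexive (cong len r₂v)) (len-bits w bf)
    d₃ = proj₁ (proj₂ run₃)
    d₄ = proj₁ (proj₂ (proj₁ (proj₂ rec)))
    k₃ = proj₁ run₃
    k₄ = proj₁ (proj₁ (proj₂ rec))
    open ≤-Reasoning
    I = ⟦ iterCost b w c ⟧ₚ z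
    bound : len (r k) + len (r k) + (k₃ + k₄) ≤ suc j * I + 2
    bound = begin
      len (r k) + len (r k) + (k₃ + k₄)   ≡⟨ +-assoc (len (r k) + len (r k)) k₃ k₄ ⟨
      len (r k) + len (r k) + k₃ + k₄     ≤⟨ +-mono-≤ (+-mono-≤ (+-mono-≤ lk lk) (proj₂ (proj₂ run₃)))
                                               (proj₂ (proj₂ (proj₁ (proj₂ rec)))) ⟩
      I + (j * I + 2)                     ≡⟨ +-assoc I (j * I) 2 ⟨
      suc j * I + 2                       ∎
    pres : r₄ ≗[ k ] r
    pres = ≗-trans {r′ = r₃} (proj₁ (proj₂ (proj₂ rec))) pres₃
    out : r₄ (suc k) ≡ a + Σ< (suc j) f
    out = trans (proj₂ (proj₂ (proj₂ rec))) shift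

comp-correct : ∀ e {k z η ρ m β r} → MemOK z m → Env k η ρ r → (∀ y → Bits (β y) z (ρ y)) →
               Computes k η e r m (val e ρ m) (⟦ cost e β ⟧ₚ z)
comp-correct (lit c) {k} {r = r} ok env ρ≤ =
  _ , runs-reg ≤-refl ≤-refl , ≗-upd ≤-refl , upd-same r k
comp-correct (var x) {k} {η = η} {β = β} {r = r} ok env ρ≤ =
  _ , runs-reg lx lx , ≗-upd ≤-refl , trans (upd-same r k) eq
  where
  eq = proj₂ (at env x)
  lx : len (r (η x)) ≤ _
  lx = ≤-trans (≤-reflexive (cong len eq)) (len-bits (β x) (ρ≤ x))
comp-correct (rd e) {k} {ρ = ρ} {m} {β} ok env ρ≤ with comp-correct e ok env ρ≤
... | r₁ , run₁ , pres₁ , eq₁ =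
  _ , runs-seq run₁ (runs-reg (+-mono-≤ le (+-mono-≤ le lv)) lv) ,
  ≗-trans {r′ = r₁} (≗-upd ≤-refl) pres₁ , trans (upd-same r₁ k) (cong m eq₁)
  where
  le : len (r₁ k) ≤ _
  le = ≤-trans (≤-reflexive (cong len eq₁)) (len-bits (width e β) (val-bits e ok ρ≤))
  lv : len (m (r₁ k)) ≤ _
  lv = len-bits 𝕏 (cell ok _)
comp-correct (bin o e e′) {k} {z} {β = β} ok env ρ≤ with comp-correct e ok env ρ≤
... | r₁ , run₁ , pres₁ , eq₁
    with comp-correct e′ ok (env-weaken (n≤1+n k) (env-≗ pres₁ env)) ρ≤
...   | r₂ , run₂ , pres₂ , eq₂ =
  _ , runs-seq run₁ (runs-seq run₂ (runs-reg (+-mono-≤ (+-mono-≤ l₁ l₂) (+-mono-≤ l₁ l₂)) lv)) ,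
  ≗-trans {r′ = r₂} (≗-upd ≤-refl) (≗-trans {r′ = r₁} (≗-weaken (n≤1+n k) pres₂) pres₁) ,
  trans (upd-same r₂ k) (cong₂ ⟦ o ⟧ eq₁′ eq₂)
  where
  eq₁′ = trans (pres₂ k ≤-refl) eq₁
  l₁ : len (r₂ k) ≤ _
  l₁ = ≤-trans (≤-reflexive (cong len eq₁′)) (len-bits (width e β) (val-bits e ok ρ≤))
  l₂ : len (r₂ (suc k)) ≤ _
  l₂ = ≤-trans (≤-reflexive (cong len eq₂)) (len-bits (width e′ β) (val-bits e′ ok ρ≤))
  lv : len (⟦ o ⟧ (r₂ k) (r₂ (suc k))) ≤ _
  lv = ≤-trans (≤-reflexive (cong len (cong₂ ⟦ o ⟧ eq₁′ eq₂)))
         (len-bits (width (bin o e e′) β) (val-bits (bin o e e′) ok ρ≤))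
comp-correct (sum x b e) {k} {z} {η} {ρ} {m} {β} {r} ok env ρ≤ =
  _ , runs-seq (runs-reg (polyExpr-cost b _ (cell₀ ok)) (polyExpr-len b _ (cell₀ ok)))
      (runs-seq (runs-reg ≤-refl ≤-refl)
      (runs-seq (_ , proj₁ (proj₂ (proj₁ (proj₂ loop))) , loop≤)
                (runs-reg lv lv))) ,
  ≗-trans {r′ = r₃} (≗-upd ≤-refl) (≗-trans {r′ = r₂} (proj₁ (proj₂ (proj₂ loop))) pres₂) ,
  trans (upd-same r₃ k) out
  where
  open ≤-Reasoning
  N  = ⟦ b ⟧ₚ (m 0)
  w  = width e (β [ x ≔ₚ b ])
  I  = iterCost b w (cost e (β [ x ≔ₚ b ]))
  r₁ = r [ k ↦ eval (polyExpr b) ⟪ r , m ⟫ ]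
  r₂ = r₁ [ suc k ↦ 0 ]
  pres₂ : r₂ ≗[ k ] r
  pres₂ = ≗-trans {r′ = r₁} (≗-upd (n≤1+n k)) (≗-upd ≤-refl)
  r₂k : r₂ k ≡ N
  r₂k = trans (upd-other r₁ (≢-sym (<⇒≢ (n<1+n k)))) (trans (upd-same r k) (polyExpr-eval b _))
  loop = sum-loop {x = x} {b} {β = β} e ok ρ≤
    (λ i r′ env′ i< → comp-correct e ok env′
       (bits-upd {β} {ρ} {x = x} {b} ρ≤ (index-bits b ok (<⇒≤ i<))))
    N 0 r₂ ≤-refl (env-≗ pres₂ env) r₂k (upd-same r₁ (suc k)) (val-bits (sum x b e) ok ρ≤)
  r₃ = proj₁ loop
  out = proj₂ (proj₂ (proj₂ loop))
  loop≤ : proj₁ (proj₁ (proj₂ loop)) ≤ ⟦ b ⊗ I ⊕ 𝕂 2 ⟧ₚ z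
  loop≤ = ≤-trans (proj₂ (proj₂ (proj₁ (proj₂ loop))))
            (+-monoˡ-≤ 2 (*-monoˡ-≤ (⟦ I ⟧ₚ z) (poly-mono b (cell₀ ok))))
  lv : len (r₃ (suc k)) ≤ _
  lv = ≤-trans (≤-reflexive (cong len out)) (len-bits (b ⊕ w) (val-bits (sum x b e) ok ρ≤))
comp-correct (let′ x e e′) {k} {z} {η} {ρ} {β = β} ok env ρ≤ with comp-correct e ok env ρ≤
... | r₁ , run₁ , pres₁ , eq₁
    with comp-correct e′ ok (env-upd x (env-≗ pres₁ env) eq₁)
           (bits-upd {β} {ρ} {x = x} {width e β} ρ≤ (val-bits e ok ρ≤))
...   | r₂ , run₂ , pres₂ , eq₂ =
  _ , runs-seq run₁ (runs-seq run₂ (runs-reg lv lv)) ,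
  ≗-trans {r′ = r₂} (≗-upd ≤-refl) (≗-trans {r′ = r₁} (≗-weaken (n≤1+n k) pres₂) pres₁) ,
  trans (upd-same r₂ k) eq₂
  where
  lv : len (r₂ (suc k)) ≤ _
  lv = ≤-trans (≤-reflexive (cong len eq₂))
         (len-bits (width (let′ x e e′) β) (val-bits (let′ x e e′) ok ρ≤))

-- Filling tables

zeros : ℕ → ℕ
zeros _ = 0

noBits : ℕ → Poly
noBits _ = 𝕂 0

-- Registers 1, 2, 3 hold the base address, the number of entries left and the current index; the
-- value arrives in register 4. Register 0 stays 0 and stands for all unbound names.
fillBody : Tm → Cmd
fillBody body =
    comp 4 (zeros [ 0 ↦ 3 ]) body
  ⨾ [ bin add (reg 1) (reg 3) ]≔ reg 4
  ⨾ 3 ≔ bin add (reg 3) (lit 1)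
  ⨾ 2 ≔ bin sub (reg 2) (lit 1)

-- Name 0 is the index of the table entry.
fill : Tm → Tm → Tm → Cmd
fill base size body =
    comp 1 zeros base
  ⨾ comp 2 zeros size
  ⨾ 3 ≔ lit 0
  ⨾ while (reg 2) (fillBody body)

record Table (z B : ℕ) (Q : ℕ → ℕ → Set) (m₀ : ℕ → ℕ) (i : ℕ) (m : ℕ → ℕ) : Set where
  field
    ok    : MemOK z m
    below : ∀ a → a < B → m a ≡ m₀ a
    entry : ∀ j → j < i → Q j (m (B + j))

open Table public

-- Course-of-values recursion along the index: entry i may rely on all entries before it. The bound
-- on the value keeps `MemOK` true for the same z.
Steps : Tm → (z B N : ℕ) → (ℕ → ℕ → Set) → (ℕ → ℕ) → Set
Steps body z B N Q m₀ = ∀ i m → i < N → Table z B Q m₀ i m →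
  let v = val body (zeros [ 0 ↦ i ]) m in Q i v × v ≤ 2 ^ z

module _ (base size body : Tm) where

  private
    b  = width base noBits
    s  = width size noBits
    β  = noBits [ 0 ≔ₚ s ]
    Lb = 𝕂 1 ⊕ b
    Ls = 𝕂 1 ⊕ s
    Li = 𝕂 1 ⊕ (𝕂 1 ⊕ (s ⊕ 𝕂 1))
    La = 𝕂 1 ⊕ (𝕂 1 ⊕ (b ⊕ s))

  fillCost : Poly
  fillCost = cost base noBits ⊕ (cost size noBits ⊕ (𝕂 2 ⊕ 𝕂 2))

  fillIterCost : Poly
  fillIterCost =
    (Ls ⊕ Ls) ⊕
    (cost body β ⊕ ((Lb ⊕ Ls ⊕ (Lb ⊕ Ls) ⊕ (𝕂 1 ⊕ 𝕏) ⊕ (La ⊕ (𝕂 1 ⊕ 𝕏))) ⊕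
    (((Ls ⊕ 𝕂 1 ⊕ (Ls ⊕ 𝕂 1)) ⊕ Li) ⊕ (Ls ⊕ 𝕂 1 ⊕ (Ls ⊕ 𝕂 1) ⊕ Ls))))

  module _ {z : ℕ} {m₀ : ℕ → ℕ} {Q : ℕ → ℕ → Set} (ok₀ : MemOK z m₀) where

    private
      B = val base zeros m₀
      N = val size zeros m₀

    module _ (0<B : 0 < B)
             (step : Steps body z B N Q m₀) where

      private
        zeros-bits : ∀ y → Bits (noBits y) z (zeros y)
        zeros-bits y = z≤n

        bB : Bits b z B
        bB = val-bits base ok₀ zeros-bits

        bs : ∀ {i} → i ≤ N → Bits s z i
        bs i≤N = ≤-trans i≤N (val-bits size ok₀ zeros-bits)

        iteration : ∀ i j r m → i + suc j ≡ N → Table z B Q m₀ i m →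
                    r 0 ≡ 0 → r 1 ≡ B → r 2 ≡ suc j → r 3 ≡ i →
                    ∃[ r′ ] ∃[ m′ ] Runs (fillBody body) r m r′ m′
                      (⟦ cost body β ⊕ ((Lb ⊕ Ls ⊕ (Lb ⊕ Ls) ⊕ (𝕂 1 ⊕ 𝕏) ⊕ (La ⊕ (𝕂 1 ⊕ 𝕏))) ⊕
                         (((Ls ⊕ 𝕂 1 ⊕ (Ls ⊕ 𝕂 1)) ⊕ Li) ⊕ (Ls ⊕ 𝕂 1 ⊕ (Ls ⊕ 𝕂 1) ⊕ Ls))) ⟧ₚ z)
                      × Table z B Q m₀ (suc i) m′
                      × r′ 0 ≡ 0 × r′ 1 ≡ B × r′ 2 ≡ j × r′ 3 ≡ suc i
        iteration i j r m i+j tab r0 r1 r2 r3 =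
          r₃ , m′ ,
          runs-seq (proj₁ (proj₂ C)) (runs-seq store (runs-seq
            (runs-reg {C = ⟦ Ls ⊕ 𝕂 1 ⊕ (Ls ⊕ 𝕂 1) ⟧ₚ z} {C′ = ⟦ Li ⟧ₚ z}
              (+-mono-≤ (+-mono-≤ (l i≤N c3) ≤-refl) (+-mono-≤ (l i≤N c3) ≤-refl))
              (≤-trans (≤-reflexive (cong (λ v → len (v + 1)) c3))
                 (len-bits (𝕂 1 ⊕ (s ⊕ 𝕂 1)) (op-bits add {s} {𝕂 1} {u = i} (bs i≤N) (s≤s z≤n)))))
            (runs-reg {C = ⟦ Ls ⊕ 𝕂 1 ⊕ (Ls ⊕ 𝕂 1) ⟧ₚ z} {C′ = ⟦ Ls ⟧ₚ z}
              (+-mono-≤ (+-mono-≤ (l sj≤N c2) ≤-refl) (+-mono-≤ (l sj≤N c2) ≤-refl))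
              (≤-trans (≤-reflexive (cong (λ v → len (v ∸ 1)) c2)) (len-bits s (bs j≤N)))))) ,
          tab′ ,
          trans (pres 0 (s≤s z≤n)) r0 , c1 , cong (_∸ 1) c2 ,
          trans (cong (_+ 1) c3) (+-comm i 1)
          where
          sj≤N : suc j ≤ N
          sj≤N = ≤-trans (m≤n+m (suc j) i) (≤-reflexive i+j)
          j≤N : j ≤ N
          j≤N = ≤-trans (n≤1+n j) sj≤N
          i<N : i < N
          i<N = ≤-trans (m≤m+n (suc i) j) (≤-reflexive (trans (sym (+-suc i j)) i+j))
          i≤N = <⇒≤ i<N
          env : Env 4 (zeros [ 0 ↦ 3 ]) (zeros [ 0 ↦ i ]) r
          env = env-upd {k = 3} 0 (mkEnv λ y → s≤s z≤n , r0) r3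
          C = comp-correct body {β = β} (ok tab) env
                (bits-upd {noBits} {zeros} {z} {0} {s} zeros-bits (bs i≤N))
          r₁ = proj₁ C
          pres = proj₁ (proj₂ (proj₂ C))
          v = val body (zeros [ 0 ↦ i ]) m
          c4 : r₁ 4 ≡ v
          c4 = proj₂ (proj₂ (proj₂ C))
          c1 : r₁ 1 ≡ B
          c1 = trans (pres 1 (s≤s (s≤s z≤n))) r1
          c2 : r₁ 2 ≡ suc j
          c2 = trans (pres 2 (s≤s (s≤s (s≤s z≤n)))) r2
          c3 : r₁ 3 ≡ i
          c3 = trans (pres 3 (s≤s (s≤s (s≤s (s≤s z≤n))))) r3
          r₂ = r₁ [ 3 ↦ r₁ 3 + 1 ]
          r₃ = r₂ [ 2 ↦ r₂ 2 ∸ 1 ]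
          m′ = m [ r₁ 1 + r₁ 3 ↦ r₁ 4 ]
          addr : r₁ 1 + r₁ 3 ≡ B + i
          addr = cong₂ _+_ c1 c3
          Qv = proj₁ (step i m i<N tab)
          v≤ = proj₂ (step i m i<N tab)
          l : ∀ {u v} → u ≤ N → v ≡ u → len v ≤ ⟦ Ls ⟧ₚ z
          l u≤N refl = len-bits s (bs u≤N)
          lB : len (r₁ 1) ≤ ⟦ Lb ⟧ₚ z
          lB = ≤-trans (≤-reflexive (cong len c1)) (len-bits b bB)
          lv : len (r₁ 4) ≤ ⟦ 𝕂 1 ⊕ 𝕏 ⟧ₚ z
          lv = ≤-trans (≤-reflexive (cong len c4)) (len-bits 𝕏 v≤)
          la : len (r₁ 1 + r₁ 3) ≤ ⟦ La ⟧ₚ z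
          la = ≤-trans (≤-reflexive (cong len addr))
                 (len-bits (𝕂 1 ⊕ (b ⊕ s)) (op-bits add {b} {s} bB (bs i≤N)))
          store : Runs ([ bin add (reg 1) (reg 3) ]≔ reg 4) r₁ m r₁ m′
                    (⟦ Lb ⊕ Ls ⊕ (Lb ⊕ Ls) ⊕ (𝕂 1 ⊕ 𝕏) ⊕ (La ⊕ (𝕂 1 ⊕ 𝕏)) ⟧ₚ z)
          store = _ , ⇓mem ,
            +-mono-≤ (+-mono-≤ (+-mono-≤ (+-mono-≤ lB (l i≤N c3)) (+-mono-≤ lB (l i≤N c3))) lv)
                     (+-mono-≤ la lv)
          at-i : m′ (B + i) ≡ v
          at-i = trans (cong m′ (sym addr)) (trans (upd-same m (r₁ 1 + r₁ 3)) c4)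
          off : ∀ a → a ≢ B + i → m′ a ≡ m a
          off a a≢ = upd-other m (λ eq → a≢ (trans (sym eq) addr))
          ok′ : ∀ a → m′ a ≤ 2 ^ z
          ok′ a with a ≟ B + i
          ... | yes refl = ≤-trans (≤-reflexive at-i) v≤
          ... | no a≢    = ≤-trans (≤-reflexive (off a a≢)) (cell (ok tab) a)
          below-≢ : ∀ a → a < B → a ≢ B + i
          below-≢ a a<B = <⇒≢ (<-≤-trans a<B (m≤m+n B i))
          tab′ : Table z B Q m₀ (suc i) m′
          ok tab′ = record
            { cell  = ok′
            ; cell₀ = ≤-trans (≤-reflexive (off 0 (below-≢ 0 0<B))) (cell₀ (ok tab)) }
          below tab′ a a<B = trans (off a (below-≢ a a<B)) (below tab a a<B)
          entry tab′ j j<si with j ≟ i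
          ... | yes refl = subst (Q i) (sym at-i) Qv
          ... | no j≢i   = subst (Q j) (sym (off (B + j) (λ eq → j≢i (+-cancelˡ-≡ B j i eq))))
                             (entry tab j (≤∧≢⇒< (s≤s⁻¹ j<si) j≢i))

        loop : ∀ j i r m → i + j ≡ N → Table z B Q m₀ i m →
               r 0 ≡ 0 → r 1 ≡ B → r 2 ≡ j → r 3 ≡ i →
               ∃[ r′ ] ∃[ m′ ] Runs (while (reg 2) (fillBody body)) r m r′ m′ (j * ⟦ fillIterCost ⟧ₚ z + 2)
                 × Table z B Q m₀ N m′ × r′ 0 ≡ 0
        loop zero i r m i+j tab r0 r1 r2 r3 =
          r , m , (_ , ⇓exit r2 , ≤-reflexive (cong₂ _+_ (cong len r2) (cong len r2))) ,
          subst (λ i → Table z B Q m₀ i m) (trans (sym (+-identityʳ i)) i+j) tab , r0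
        loop (suc j) i r m i+j tab r0 r1 r2 r3
          with iteration i j r m i+j tab r0 r1 r2 r3
        ... | r′ , m′ , (k , d , k≤) , tab′ , r0′ , r1′ , r2′ , r3′
            with loop j (suc i) r′ m′ (trans (sym (+-suc i j)) i+j) tab′ r0′ r1′ r2′ r3′
        ...   | r″ , m″ , (k′ , d′ , k≤′) , tab″ , r0″ =
          r″ , m″ , (_ , ⇓loop r2≢0 d d′ , bound) , tab″ , r0″
          where
          open ≤-Reasoning
          I = ⟦ fillIterCost ⟧ₚ z
          r2≢0 : r 2 ≢ 0
          r2≢0 eq with trans (sym r2) eq
          ... | ()
          l : len (r 2) ≤ ⟦ Ls ⟧ₚ z
          l = ≤-trans (≤-reflexive (cong len r2))
                (len-bits s (bs (≤-trans (m≤n+m (suc j) i) (≤-reflexive i+j))))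
          bound : len (r 2) + len (r 2) + (k + k′) ≤ suc j * I + 2
          bound = begin
            len (r 2) + len (r 2) + (k + k′)   ≡⟨ +-assoc (len (r 2) + len (r 2)) k k′ ⟨
            len (r 2) + len (r 2) + k + k′     ≤⟨ +-mono-≤ (+-mono-≤ (+-mono-≤ l l) k≤) k≤′ ⟩
            I + (j * I + 2)                    ≡⟨ +-assoc I (j * I) 2 ⟨
            suc j * I + 2                      ∎

      fill-correct : ∀ r → r 0 ≡ 0 →
        ∃[ r′ ] ∃[ m′ ] Runs (fill base size body) r m₀ r′ m′ (⟦ fillCost ⟧ₚ z + N * ⟦ fillIterCost ⟧ₚ z)
          × Table z B Q m₀ N m′ × r′ 0 ≡ 0
      fill-correct r r0
        with comp-correct base {k = 1} {β = noBits} ok₀ (mkEnv λ y → s≤s z≤n , r0) zeros-bits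
      ... | r₁ , run₁ , pres₁ , eq₁
          with comp-correct size {k = 2} {β = noBits} ok₀
                 (mkEnv λ y → s≤s z≤n , trans (pres₁ 0 (s≤s z≤n)) r0) zeros-bits
      ...   | r₂ , run₂ , pres₂ , eq₂
            with loop N 0 (r₂ [ 3 ↦ 0 ]) m₀ refl
                   (record { ok = ok₀ ; below = λ _ _ → refl ; entry = λ _ () })
                   (trans (pres₂ 0 (s≤s z≤n)) (trans (pres₁ 0 (s≤s z≤n)) r0))
                   (trans (pres₂ 1 (s≤s (s≤s z≤n))) eq₁) eq₂ refl
      ...     | r₃ , m₃ , run₃ , tab , r0′ =
        r₃ , m₃ ,
        weaken (runs-seq run₁ (runs-seq run₂ (runs-seq (runs-reg {C = 1} {C′ = 1} ≤-refl ≤-refl) run₃))) ,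
        tab , r0′
        where
        open ≤-Reasoning
        c₁ = ⟦ cost base noBits ⟧ₚ z
        c₂ = ⟦ cost size noBits ⟧ₚ z
        L  = N * ⟦ fillIterCost ⟧ₚ z
        weaken : ∀ {r m r′ m′} → Runs (fill base size body) r m r′ m′ (c₁ + (c₂ + (2 + (L + 2)))) →
                 Runs (fill base size body) r m r′ m′ (⟦ fillCost ⟧ₚ z + L)
        weaken (k , d , k≤) = k , d , (begin
          k                             ≤⟨ k≤ ⟩
          c₁ + (c₂ + (2 + (L + 2)))     ≡⟨ cong (λ x → c₁ + (c₂ + (2 + x))) (+-comm L 2) ⟩
          c₁ + (c₂ + (4 + L))           ≡⟨ cong (c₁ +_) (+-assoc c₂ 4 L) ⟨
          c₁ + (c₂ + 4 + L)             ≡⟨ +-assoc c₁ (c₂ + 4) L ⟨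
          c₁ + (c₂ + 4) + L             ∎)

-- Truth values, sums and codes

-- `Truth (regs s 0) P` unfolds to `Answers P s`, so a truth value left in register 0 is an answer
-- as it stands.
Truth : ℕ → Set → Set
Truth x P = (x ≡ 1 × P) ⊎ (x ≡ 0 × ¬ P)

truth-dec : ∀ {x P} → Truth x P → Dec P
truth-dec (inj₁ (_ , p))  = yes p
truth-dec (inj₂ (_ , ¬p)) = no ¬p

truth-map : ∀ {x P Q} → (P → Q) → (Q → P) → Truth x P → Truth x Q
truth-map f g (inj₁ (x≡1 , p))  = inj₁ (x≡1 , f p)
truth-map f g (inj₂ (x≡0 , ¬p)) = inj₂ (x≡0 , ¬p ∘ g)

truth-unit : Truth 1 Unit
truth-unit = inj₁ (refl , tt)

truth-≤1 : ∀ {x P} → Truth x P → x ≤ 1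
truth-≤1 (inj₁ (refl , _)) = ≤-refl
truth-≤1 (inj₂ (refl , _)) = z≤n

truth-¬ : ∀ {x P} → Truth x P → Truth (1 ∸ x) (¬ P)
truth-¬ (inj₁ (refl , p))  = inj₂ (refl , λ ¬p → ¬p p)
truth-¬ (inj₂ (refl , ¬p)) = inj₁ (refl , ¬p)

-- The second factor may be junk when the first one is false.
truth-× : ∀ {x y P Q} → Truth x P → (P → Truth y Q) → Truth (x * y) (P × Q)
truth-× (inj₂ (refl , ¬p)) ty = inj₂ (refl , ¬p ∘ proj₁)
truth-× {y = y} (inj₁ (refl , p)) ty with ty p
... | inj₁ (refl , q)  = inj₁ (refl , p , q)
... | inj₂ (refl , ¬q) = inj₂ (refl , ¬q ∘ proj₂)

truth-⊎ : ∀ {x y P Q} → Truth x P → Truth y Q → Truth (1 ∸ (1 ∸ x) * (1 ∸ y)) (P ⊎ Q)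
truth-⊎ (inj₁ (refl , p)) ty                    = inj₁ (refl , inj₁ p)
truth-⊎ (inj₂ (refl , ¬p)) (inj₁ (refl , q))    = inj₁ (refl , inj₂ q)
truth-⊎ (inj₂ (refl , ¬p)) (inj₂ (refl , ¬q))   = inj₂ (refl , [ ¬p , ¬q ]′)

truth-≤ : ∀ x y → Truth (1 ∸ (x ∸ y)) (x ≤ y)
truth-≤ x y with x ≤? y
... | yes x≤y rewrite m≤n⇒m∸n≡0 x≤y = inj₁ (refl , x≤y)
... | no ¬x≤y with x ∸ y in eq
...   | zero  = ⊥-elim (¬x≤y (m∸n≡0⇒m≤n eq))
...   | suc d = inj₂ (0∸n≡0 d , ¬x≤y)

truth-≡ : ∀ x y → Truth ((1 ∸ (x ∸ y)) * (1 ∸ (y ∸ x))) (x ≡ y)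
truth-≡ x y = truth-map (uncurry ≤-antisym) (λ { refl → ≤-refl , ≤-refl })
                (truth-× (truth-≤ x y) λ _ → truth-≤ y x)

truth-⇔ : ∀ {x y P Q} → Truth x P → Truth y Q →
          Truth ((1 ∸ (x ∸ y)) * (1 ∸ (y ∸ x))) ((P → Q) × (Q → P))
truth-⇔ (inj₁ (refl , p))  (inj₁ (refl , q))  = inj₁ (refl , (λ _ → q) , (λ _ → p))
truth-⇔ (inj₁ (refl , p))  (inj₂ (refl , ¬q)) = inj₂ (refl , λ (f , _) → ¬q (f p))
truth-⇔ (inj₂ (refl , ¬p)) (inj₁ (refl , q))  = inj₂ (refl , λ (_ , g) → ¬p (g q))
truth-⇔ (inj₂ (refl , ¬p)) (inj₂ (refl , ¬q)) = inj₁ (refl , ⊥-elim ∘ ¬p , ⊥-elim ∘ ¬q)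

-- `1 ∸ (1 ∸ x)` is min(x, 1): the sum counts witnesses, and this cuts the count down to a truth
-- value.
truth-∃ : ∀ n f {P : ℕ → Set} → (∀ i → i < n → Truth (f i) (P i)) →
          Truth (1 ∸ (1 ∸ Σ< n f)) (∃[ i ] i < n × P i)
truth-∃ zero    f t = inj₂ (refl , λ { (_ , () , _) })
truth-∃ (suc n) f t with t n ≤-refl
... | inj₁ (eq , p) rewrite eq | 0∸n≡0 (Σ< n f) = inj₁ (refl , n , ≤-refl , p)
... | inj₂ (eq , ¬p) rewrite eq =
  truth-map (λ (i , i<n , p) → i , m<n⇒m<1+n i<n , p)
            (λ { (i , i<sn , p) → i , ≤∧≢⇒< (s≤s⁻¹ i<sn) (λ { refl → ¬p p }) , p })
            (truth-∃ n f λ i i<n → t i (m<n⇒m<1+n i<n))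

truth-∃Fin : ∀ {n N f} {P : Fin n → Set} → N ≡ n → (∀ i → Truth (f (toℕ i)) (P i)) →
             Truth (1 ∸ (1 ∸ Σ< N f)) (∃[ i ] P i)
truth-∃Fin {n} {f = f} {P} refl t =
  truth-map (λ (i , i<n , p) → fromℕ< i<n , p i<n)
            (λ (i , p) → toℕ i , toℕ<n i , λ i<n → subst P (sym (fromℕ<-toℕ i i<n)) p)
            -- On numbers the predicate takes the proof of `i < n` as an argument; all such proofs
            -- give the same element of `Fin n`.
            (truth-∃ n f {P = λ i → (i<n : i < n) → P (fromℕ< i<n)} λ i i<n →
              truth-map (λ p i<n′ → subst P (fromℕ<-irr i<n i<n′) p) (λ p → p i<n)
                (subst (λ j → Truth (f j) (P (fromℕ< i<n))) (toℕ-fromℕ< i<n) (t (fromℕ< i<n))))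
  where
  fromℕ<-irr : ∀ {i} (p q : i < n) → fromℕ< p ≡ fromℕ< q
  fromℕ<-irr p q = fromℕ<-cong _ _ refl p q

-- `Σ<` splits off its last summand, whereas recursion on `Fin (suc n)` splits off `zero`.
Σ<-shift : ∀ n f → Σ< (suc n) f ≡ f 0 + Σ< n (f ∘ suc)
Σ<-shift zero    f = refl
Σ<-shift (suc n) f = begin
    f (suc n) + Σ< (suc n) f                ≡⟨ cong (f (suc n) +_) (Σ<-shift n f) ⟩
    f (suc n) + (f 0 + Σ< n (f ∘ suc))      ≡⟨ +-assoc (f (suc n)) (f 0) _ ⟨
    f (suc n) + f 0 + Σ< n (f ∘ suc)        ≡⟨ cong (_+ Σ< n (f ∘ suc)) (+-comm (f (suc n)) (f 0)) ⟩
    f 0 + f (suc n) + Σ< n (f ∘ suc)        ≡⟨ +-assoc (f 0) (f (suc n)) _ ⟩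
    f 0 + Σ< (suc n) (f ∘ suc)              ∎
  where open ≡-Reasoning

-- Gives a computed count its content: the double sum κ becomes the length of a duplicate-free list
-- of all covering pairs, along which arcs can be chosen one by one.
record Listing {A : Set} (P : A → Set) (k : ℕ) : Set where
  field
    elems  : List A
    nodup : Unique elems
    holds  : All P elems
    exhaustive   : ∀ {x} → P x → x ∈ˡ elems
    count   : length elems ≡ k

open Listing

listing-Fin : ∀ n f {P : Fin n → Set} → (∀ i → Truth (f (toℕ i)) (P i)) → Listing P (Σ< n f)
listing-Fin zero    f t = record { elems = [] ; nodup = [] ; holds = [] ; exhaustive = λ { {()} } ; count = refl }
listing-Fin (suc n) f {P} t = subst (Listing P) (sym (Σ<-shift n f)) (go (t zero) (listing-Fin n (f ∘ suc) (t ∘ suc)))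
  where
  lift : ∀ {k} (L : Listing (P ∘ suc) k) → Listing (λ i → ∃[ j ] i ≡ suc j × P (suc j)) k
  lift L = record
    { elems  = map suc (elems L)
    ; nodup = Unique.map⁺ (λ { refl → refl }) (nodup L)
    ; holds  = All.map⁺ (All.map (λ p → _ , refl , p) (holds L))
    ; exhaustive   = λ { (_ , refl , p) → ∈-map⁺ suc (exhaustive L p) }
    ; count   = trans (length-map suc (elems L)) (count L) }
  go : ∀ {x k} → Truth x (P zero) → Listing (P ∘ suc) k → Listing P (x + k)
  go (inj₁ (refl , p)) L = record
    { elems  = zero ∷ elems L′
    ; nodup = All.map (λ { (_ , refl , _) () }) (holds L′) ∷ nodup L′
    ; holds  = p ∷ All.map (λ { (_ , refl , q) → q }) (holds L′)
    ; exhaustive   = λ { {zero} _ → here refl ; {suc i} q → there (exhaustive L′ (i , refl , q)) }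
    ; count   = cong suc (count L′) }
    where L′ = lift L
  go (inj₂ (refl , ¬p)) L = record
    { elems  = elems L′
    ; nodup = nodup L′
    ; holds  = All.map (λ { (_ , refl , q) → q }) (holds L′)
    ; exhaustive   = λ { {zero} q → ⊥-elim (¬p q) ; {suc i} q → exhaustive L′ (i , refl , q) }
    ; count   = count L′ }
    where L′ = lift L

listing-× : ∀ {B : Set} n (g : ℕ → ℕ) {P : Fin n → B → Set} → (∀ i → Listing (P i) (g (toℕ i))) →
            Listing (uncurry P) (Σ< n g)
listing-× zero    g L = record { elems = [] ; nodup = [] ; holds = [] ; exhaustive = λ { {() , _} } ; count = refl }
listing-× {B} (suc n) g {P} L = subst (Listing (uncurry P)) (sym (Σ<-shift n g)) (record
  { elems  = xs ++ ys
  ; nodup = Unique.++⁺ (Unique.map⁺ (cong proj₂) (nodup L₀)) (Unique.map⁺ (λ { refl → refl }) (nodup L₁)) disjoint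
  ; holds  = All.++⁺ (All.map⁺ (holds L₀)) (All.map⁺ (holds L₁))
  ; exhaustive   = λ { {zero , b} p → ∈-++⁺ˡ (∈-map⁺ (zero ,_) (exhaustive L₀ p))
               ; {suc i , b} p → ∈-++⁺ʳ xs (∈-map⁺ up (exhaustive L₁ p)) }
  ; count   = trans (length-++ xs) (cong₂ _+_ (trans (length-map _ (elems L₀)) (count L₀))
                                              (trans (length-map _ (elems L₁)) (count L₁))) })
  where
  up : Fin n × B → Fin (suc n) × B
  up (i , b) = suc i , b
  L₀ = L zero
  L₁ = listing-× n (g ∘ suc) {P ∘ suc} (L ∘ suc)
  xs = map (zero ,_) (elems L₀)
  ys = map up (elems L₁)
  disjoint : ∀ {x} → ¬ (x ∈ˡ xs × x ∈ˡ ys)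
  disjoint (x∈ , y∈) with ∈-map⁻ (zero ,_) x∈ | ∈-map⁻ up y∈
  ... | _ , _ , refl | _ , _ , ()

-- Mixed-radix table indices, and vertex sets as binary numbers

div-code : ∀ n q {r} → r < n → ⟦ div ⟧ (n * q + r) n ≡ q
div-code n@(suc _) q {r} r<n = begin
    (n * q + r) / n        ≡⟨ cong (_/ n) (cong (_+ r) (*-comm n q)) ⟩
    (q * n + r) / n        ≡⟨ +-distrib-/ (q * n) r (subst (_< n) (sym rem) r<n) ⟩
    q * n / n + r / n      ≡⟨ cong₂ _+_ (m*n/n≡m q n) (m<n⇒m/n≡0 r<n) ⟩
    q + 0                  ≡⟨ +-identityʳ q ⟩
    q                      ∎
  where
  open ≡-Reasoning
  rem : (q * n) % n + r % n ≡ r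
  rem = cong₂ _+_ (m*n%n≡0 q n) (m<n⇒m%n≡m r<n)

mod-code : ∀ n q {r} → r < n → (n * q + r) ∸ n * ⟦ div ⟧ (n * q + r) n ≡ r
mod-code n q {r} r<n rewrite div-code n q r<n = m+n∸m≡n (n * q) r

-- The leading digit decides the order of codes. This serves twice: codes stay within their table,
-- and a state of an earlier stage has a smaller index.
code-< : ∀ n {q q′ r} → q < q′ → r < n → n * q + r < n * q′
code-< n {q} {q′} {r} q<q′ r<n = begin-strict
    n * q + r    <⟨ +-monoʳ-< (n * q) r<n ⟩
    n * q + n    ≡⟨ +-comm (n * q) n ⟩
    n + n * q    ≡⟨ *-suc n q ⟨
    n * suc q    ≤⟨ *-monoʳ-≤ n q<q′ ⟩
    n * q′       ∎
  where open ≤-Reasoning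

-- The head of the vector is the lowest binary digit, so that vertex v has weight 2^v.
num : ∀ {n} → Subset n → ℕ
num []      = 0
num (b ∷ T) = 2 * num T + bit b

bit<2 : ∀ b → bit b < 2
bit<2 true  = s≤s (s≤s z≤n)
bit<2 false = s≤s z≤n

num< : ∀ {n} (T : Subset n) → num T < 2 ^ n
num< []      = s≤s z≤n
num< (b ∷ T) = code-< 2 (num< T) (bit<2 b)

num-⊤ : ∀ n → num (⊤ {n}) ≡ 2 ^ n ∸ 1
num-⊤ n = cong (_∸ 1) (suc-num n)
  where
  suc-num : ∀ n → suc (num (⊤ {n})) ≡ 2 ^ n
  suc-num zero    = refl
  suc-num (suc n) = begin
    suc (2 * num (⊤ {n}) + 1)     ≡⟨ cong suc (+-comm (2 * num (⊤ {n})) 1) ⟩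
    2 + 2 * num (⊤ {n})           ≡⟨ *-suc 2 (num (⊤ {n})) ⟨
    2 * suc (num (⊤ {n}))         ≡⟨ cong (2 *_) (suc-num n) ⟩
    2 * 2 ^ n                     ∎
    where open ≡-Reasoning

2^≤num : ∀ {n} {T : Subset n} {v} → v ∈ T → 2 ^ toℕ v ≤ num T
2^≤num {T = true ∷ T} here = m≤n+m 1 (2 * num T)
2^≤num {T = b ∷ T} (there v∈) = ≤-trans (*-monoʳ-≤ 2 (2^≤num v∈)) (m≤m+n (2 * num T) (bit b))

-- Lets the program pass from T to `T - v` by subtracting a tabulated power of two.
num-remove : ∀ {n} {T : Subset n} {v} → v ∈ T → num (T - v) ≡ num T ∸ 2 ^ toℕ v
num-remove {T = true ∷ T} here = begin
    2 * num (T ─ ∅) + 0     ≡⟨ +-identityʳ _ ⟩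
    2 * num (T ─ ∅)         ≡⟨ cong (λ T → 2 * num T) (p─⊥≡p T) ⟩
    2 * num T               ≡⟨ m+n∸n≡m (2 * num T) 1 ⟨
    2 * num T + 1 ∸ 1       ∎
  where open ≡-Reasoning
num-remove {T = b ∷ T} {suc v} (there v∈) = begin
    2 * num (T - v) + bit b                 ≡⟨ cong (λ x → 2 * x + bit b) (num-remove v∈) ⟩
    2 * (num T ∸ 2 ^ toℕ v) + bit b         ≡⟨ cong (_+ bit b) (*-distribˡ-∸ 2 (num T) (2 ^ toℕ v)) ⟩
    2 * num T ∸ 2 * 2 ^ toℕ v + bit b       ≡⟨ +-∸-comm (bit b) (*-monoʳ-≤ 2 (2^≤num v∈)) ⟨
    2 * num T + bit b ∸ 2 * 2 ^ toℕ v       ∎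
  where open ≡-Reasoning

div-/ : ∀ m k .{{_ : NonZero k}} → ⟦ div ⟧ m k ≡ m / k
div-/ m (suc k) = refl

-- Division by 2^v shifts the digit of v to the lowest place, where the remainder modulo 2 reads it.
-- In the induction one factor 2 is divided out first, which drops the head of the vector.
truth-bit : ∀ {n} (T : Subset n) v →
            let q = ⟦ div ⟧ (num T) (2 ^ toℕ v) in Truth (q ∸ 2 * ⟦ div ⟧ q 2) (v ∈ T)
truth-bit (b ∷ T) zero rewrite n/1≡n (num (b ∷ T)) | mod-code 2 (num T) (bit<2 b) with b
... | true  = inj₁ (refl , here)
... | false = inj₂ (refl , λ ())
truth-bit (b ∷ T) (suc v) =
  truth-map there drop-there (subst (λ q → Truth (q ∸ 2 * ⟦ div ⟧ q 2) (v ∈ T)) (sym eq) (truth-bit T v))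
  where
  open ≡-Reasoning
  instance
    2^v≢0 = m^n≢0 2 (toℕ v)
    2^sv≢0 = m^n≢0 2 (suc (toℕ v))
  x = 2 * num T + bit b
  eq : ⟦ div ⟧ x (2 ^ suc (toℕ v)) ≡ ⟦ div ⟧ (num T) (2 ^ toℕ v)
  eq = begin
    ⟦ div ⟧ x (2 ^ suc (toℕ v))     ≡⟨ div-/ x (2 ^ suc (toℕ v)) ⟩
    x / (2 * 2 ^ toℕ v)             ≡⟨ m/n/o≡m/[n*o] x 2 (2 ^ toℕ v) ⟨
    x / 2 / 2 ^ toℕ v               ≡⟨ cong (_/ 2 ^ toℕ v) (div-code 2 (num T) (bit<2 b)) ⟩
    num T / 2 ^ toℕ v               ≡⟨ div-/ (num T) (2 ^ toℕ v) ⟨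
    ⟦ div ⟧ (num T) (2 ^ toℕ v)     ∎

-- Ear decompositions

x∉p-x : ∀ {n} (p : Subset n) x → x ∉ p - x
x∉p-x (_ ∷ p) (suc x) (there x∈) = x∉p-x p x x∈

∈-remove⁻ : ∀ {n} {T : Subset n} {x y} → x ∈ T - y → x ∈ T × x ≢ y
∈-remove⁻ {T = T} {x} {y} x∈ = p─q⊆p T ⁅ y ⁆ x∈ , λ { refl → x∉p-x T x x∈ }

∈-add⁻ : ∀ {n} {T : Subset n} {x y} → x ∈ T ∪ ⁅ y ⁆ → x ∈ T ⊎ x ≡ y
∈-add⁻ {T = T} {x} {y} x∈ with x∈p∪q⁻ T ⁅ y ⁆ x∈
... | inj₁ x∈T = inj₁ x∈T
... | inj₂ x∈y = inj₂ (x∈⁅y⁆⇒x≡y y x∈y)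

⊆-add : ∀ {n} {T : Subset n} {x y} → x ∈ T → x ∈ T ∪ ⁅ y ⁆
⊆-add x∈ = x∈p∪q⁺ (inj₁ x∈)

self-add : ∀ {n} {T : Subset n} y → y ∈ T ∪ ⁅ y ⁆
self-add y = x∈p∪q⁺ (inj₂ (x∈⁅x⁆ y))

-- `Reach` refers to the set before its newest vertex came in, while ears are grown by adding
-- vertices; this passes between the two views.
add-remove : ∀ {n} {T : Subset n} {v} → v ∉ T → (T ∪ ⁅ v ⁆) - v ≡ T
add-remove {T = T} {v} v∉T = ⊆-antisym
  (λ x∈ → [ (λ x∈T → x∈T) , (λ x≡v → ⊥-elim (proj₂ (∈-remove⁻ x∈) x≡v)) ]′ (∈-add⁻ (proj₁ (∈-remove⁻ x∈))))
  (λ {x} x∈T → x∈p∧x≢y⇒x∈p-y (⊆-add x∈T) λ { refl → v∉T x∈T })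

module Ears {n : ℕ} (R Ok : Fin n → Fin n → Set) (Init : Subset n → Set) where

  -- Reach c T v w: with c arcs, a subgraph has been built that a path from v
  -- to w turns into one with the required connectivity on T.  An ear is
  -- grown vertex by vertex by ext, w being its end fixed in advance, and
  -- fin adds its last inner vertex x together with both arcs at x.  In the
  -- undirected case Ok u y is u ≢ y, so that the two arcs are distinct edges.
  data Reach : ℕ → Subset n → Fin n → Fin n → Set where
    init : ∀ {T v w} → Init T → v ∈ T → w ∈ T → Reach 0 T v w
    ext  : ∀ {c T u v w} → v ∈ T → R u v → Reach c (T - v) u w → Reach (1 + c) T v w
    fin  : ∀ {c T a b u x y} → a ∈ T → b ∈ T → x ∈ T → R u x → R x y → Ok u y →
           Reach c (T - x) u y → Reach (2 + c) T a b

  reach-∈ : ∀ {c T v w} → Reach c T v w → v ∈ T × w ∈ T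
  reach-∈ (init _ v∈ w∈)         = v∈ , w∈
  reach-∈ (ext v∈ _ r)           = v∈ , proj₁ (∈-remove⁻ (proj₂ (reach-∈ r)))
  reach-∈ (fin a∈ b∈ _ _ _ _ _) = a∈ , b∈

  -- `_~_` says which vertices are to be connected with each other, namely those of one strong
  -- component of the input. An initial set satisfies this without arcs because it has at most one
  -- vertex in each class.
  module Soundness (_~_ : Fin n → Fin n → Set)
                   (~-sym : ∀ {a b} → a ~ b → b ~ a) (~-trans : ∀ {a b c} → a ~ b → b ~ c → a ~ c)
                   (~-refl : ∀ {a} → a ~ a)
                   (R⇒~ : ∀ {a b} → R a b → a ~ b)
                   (init-~ : ∀ {T a b} → Init T → a ∈ T → b ∈ T → a ~ b → a ≡ b) where

    -- An open ear is a promise: whichever relation `Y` finally supplies the missing path from v to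
    -- w, T becomes connected within classes. Quantifying over `Y` lets that path use vertices and
    -- arcs not chosen yet.
    Connects : List (Fin n × Fin n) → Subset n → Fin n → Fin n → Set₁
    Connects xs T v w = ∀ (Y : Fin n → Fin n → Set) → (∀ {a b} → (a , b) ∈ˡ xs → Y a b) →
      (∀ {a b} → Y a b → a ~ b) → Star Y v w → ∀ {a b} → a ∈ T → b ∈ T → a ~ b → Star Y a b

    NoAntiparallel : List (Fin n × Fin n) → Set
    NoAntiparallel xs = ∀ {a b} → (a , b) ∈ˡ xs → (b , a) ∉ˡ xs

    record Built (c : ℕ) (T : Subset n) (v w : Fin n) : Set₁ where
      field
        arcs     : List (Fin n × Fin n)
        length≤  : length arcs ≤ c
        arcs-R   : ∀ {a b} → (a , b) ∈ˡ arcs → R a b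
        inside   : ∀ {a b} → (a , b) ∈ˡ arcs → a ∈ T × b ∈ T
        connects : Connects arcs T v w
        oriented : (∀ {u w} → Ok u w → u ≢ w) → NoAntiparallel arcs

    open Built

    star-~ : ∀ {Y : Fin n → Fin n → Set} → (∀ {a b} → Y a b → a ~ b) → ∀ {a b} → Star Y a b → a ~ b
    star-~ Y⇒~ ε       = ~-refl
    star-~ Y⇒~ (y ◅ p) = ~-trans (Y⇒~ y) (star-~ Y⇒~ p)

    -- The path from v to w, preceded by the arc u → v, is the path that the smaller state asks for.
    -- The new vertex v is entered from u and left along the path to w.
    connects-ext : ∀ {xs T u v w} → u ∈ T - v → w ∈ T - v → Connects xs (T - v) u w → Connects ((u , v) ∷ xs) T v w
    connects-ext {xs} {T} {u} {v} {w} u∈ w∈ conn Y Y⊇ Y⇒~ p = go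
      where
      uv = Y⊇ (here refl)
      old : ∀ {a b} → a ∈ T - v → b ∈ T - v → a ~ b → Star Y a b
      old = conn Y (λ e → Y⊇ (there e)) Y⇒~ (uv ◅ p)
      v~w = star-~ Y⇒~ p
      go : ∀ {a b} → a ∈ T → b ∈ T → a ~ b → Star Y a b
      go {a} {b} a∈ b∈ a~b with a ≟ᶠ v | b ≟ᶠ v
      ... | yes refl | yes refl = ε
      ... | yes refl | no b≢    = p ◅◅ old w∈ (x∈p∧x≢y⇒x∈p-y b∈ b≢) (~-trans (~-sym v~w) a~b)
      ... | no a≢    | yes refl =
        old (x∈p∧x≢y⇒x∈p-y a∈ a≢) u∈ (~-trans a~b (~-sym (Y⇒~ uv))) ◅◅ uv ◅ ε
      ... | no a≢    | no b≢    = old (x∈p∧x≢y⇒x∈p-y a∈ a≢) (x∈p∧x≢y⇒x∈p-y b∈ b≢) a~b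

    sound : ∀ {c T v w} → Reach c T v w → Built c T v w
    sound (init i v∈ w∈) = record
      { arcs     = []
      ; length≤  = z≤n
      ; arcs-R   = λ ()
      ; inside   = λ ()
      ; connects = λ Y _ _ _ a∈ b∈ a~b → subst (Star Y _) (init-~ i a∈ b∈ a~b) ε
      ; oriented = λ _ ()
      }
    sound (ext {T = T} {u} {v} {w} v∈ uv r) = record
      { arcs     = (u , v) ∷ arcs B
      ; length≤  = s≤s (length≤ B)
      ; arcs-R   = λ { (here refl) → uv ; (there e) → arcs-R B e }
      ; inside   = λ { (here refl) → u∈ , v∈ ; (there e) → ins e }
      ; connects = connects-ext (proj₁ (reach-∈ r)) (proj₂ (reach-∈ r)) (connects B)
      ; oriented = λ ok → λ
          { (here refl) (here refl) → u≢v refl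
          ; (here refl) (there e)   → v∉ (proj₁ (inside B e))
          ; (there e)   (here refl) → v∉ (proj₁ (inside B e))
          ; (there e)   (there e′)  → oriented B ok e e′ }
      }
      where
      B   = sound r
      u∈  = proj₁ (∈-remove⁻ (proj₁ (reach-∈ r)))
      u≢v = proj₂ (∈-remove⁻ (proj₁ (reach-∈ r)))
      v∉ : v ∉ T - v
      v∉ v∈ = proj₂ (∈-remove⁻ v∈) refl
      ins : ∀ {a b} → (a , b) ∈ˡ arcs B → a ∈ T × b ∈ T
      ins e = proj₁ (∈-remove⁻ (proj₁ (inside B e))) , proj₁ (∈-remove⁻ (proj₂ (inside B e)))
    sound (fin {T = T} {u = u} {x} {y} a∈ b∈ x∈ ux xy okuy r) = record
      { arcs     = (x , y) ∷ (u , x) ∷ arcs B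
      ; length≤  = s≤s (s≤s (length≤ B))
      ; arcs-R   = λ { (here refl) → xy ; (there (here refl)) → ux ; (there (there e)) → arcs-R B e }
      ; inside   = λ { (here refl) → x∈ , y∈ ; (there (here refl)) → u∈ , x∈ ; (there (there e)) → ins e }
      -- The arc x → y is itself the missing path, so the closed ear imposes nothing on the path
      -- from a to b.
      ; connects = λ Y Y⊇ Y⇒~ _ →
          connects-ext (proj₁ (reach-∈ r)) (proj₂ (reach-∈ r)) (connects B) Y (λ e → Y⊇ (there e)) Y⇒~ (Y⊇ (here refl) ◅ ε)
      -- x is new, so u → x and x → y are the only arcs at x; they are antiparallel only for u = y,
      -- which `Ok` excludes.
      ; oriented = λ ok → λ
          { (here refl) (here refl)                         → y≢x refl
          ; (here refl) (there (here refl))                 → ok okuy refl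
          ; (here refl) (there (there e))                   → x∉ (proj₂ (inside B e))
          ; (there (here refl)) (here refl)                 → ok okuy refl
          ; (there (here refl)) (there (here refl))         → u≢x refl
          ; (there (here refl)) (there (there e))           → x∉ (proj₁ (inside B e))
          ; (there (there e)) (here refl)                   → x∉ (proj₂ (inside B e))
          ; (there (there e)) (there (here refl))           → x∉ (proj₁ (inside B e))
          ; (there (there e)) (there (there e′))            → oriented B ok e e′ }
      }
      where
      B   = sound r
      u∈  = proj₁ (∈-remove⁻ (proj₁ (reach-∈ r)))
      u≢x = proj₂ (∈-remove⁻ (proj₁ (reach-∈ r)))
      y∈  = proj₁ (∈-remove⁻ (proj₂ (reach-∈ r)))
      y≢x = proj₂ (∈-remove⁻ (proj₂ (reach-∈ r)))
      x∉ : x ∉ T - x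
      x∉ x∈ = proj₂ (∈-remove⁻ x∈) refl
      ins : ∀ {a b} → (a , b) ∈ˡ arcs B → a ∈ T × b ∈ T
      ins e = proj₁ (∈-remove⁻ (proj₁ (inside B e))) , proj₁ (∈-remove⁻ (proj₂ (inside B e)))

  -- A walk from v to w with all inner vertices outside T. ℓ only bounds its length from above; it
  -- is the recursion measure of `grow`, where `avoid` replaces the remaining walk by another one.
  data Tail (W : Fin n → Fin n → Set) (T : Subset n) (w : Fin n) : Fin n → ℕ → Set where
    done : ∀ {v ℓ} → W v w → Tail W T w v (suc ℓ)
    step : ∀ {v y ℓ} → W v y → y ∉ T → Tail W T w y ℓ → Tail W T w v (suc ℓ)

  tail-suc : ∀ {W T w v ℓ} → Tail W T w v ℓ → Tail W T w v (suc ℓ)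
  tail-suc (done vw)      = done vw
  tail-suc (step vy y∉ p) = step vy y∉ (tail-suc p)

  first-hit : ∀ {W T v w} → Star W v w → v ∉ T → w ∈ T → ∃[ w′ ] ∃[ ℓ ] w′ ∈ T × Tail W T w′ v ℓ
  first-hit ε v∉ w∈ = ⊥-elim (v∉ w∈)
  first-hit {T = T} (_◅_ {j = y} vy p) v∉ w∈ with y ∈? T
  ... | yes y∈ = y , 1 , y∈ , done vy
  ... | no y∉ with first-hit p y∉ w∈
  ...   | w′ , ℓ , w′∈ , t = w′ , suc ℓ , w′∈ , step vy y∉ t

  -- Restarting a walk at its last visit of v makes it avoid v.
  avoid : ∀ {W T w a ℓ} v → Tail W T w a ℓ → Tail W (T ∪ ⁅ v ⁆) w a ℓ ⊎ Tail W (T ∪ ⁅ v ⁆) w v ℓ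
  avoid v (done aw) = inj₁ (done aw)
  avoid v (step {y = y} ay y∉ p) with avoid v p
  ... | inj₂ q = inj₂ (tail-suc q)
  ... | inj₁ q with y ≟ᶠ v
  ...   | yes refl = inj₂ (tail-suc q)
  ...   | no y≢v   = inj₁ (step ay (λ y∈ → [ y∉ , y≢v ]′ (∈-add⁻ y∈)) q)

  avoid-start : ∀ {W T w v ℓ} → Tail W T w v ℓ → Tail W (T ∪ ⁅ v ⁆) w v ℓ
  avoid-start {v = v} p = [ id , id ]′ (avoid v p)

  -- The walk back that turns u → v into the first arc of an ear. The last clause is for the
  -- shortest ear u → v → w, whose two arcs must be compatible.
  Return : (Fin n → Fin n → Set) → Fin n → Fin n → Set₁
  Return Z u v = Σ[ W ∈ (Fin n → Fin n → Set) ]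
    (∀ {a b} → W a b → Z a b) × Star W v u × (∀ {w} → W v w → Ok u w)

  -- `Z` consists of arcs of a given solution, and `link` names the element of the solution that an
  -- arc uses; both directions of an undirected edge share one name. Counting distinct names bounds
  -- the number of arcs by the size of the solution.
  module Completeness {N : ℕ} (Z : Fin n → Fin n → Set) (link : Fin n → Fin n → Fin N)
      (Z⇒R : ∀ {u v} → Z u v → R u v)
      (link-ends : ∀ {u v u′ v′} → link u v ≡ link u′ v′ → (u ≡ u′ × v ≡ v′) ⊎ (u ≡ v′ × v ≡ u′))
      (link-≢ : ∀ {u v w} → Ok u w → u ≢ v → link u v ≢ link v w)
      (≢⇒Ok : ∀ {u w} → u ≢ w → Ok u w)
      (return : ∀ {u v} → Z u v → Return Z u v)
      where

    Inside : Subset n → Fin N → Set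
    Inside T e = ∃[ u ] ∃[ v ] u ∈ T × v ∈ T × Z u v × e ≡ link u v

    record Edges (c : ℕ) (T : Subset n) : Set where
      field
        edges      : List (Fin N)
        unique     : Unique edges
        length≡    : length edges ≡ c
        all-inside : All (Inside T) edges

    open Edges

    inside-add : ∀ {T v e} → Inside T e → Inside (T ∪ ⁅ v ⁆) e
    inside-add (a , b , a∈ , b∈ , ab , eq) = a , b , ⊆-add a∈ , ⊆-add b∈ , ab , eq

    link-new : ∀ {T u v e} → v ∉ T → Inside T e → link u v ≢ e
    link-new v∉ (a , b , a∈ , b∈ , _ , refl) eq with link-ends eq
    ... | inj₁ (_ , refl) = v∉ b∈
    ... | inj₂ (_ , refl) = v∉ a∈

    link-new′ : ∀ {T u v e} → v ∉ T → Inside T e → link v u ≢ e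
    link-new′ v∉ (a , b , a∈ , b∈ , _ , refl) eq with link-ends eq
    ... | inj₁ (refl , _) = v∉ a∈
    ... | inj₂ (refl , _) = v∉ b∈

    edges-ext : ∀ {c T u v} → u ∈ T → v ∉ T → Z u v → Edges c T → Edges (1 + c) (T ∪ ⁅ v ⁆)
    edges-ext {u = u} {v} u∈ v∉ uv E = record
      { edges      = link u v ∷ edges E
      ; unique     = All.map (link-new v∉) (all-inside E) ∷ unique E
      ; length≡    = cong suc (length≡ E)
      ; all-inside = (u , v , ⊆-add u∈ , self-add v , uv , refl) ∷ All.map inside-add (all-inside E)
      }

    edges-fin : ∀ {c T u v w} → u ∈ T → w ∈ T → v ∉ T → Z u v → Z v w → Ok u w →
                Edges c T → Edges (2 + c) (T ∪ ⁅ v ⁆)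
    edges-fin {u = u} {v} {w} u∈ w∈ v∉ uv vw ok E = record
      { edges      = link v w ∷ link u v ∷ edges E
      ; unique     = ((λ eq → link-≢ ok (λ { refl → v∉ u∈ }) (sym eq)) ∷ All.map (link-new′ v∉) (all-inside E))
                     ∷ All.map (link-new v∉) (all-inside E) ∷ unique E
      ; length≡    = cong (2 +_) (length≡ E)
      ; all-inside = (v , w , self-add v , ⊆-add w∈ , vw , refl)
                     ∷ (u , v , ⊆-add u∈ , self-add v , uv , refl)
                     ∷ All.map inside-add (all-inside E)
      }

    -- One count serves all pairs a, b, because the next ear may start and end anywhere in T.
    record Full (T : Subset n) : Set where
      field
        {size} : ℕ
        used   : Edges size T
        reach  : ∀ {a b} → a ∈ T → b ∈ T → Reach size T a b

    open Full

    -- Each further vertex of the ear is an `ext`, the last one before w a `fin`. The recorded edges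
    -- are new because they have an end outside the current set; the two edges of `fin` are told
    -- apart by `link-≢`.
    grow : ∀ {W : Fin n → Fin n → Set} → (∀ {a b} → W a b → Z a b) →
           ∀ ℓ {c T u v w} → v ∉ T → Edges c T → Reach c T u w → Z u v → (W v w → Ok u w) →
           Tail W (T ∪ ⁅ v ⁆) w v ℓ → ∃[ T′ ] Full T′ × T ⊆ T′ × v ∈ T′
    grow W⇒Z (suc ℓ) {c} {T} {u} {v} v∉ E r uv ok (done vw) =
      T ∪ ⁅ v ⁆ ,
      record
        { used  = edges-fin (proj₁ (reach-∈ r)) (proj₂ (reach-∈ r)) v∉ uv (W⇒Z vw) (ok vw) E
        ; reach = λ a∈ b∈ → fin a∈ b∈ (self-add v) (Z⇒R uv) (Z⇒R (W⇒Z vw)) (ok vw)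
                    (subst (λ T → Reach c T _ _) (sym (add-remove v∉)) r) } ,
      ⊆-add , self-add v
    grow W⇒Z (suc ℓ) {c} {T} {u} {v} v∉ E r uv ok (step vy y∉ p)
      with grow W⇒Z ℓ y∉ (edges-ext (proj₁ (reach-∈ r)) v∉ uv E)
             (ext (self-add v) (Z⇒R uv) (subst (λ T → Reach c T _ _) (sym (add-remove v∉)) r))
             -- From the second inner vertex on, the predecessor is itself a new vertex and so
             -- differs from the end w, which lies in T.
             (W⇒Z vy) (λ _ → ≢⇒Ok λ { refl → v∉ (proj₂ (reach-∈ r)) })
             (avoid-start p)
    ... | T′ , F , ⊆T′ , _ = T′ , F , (λ x∈ → ⊆T′ (⊆-add x∈)) , ⊆T′ (self-add v)

    exit : ∀ {T a y} → Star Z a y → a ∈ T → y ∉ T → ∃[ u ] ∃[ v ] u ∈ T × v ∉ T × Z u v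
    exit ε a∈ y∉ = ⊥-elim (y∉ a∈)
    exit {T} {a} (_◅_ {j = b} ab p) a∈ y∉ with b ∈? T
    ... | yes b∈ = exit p b∈ y∉
    ... | no b∉  = a , b , a∈ , b∉ , ab

    -- A walk to y leaves T along some arc u → v. The walk back from v to u returns to T, and its
    -- part up to the first vertex w in T completes an ear.
    ear : ∀ {T a y} → Full T → Star Z a y → a ∈ T → y ∉ T → ∃[ T′ ] Full T′ × T ⊆ T′ × ∣ T ∣ < ∣ T′ ∣
    ear F p a∈ y∉ with exit p a∈ y∉
    ... | u , v , u∈ , v∉ , uv with return uv
    ...   | W , W⇒Z , q , okW with first-hit q v∉ u∈
    ...     | w , ℓ , w∈ , t with grow W⇒Z ℓ v∉ (used F) (reach F u∈ w∈) uv okW (avoid-start t)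
    ...       | T′ , F′ , T⊆ , v∈ = T′ , F′ , T⊆ , p⊂q⇒∣p∣<∣q∣ (T⊆ , v , v∈ , v∉)

    module _ (T₀ : Subset n) (init₀ : Init T₀) (cover : ∀ y → ∃[ r ] r ∈ T₀ × Star Z r y) where

      -- Every ear adds a vertex, so the number k of vertices that may still be missing bounds the
      -- number of ears.
      saturate : ∀ k {T} → n ≤ ∣ T ∣ + k → T₀ ⊆ T → Full T → Full ⊤
      saturate k {T} n≤ T₀⊆ F with any? (λ y → ¬? (y ∈? T))
      ... | no ¬∃ = subst Full (⊆-antisym ⊆⊤ (λ {y} _ → decidable-stable (y ∈? T) λ y∉ → ¬∃ (y , y∉))) F
      saturate zero {T} n≤ T₀⊆ F | yes (y , y∉) =
        ⊥-elim (y∉ (subst (y ∈_) (sym (∣p∣≡n⇒p≡⊤ (≤-antisym (∣p∣≤n T) (subst (n ≤_) (+-identityʳ _) n≤)))) ∈⊤))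
      saturate (suc k) {T} n≤ T₀⊆ F | yes (y , y∉) with cover y
      ... | r , r∈ , p with ear F p (T₀⊆ r∈) y∉
      ...   | T′ , F′ , T⊆ , T<T′ =
        saturate k (≤-trans n≤ (≤-trans (≤-reflexive (+-suc ∣ T ∣ k)) (+-monoˡ-≤ k T<T′)))
          (λ x∈ → T⊆ (T₀⊆ x∈)) F′

      spanning : Full ⊤
      spanning = saturate n (m≤n+m n ∣ T₀ ∣) (λ x∈ → x∈) (record
        { used  = record { edges = [] ; unique = [] ; length≡ = refl ; all-inside = [] }
        ; reach = init init₀ })

-- Components, covering pairs and minimum equivalent graphs

module _ {N : ℕ} where

  setOf : List (Fin N) → Subset N
  setOf = foldr (λ e p → ⁅ e ⁆ ∪ p) ∅

  ∈-setOf⁺ : ∀ {e xs} → e ∈ˡ xs → e ∈ setOf xs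
  ∈-setOf⁺ {e} (here refl)  = x∈p∪q⁺ (inj₁ (x∈⁅x⁆ e))
  ∈-setOf⁺ (there e∈) = x∈p∪q⁺ (inj₂ (∈-setOf⁺ e∈))

  ∈-setOf⁻ : ∀ {e} xs → e ∈ setOf xs → e ∈ˡ xs
  ∈-setOf⁻ []       e∈ = ⊥-elim (∉⊥ e∈)
  ∈-setOf⁻ (x ∷ xs) e∈ with x∈p∪q⁻ ⁅ x ⁆ (setOf xs) e∈
  ... | inj₁ e∈x  = here (x∈⁅y⁆⇒x≡y x e∈x)
  ... | inj₂ e∈xs = there (∈-setOf⁻ xs e∈xs)

∣p∪q∣≤∣p∣+∣q∣ : ∀ {N} (p q : Subset N) → ∣ p ∪ q ∣ ≤ ∣ p ∣ + ∣ q ∣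
∣p∪q∣≤∣p∣+∣q∣ []          []          = z≤n
∣p∪q∣≤∣p∣+∣q∣ (false ∷ p) (false ∷ q) = ∣p∪q∣≤∣p∣+∣q∣ p q
∣p∪q∣≤∣p∣+∣q∣ (false ∷ p) (true ∷ q)  =
  ≤-trans (s≤s (∣p∪q∣≤∣p∣+∣q∣ p q)) (≤-reflexive (sym (+-suc ∣ p ∣ ∣ q ∣)))
∣p∪q∣≤∣p∣+∣q∣ (true ∷ p)  (false ∷ q) = s≤s (∣p∪q∣≤∣p∣+∣q∣ p q)
∣p∪q∣≤∣p∣+∣q∣ (true ∷ p)  (true ∷ q)  =
  s≤s (≤-trans (∣p∪q∣≤∣p∣+∣q∣ p q) (+-monoʳ-≤ ∣ p ∣ (n≤1+n ∣ q ∣)))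

∣setOf∣≤length : ∀ {N} (xs : List (Fin N)) → ∣ setOf xs ∣ ≤ length xs
∣setOf∣≤length {N} []   = ≤-reflexive (∣⊥∣≡0 N)
∣setOf∣≤length (x ∷ xs) =
  ≤-trans (∣p∪q∣≤∣p∣+∣q∣ ⁅ x ⁆ (setOf xs)) (+-mono-≤ (≤-reflexive (∣⁅x⁆∣≡1 x)) (∣setOf∣≤length xs))

length≤∣∣ : ∀ {N} {X : Subset N} {xs} → Unique xs → All (_∈ X) xs → length xs ≤ ∣ X ∣
length≤∣∣ []       []         = z≤n
length≤∣∣ (x∉ ∷ u) (x∈ ∷ xs∈) =
  ≤-trans (s≤s (length≤∣∣ u (All.zipWith (λ (y∈ , x≢y) → x∈p∧x≢y⇒x∈p-y y∈ (≢-sym x≢y)) (xs∈ , x∉))))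
          (x∈p⇒∣p-x∣<∣p∣ x∈)

subsetOf : ∀ {n} {P : Fin n → Set} → (∀ i → Dec (P i)) → ∃[ S ] ∀ i → (i ∈ S → P i) × (P i → i ∈ S)
subsetOf {n} {P} P? = S , λ i → ∈⇒ i , ⇒∈ i
  where
  S : Subset n
  S = tabulate (does ∘ P?)
  ∈⇒ : ∀ i → i ∈ S → P i
  ∈⇒ i i∈ with P? i | trans (sym (lookup∘tabulate (does ∘ P?) i)) ([]=⇒lookup i∈)
  ... | yes p | _ = p
  ⇒∈ : ∀ i → P i → i ∈ S
  ⇒∈ i p = lookup⇒[]= i S (trans (lookup∘tabulate (does ∘ P?) i) (dec-true (P? i) p))

module Condensation {n : ℕ} (A : Fin n → Fin n → Set) where

  infix 4 _≼_ _~_ _≺_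

  _≼_ _~_ _≺_ : Fin n → Fin n → Set
  u ≼ v = Star A u v
  u ~ v = u ≼ v × v ≼ u
  u ≺ v = u ≼ v × ¬ v ≼ u

  -- Taking the least vertex of each component makes the initial set unique, so that the program can
  -- recognise it.
  Rep : Fin n → Set
  Rep r = ∀ x → x <ᶠ r → ¬ x ~ r

  IsRepSet : Subset n → Set
  IsRepSet T = ∀ i → (i ∈ T → Rep i) × (Rep i → i ∈ T)

  Intra : Fin n → Fin n → Set
  Intra u v = A u v × v ≼ u

  Between : Fin n → Fin n → Fin n → Set
  Between u v w = u ≺ w × w ≺ v

  -- The Hasse diagram of the order on strong components, written on representatives so that each
  -- pair of components counts once. Every covering pair forces an arc between its components, and
  -- one such arc for each pair suffices.
  Cover : Fin n → Fin n → Set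
  Cover u v = Rep u × Rep v × u ≺ v × ¬ (∃[ w ] Between u v w)

  ~-sym : ∀ {u v} → u ~ v → v ~ u
  ~-sym (p , q) = q , p

  ~-trans : ∀ {u v w} → u ~ v → v ~ w → u ~ w
  ~-trans (p , q) (p′ , q′) = p ◅◅ p′ , q′ ◅◅ q

  Intra⇒~ : ∀ {u v} → Intra u v → u ~ v
  Intra⇒~ (uv , v≼u) = uv ◅ ε , v≼u

  rep-unique : ∀ {r s} → Rep r → Rep s → r ~ s → r ≡ s
  rep-unique {r} {s} rep-r rep-s r~s with <ᶠ-cmp r s
  ... | tri< r<s _ _ = ⊥-elim (rep-s r r<s r~s)
  ... | tri≈ _ r≡s _ = r≡s
  ... | tri> _ _ s<r = ⊥-elim (rep-r s s<r (~-sym r~s))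

  ≺-isSPO : IsStrictPartialOrder _≡_ _≺_
  ≺-isSPO = record
    { isEquivalence = isEquivalence
    ; irrefl        = λ { refl (_ , ¬p) → ¬p ε }
    ; trans         = λ (p , ¬q) (p′ , ¬q′) → p ◅◅ p′ , λ q → ¬q (p′ ◅◅ q)
    ; <-resp-≈      = (λ { refl p → p }) , (λ { refl p → p })
    }

  module _ (_≼?_ : ∀ u v → Dec (u ≼ v)) where

    private
      _~?_ : ∀ u v → Dec (u ~ v)
      u ~? v = (u ≼? v) ×-dec (v ≼? u)

    ∃-rep : ∀ y → ∃[ r ] Rep r × r ~ y
    ∃-rep y = go y (<-wellFounded y)
      where
      go : ∀ y → Acc _<ᶠ_ y → ∃[ r ] Rep r × r ~ y
      go y (acc rs) with any? (λ x → (x <ᶠ? y) ×-dec (x ~? y))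
      ... | no ¬∃ = y , (λ x x<y x~y → ¬∃ (x , x<y , x~y)) , (ε , ε)
      ... | yes (x , x<y , x~y) with go x (rs x<y)
      ...   | r , rep , r~x = r , rep , ~-trans r~x x~y

    rep? : ∀ r → Dec (Rep r)
    rep? r with any? (λ x → (x <ᶠ? r) ×-dec (x ~? r))
    ... | no ¬∃           = yes λ x x<r x~r → ¬∃ (x , x<r , x~r)
    ... | yes (x , x< , x~r) = no λ rep → rep x x< x~r

    ∃-repSet : ∃[ T ] IsRepSet T
    ∃-repSet = subsetOf rep?

    -- The walk leaves the component of r into that of s at once: any other
    -- component it enters would lie between the two.
    crossing : ∀ {W : Fin n → Fin n → Set} {r s p} → (∀ {a b} → W a b → A a b) → Cover r s →
               Star W p s → p ~ r → ∃[ a ] ∃[ b ] W a b × a ~ r × b ~ s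
    crossing W⇒A (_ , _ , (_ , ¬s≼r) , _) ε s~r = ⊥-elim (¬s≼r (proj₁ s~r))
    crossing {r = r} {s} W⇒A cov@(_ , _ , (_ , ¬s≼r) , ¬btw) (_◅_ {i = p} {j = q} pq rest) p~r
      with q ≼? r
    ... | yes q≼r = crossing W⇒A cov rest (q≼r , proj₂ p~r ◅◅ W⇒A pq ◅ ε)
    ... | no ¬q≼r with s ≼? q
    ...   | yes s≼q = p , q , pq , p~r , (star-map W⇒A rest , s≼q)
    ...   | no ¬s≼q =
      ⊥-elim (¬btw (q , ((proj₂ p~r ◅◅ W⇒A pq ◅ ε) , ¬q≼r) , (star-map W⇒A rest , ¬s≼q)))

    lowest-above : ∀ {u} v → u ≺ v → ∃[ w ] u ≺ w × w ≼ v × ¬ (∃[ x ] Between u w x)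
    lowest-above {u} v u≺v = go v u≺v (spo-wellFounded ≺-isSPO v)
      where
      go : ∀ v → u ≺ v → Acc _≺_ v → ∃[ w ] u ≺ w × w ≼ v × ¬ (∃[ x ] Between u w x)
      go v u≺v (acc rs)
        with any? (λ x → ((u ≼? x) ×-dec ¬? (x ≼? u)) ×-dec ((x ≼? v) ×-dec ¬? (v ≼? x)))
      ... | no ¬∃ = v , u≺v , ε , ¬∃
      ... | yes (x , u≺x , x≺v) with go x u≺x (rs x≺v)
      ...   | w , u≺w , w≼x , ¬btw = w , u≺w , w≼x ◅◅ proj₁ x≺v , ¬btw

    -- Induction upwards along the finite order of components: while v lies strictly above u, some
    -- component covers that of u on the way to v, and the arc for this covering pair is taken.
    connect : ∀ {Y : Fin n → Fin n → Set} → (∀ {a b} → a ~ b → Star Y a b) →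
              (∀ {r s} → Cover r s → ∃[ a ] ∃[ b ] Y a b × a ~ r × b ~ s) →
              ∀ {u v} → u ≼ v → Star Y u v
    connect {Y} intra covered {u} {v} u≼v = go u u≼v (spo-noetherian ≺-isSPO u)
      where
      go : ∀ u → u ≼ v → Acc (flip _≺_) u → Star Y u v
      go u u≼v (acc rs) with v ≼? u
      ... | yes v≼u = intra (u≼v , v≼u)
      ... | no ¬v≼u with lowest-above v (u≼v , ¬v≼u)
      ...   | w , u≺w@(u≼w , ¬w≼u) , w≼v , ¬btw with ∃-rep u | ∃-rep w
      ...     | r , rep-r , r~u | s , rep-s , s~w
              -- Covering depends on components only, so it passes from u and w to their
              -- representatives.
              with covered (rep-r , rep-s ,
                     (proj₁ r~u ◅◅ u≼w ◅◅ proj₂ s~w , λ s≼r → ¬w≼u (proj₂ s~w ◅◅ s≼r ◅◅ proj₁ r~u)) ,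
                     λ { (x , (r≼x , ¬x≼r) , (x≼s , ¬s≼x)) →
                       ¬btw (x , (proj₂ r~u ◅◅ r≼x , λ x≼u → ¬x≼r (x≼u ◅◅ proj₂ r~u)) ,
                                 (x≼s ◅◅ proj₁ s~w , λ w≼x → ¬s≼x (proj₁ s~w ◅◅ w≼x))) })
      ...       | a , b , ab , a~r , b~s =
        intra (~-sym (~-trans a~r r~u)) ◅◅ ab ◅ intra (~-trans b~s s~w) ◅◅ go w w≼v (rs u≺w)

    no-cover : (∀ u v → u ≼ v) → ∀ {r s} → ¬ Cover r s
    no-cover all (_ , _ , (_ , ¬s≼r) , _) = ¬s≼r (all _ _)

  -- For n = 0 no vertex exists to name a state, and the empty set is a solution. Otherwise the pair
  -- a, a is taken since the empty path then keeps every promise. The bound n² on c, the number of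
  -- all pairs of vertices, makes the table finite.
  Affordable : (Ok : Fin n → Fin n → Set) → ℕ → ℕ → Set
  Affordable Ok κ k = n ≡ 0 ⊎
    ∃[ c ] ∃[ a ] c ≤ n * n × Reach c ⊤ a a × κ + c ≤ k
    where open Ears Intra Ok IsRepSet

  module E (Ok : Fin n → Fin n → Set) = Ears Intra Ok IsRepSet

  built : ∀ {Ok c a} → E.Reach Ok c ⊤ a a →
          ∃[ arcs ] length arcs ≤ c × (∀ {u v} → (u , v) ∈ˡ arcs → Intra u v) ×
                    (∀ {u v} → u ~ v → Star (λ a b → (a , b) ∈ˡ arcs) u v) ×
                    ((∀ {u w} → Ok u w → u ≢ w) → ∀ {u v} → (u , v) ∈ˡ arcs → (v , u) ∉ˡ arcs)
  built {Ok} r =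
    arcs B , length≤ B , arcs-R B ,
    (λ u~v → connects B (λ a b → (a , b) ∈ˡ arcs B) id (Intra⇒~ ∘ arcs-R B) ε ∈⊤ ∈⊤ u~v) ,
    (λ ok → oriented B ok)
    where
    open E.Soundness Ok _~_ ~-sym ~-trans (ε , ε) Intra⇒~
           (λ {T} isRep a∈ b∈ → rep-unique (proj₁ (isRep _) a∈) (proj₁ (isRep _) b∈))
    open Built
    B = sound r

module MEGraph {n : ℕ} (A : PairSet n) (_≼?_ : ∀ u v → Dec (DiPath n A u v))
               {κ : ℕ} (L : Listing (uncurry (Condensation.Cover (Arc n A))) κ) where

  open Condensation (Arc n A)
  open Listing L renaming (elems to pairs; nodup to pairs-unique; holds to pairs-cover; exhaustive to pairs-all; count to pairs-count)

  private
    Any : Fin n → Fin n → Set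
    Any _ _ = Unit

  Equivalent : PairSet n → Set
  Equivalent X = ∀ u v → DiPath n A u v → DiPath n X u v

  record Cross (X : PairSet n) (L : List (Fin n × Fin n)) (e : Fin (n * n)) : Set where
    field
      {src tgt r s} : Fin n
      is            : e ≡ combine src tgt
      e∈            : e ∈ X
      pair∈         : (r , s) ∈ˡ L
      pair-cover    : Cover r s
      src~          : src ~ r
      tgt~          : tgt ~ s

  open Cross

  cross-weaken : ∀ {X L L′ e} → (∀ {p} → p ∈ˡ L → p ∈ˡ L′) → Cross X L e → Cross X L′ e
  cross-weaken f c = record
    { is = is c ; e∈ = e∈ c ; pair∈ = f (pair∈ c) ; pair-cover = pair-cover c ; src~ = src~ c ; tgt~ = tgt~ c }

  module _ {X : PairSet n} (X⊆A : X ⊆ A) (equiv : ∀ {u v} → u ≼ v → DiPath n X u v) where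

    crossArc : ∀ {r s} → Cover r s → ∃[ a ] ∃[ b ] Arc n X a b × a ~ r × b ~ s
    crossArc cov = crossing _≼?_ X⊆A cov (equiv (proj₁ (proj₁ (proj₂ (proj₂ cov))))) (ε , ε)

    -- Arcs chosen for different pairs differ, because the components of the ends determine the pair
    -- by uniqueness of representatives. Applied to A it selects arcs for a solution; applied to a
    -- solution it counts arcs there.
    ∃-crossArcs : ∀ L → Unique L → All (uncurry Cover) L →
      ∃[ K ] length K ≡ length L × Unique K × All (Cross X L) K ×
             All (λ (r , s) → ∃[ a ] ∃[ b ] combine a b ∈ˡ K × a ~ r × b ~ s) L
    ∃-crossArcs []            []        []        = [] , refl , [] , [] , []
    ∃-crossArcs ((r , s) ∷ L) (rs∉ ∷ u) (c ∷ cs) with ∃-crossArcs L u cs | crossArc c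
    ... | K , len≡ , uK , crossK , coverK | a , b , ab , a~r , b~s =
      combine a b ∷ K , cong suc len≡ , All.map new crossK ∷ uK ,
      record { is = refl ; e∈ = ab ; pair∈ = here refl ; pair-cover = c ; src~ = a~r ; tgt~ = b~s }
        ∷ All.map (cross-weaken there) crossK ,
      (a , b , here refl , a~r , b~s) ∷ All.map (λ (a , b , e∈ , p) → a , b , there e∈ , p) coverK
      where
      new : ∀ {e} → Cross X L e → combine a b ≢ e
      new c′ eq with combine-injective a b _ _ (trans eq (is c′))
      ... | refl , refl =
        All.lookup rs∉ (pair∈ c′)
          (cong₂ _,_ (rep-unique (proj₁ c) (proj₁ (pair-cover c′)) (~-trans (~-sym a~r) (src~ c′)))
                     (rep-unique (proj₁ (proj₂ c)) (proj₁ (proj₂ (pair-cover c′))) (~-trans (~-sym b~s) (tgt~ c′))))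

  sound : ∀ {k} → Affordable Any κ k → ∃[ X ] X ⊆ A × ∣ X ∣ ≤ k × Equivalent X
  sound (inj₁ refl) = ∅ , (λ e∈ → ⊥-elim (∉⊥ e∈)) , ≤-trans (≤-reflexive (∣⊥∣≡0 0)) z≤n , λ ()
  sound {k} (inj₂ (c , a , _ , r , κ+c≤k)) with built r | ∃-crossArcs id id pairs pairs-unique pairs-cover
  ... | arcs , length≤ , intra , conn , _ | K , length≡ , _ , crossK , coverK = X , X⊆A , ∣X∣≤k , equiv
    where
    xs = K ++ map (uncurry combine) arcs
    X = setOf xs
    arc∈ : ∀ {u v} → (u , v) ∈ˡ arcs → Arc n X u v
    arc∈ e∈ = ∈-setOf⁺ (∈-++⁺ʳ K (∈-map⁺ (uncurry combine) e∈))
    X⊆A : X ⊆ A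
    X⊆A e∈X with ∈-++⁻ K (∈-setOf⁻ xs e∈X)
    ... | inj₁ e∈K = e∈ (All.lookup crossK e∈K)
    ... | inj₂ e∈arcs with ∈-map⁻ (uncurry combine) e∈arcs
    ...   | (u , v) , uv∈ , refl = proj₁ (intra uv∈)
    ∣X∣≤k : ∣ X ∣ ≤ k
    ∣X∣≤k = begin
      ∣ X ∣                                           ≤⟨ ∣setOf∣≤length xs ⟩
      length xs                                       ≡⟨ length-++ K ⟩
      length K + length (map (uncurry combine) arcs)  ≡⟨ cong₂ _+_ (trans length≡ pairs-count) (length-map (uncurry combine) arcs) ⟩
      κ + length arcs                                 ≤⟨ +-monoʳ-≤ κ length≤ ⟩
      κ + c                                           ≤⟨ κ+c≤k ⟩
      k                                               ∎
      where open ≤-Reasoning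
    equiv : Equivalent X
    equiv u v = connect _≼?_ (λ a~b → star-map arc∈ (conn a~b)) λ {r} {s} cov →
      let a , b , ab∈ , p = All.lookup coverK (pairs-all cov) in
      a , b , ∈-setOf⁺ (∈-++⁺ˡ ab∈) , p

  complete : ∀ {k X} → X ⊆ A → ∣ X ∣ ≤ k → Equivalent X → Affordable Any κ k
  complete {k} {X} X⊆A ∣X∣≤k equiv = answer
    where
    Z : Fin n → Fin n → Set
    Z u v = Arc n X u v × v ≼ u

    Z⇒Intra : ∀ {u v} → Z u v → Intra u v
    Z⇒Intra (uv , v≼u) = X⊆A uv , v≼u

    -- If the last vertex leads back to the first, every vertex on the walk lies in the same
    -- component.
    intra-path : ∀ {u v} → DiPath n X u v → v ≼ u → Star Z u v
    intra-path ε          v≼u = ε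
    intra-path (um ◅ p) v≼u =
      (um , star-map X⊆A p ◅◅ v≼u) ◅ intra-path p (v≼u ◅◅ X⊆A um ◅ ε)

    ~-path : ∀ {u v} → u ~ v → Star Z u v
    ~-path (u≼v , v≼u) = intra-path (equiv _ _ u≼v) v≼u

    open E Any
    open Completeness Z combine Z⇒Intra
      (λ eq → inj₁ (combine-injective _ _ _ _ eq))
      (λ {u} {v} {w} _ u≢v eq → u≢v (proj₁ (combine-injective u v v w eq)))
      (λ _ → tt)
      (λ uv → Z , id , ~-path (~-sym (Intra⇒~ (Z⇒Intra uv))) , λ _ → tt)

    cover-by-rep : ∀ {T} → IsRepSet T → ∀ y → ∃[ r ] r ∈ T × Star Z r y
    cover-by-rep isRep y with ∃-rep _≼?_ y
    ... | r , rep-r , r~y = r , proj₂ (isRep r) rep-r , ~-path r~y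

    F : Full ⊤
    F = spanning (proj₁ (∃-repSet _≼?_)) (proj₂ (∃-repSet _≼?_)) (cover-by-rep (proj₂ (∃-repSet _≼?_)))

    c = Full.size F
    es = Edges.edges (Full.used F)
    Ks = ∃-crossArcs X⊆A (λ {u} {v} → equiv u v) pairs pairs-unique pairs-cover
    K = proj₁ Ks
    crossK = proj₁ (proj₂ (proj₂ (proj₂ Ks)))

    -- No path leads backwards over a covering pair, whereas the ends of an arc of an ear reach each
    -- other. So κ and c count different elements of X.
    disjoint : ∀ {e} → ¬ (e ∈ˡ K × e ∈ˡ es)
    disjoint (e∈K , e∈es) with All.lookup crossK e∈K | All.lookup (Edges.all-inside (Full.used F)) e∈es
    ... | c | u , v , _ , _ , (_ , v≼u) , eq with combine-injective _ _ u v (trans (sym (is c)) eq)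
    ...   | refl , refl = proj₂ (proj₁ (proj₂ (proj₂ (pair-cover c))))
                            (proj₂ (tgt~ c) ◅◅ v≼u ◅◅ proj₁ (src~ c))

    inX : All (_∈ X) es
    inX = All.map (λ { (_ , _ , _ , _ , (uv , _) , refl) → uv }) (Edges.all-inside (Full.used F))

    κ+c≤ : κ + c ≤ ∣ X ∣
    κ+c≤ = begin
      κ + c                    ≡⟨ cong₂ _+_ (trans (proj₁ (proj₂ Ks)) pairs-count) (Edges.length≡ (Full.used F)) ⟨
      length K + length es     ≡⟨ length-++ K ⟨
      length (K ++ es)         ≤⟨ length≤∣∣
                                    (Unique.++⁺ (proj₁ (proj₂ (proj₂ Ks))) (Edges.unique (Full.used F)) disjoint)
                                    (All.++⁺ (All.map e∈ crossK) inX) ⟩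
      ∣ X ∣                    ∎
      where open ≤-Reasoning

    pick : ∀ {m} → (Fin m → m ≡ n → Affordable Any κ k) → m ≡ n → Affordable Any κ k
    pick {zero}  f eq = inj₁ (sym eq)
    pick {suc m} f eq = f zero eq

    answer : Affordable Any κ k
    answer = pick (λ { a refl → inj₂ (c , a ,
      ≤-trans (m≤n+m c κ) (≤-trans κ+c≤ (∣p∣≤n X)) ,
      Full.reach F ∈⊤ ∈⊤ , ≤-trans κ+c≤ ∣X∣≤k) }) refl

-- Two-edge connectivity and orientations

-- A walk that ends at a need not leave a.
avoid-out-arc : ∀ {n} {xs : List (Fin n × Fin n)} {a b p} → Star (λ u v → (u , v) ∈ˡ xs) p a →
                Star (λ u v → (u , v) ∈ˡ xs × (u , v) ≢ (a , b)) p a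
avoid-out-arc ε = ε
avoid-out-arc {a = a} (_◅_ {i = p} pq rest) with p ≟ᶠ a
... | yes refl = ε
... | no p≢a   = (pq , λ { refl → p≢a refl }) ◅ avoid-out-arc rest

module 2ECSSGraph {n : ℕ} (E : PairSet n) (isEdge : IsEdgeSet n E)
                  (_≼?_ : ∀ u v → Dec (Star (Adjacent n E) u v))
                  {κ : ℕ} (L : Listing (uncurry (Condensation.Cover (Adjacent n E))) κ) where

  open Condensation (Adjacent n E)
  open Listing L using () renaming (holds to pairs-cover; count to pairs-count)

  -- Gives both directions of an edge the number under which it is stored, that of the pair with the
  -- smaller vertex first.
  link : Fin n → Fin n → Fin (n * n)
  link u v with u <ᶠ? v
  ... | yes _ = combine u v
  ... | no _  = combine v u

  link⇒adjacent : ∀ {X u v} → link u v ∈ X → Adjacent n X u v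
  link⇒adjacent {u = u} {v} l∈ with u <ᶠ? v
  ... | yes _ = inj₁ l∈
  ... | no _  = inj₂ l∈

  adjacent⇒link : ∀ {X u v} → X ⊆ E → Adjacent n X u v → link u v ∈ X
  adjacent⇒link {u = u} {v} X⊆E adj with u <ᶠ? v | adj
  ... | yes _   | inj₁ uv = uv
  ... | yes u<v | inj₂ vu = ⊥-elim (<ᶠ-asym u<v (isEdge v u (X⊆E vu)))
  ... | no ¬u<v | inj₁ uv = ⊥-elim (¬u<v (isEdge u v (X⊆E uv)))
  ... | no _    | inj₂ vu = vu

  link-ends : ∀ {u v u′ v′} → link u v ≡ link u′ v′ → (u ≡ u′ × v ≡ v′) ⊎ (u ≡ v′ × v ≡ u′)
  link-ends {u} {v} {u′} {v′} eq with u <ᶠ? v | u′ <ᶠ? v′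
  ... | yes _ | yes _ = inj₁ (combine-injective u v u′ v′ eq)
  ... | yes _ | no _  = inj₂ (combine-injective u v v′ u′ eq)
  ... | no _  | yes _ = let p , q = combine-injective v u u′ v′ eq in inj₂ (q , p)
  ... | no _  | no _  = let p , q = combine-injective v u v′ u′ eq in inj₁ (q , p)

  sound : ∀ {k} → Affordable _≢_ κ k → (∀ u v → u ≼ v) → ∃[ X ] X ⊆ E × ∣ X ∣ ≤ k × TwoEdgeConnected n X
  sound (inj₁ refl) _ =
    ∅ , (λ e∈ → ⊥-elim (∉⊥ e∈)) , ≤-trans (≤-reflexive (∣⊥∣≡0 0)) z≤n , (λ ()) , λ e e∈ → ⊥-elim (∉⊥ e∈)
  sound {k} (inj₂ (c , a , _ , r , κ+c≤k)) all≼ with built r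
  ... | arcs , length≤ , intra , conn , oriented = X , X⊆E , ∣X∣≤k , connected , bridgeless
    where
    xs = map (uncurry link) arcs
    X = setOf xs
    X⊆E : X ⊆ E
    X⊆E e∈ with ∈-map⁻ (uncurry link) (∈-setOf⁻ xs e∈)
    ... | (u , v) , uv∈ , refl = adjacent⇒link {E} id (proj₁ (intra uv∈))
    ∣X∣≤k : ∣ X ∣ ≤ k
    ∣X∣≤k = ≤-trans (∣setOf∣≤length xs) (≤-trans (≤-reflexive (length-map (uncurry link) arcs))
              (≤-trans length≤ (≤-trans (m≤n+m c κ) κ+c≤k)))
    connected : Connected n X
    connected u v = star-map (λ uv∈ → link⇒adjacent (∈-setOf⁺ (∈-map⁺ (uncurry link) uv∈)))
                      (conn (all≼ u v , all≼ v u))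
    -- If the deleted edge carries the arc a → b, then b → a is not among the arcs. A walk from b to
    -- a that does not use a → b therefore survives and, read backwards, replaces that arc.
    bridgeless : ∀ e → e ∈ X → Connected n (X - e)
    bridgeless e e∈ u v with ∈-map⁻ (uncurry link) (∈-setOf⁻ xs e∈)
    ... | (a , b) , ab∈ , refl = kleisliStar id reroute (conn (all≼ u v , all≼ v u))
      where
      keep : ∀ {p q} → (p , q) ∈ˡ arcs × (p , q) ≢ (a , b) → Adjacent n (X - link a b) p q
      keep {p} {q} (pq∈ , ≢ab) = link⇒adjacent
        (x∈p∧x≢y⇒x∈p-y (∈-setOf⁺ (∈-map⁺ (uncurry link) pq∈)) λ eq → differ (link-ends eq))
        where
        differ : ¬ ((p ≡ a × q ≡ b) ⊎ (p ≡ b × q ≡ a))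
        differ (inj₁ (refl , refl)) = ≢ab refl
        differ (inj₂ (refl , refl)) = oriented id ab∈ pq∈
      back : Star (Adjacent n (X - link a b)) b a
      back = star-map keep (avoid-out-arc (conn (all≼ b a , all≼ a b)))
      reroute : ∀ {p q} → (p , q) ∈ˡ arcs → Star (Adjacent n (X - link a b)) p q
      reroute {p} {q} pq∈ with ≡-dec _≟ᶠ_ _≟ᶠ_ (p , q) (a , b)
      ... | yes refl = reverse swap back
      ... | no ≢ab   = keep (pq∈ , ≢ab) ◅ ε

  complete : ∀ {k X} → X ⊆ E → ∣ X ∣ ≤ k → TwoEdgeConnected n X → Affordable _≢_ κ k × (∀ u v → u ≼ v)
  complete {k} {X} X⊆E ∣X∣≤k (connected , bridgeless) = answer , all≼
    where
    adj⊆ : ∀ {u v} → Adjacent n X u v → Adjacent n E u v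
    adj⊆ = [ inj₁ ∘ X⊆E , inj₂ ∘ X⊆E ]′

    all≼ : ∀ u v → u ≼ v
    all≼ u v = star-map adj⊆ (connected u v)

    -- In a connected graph there is a single component, so κ vanishes from the budget.
    no-covers : ∀ {L} → All (uncurry Cover) L → length L ≡ 0
    no-covers []      = refl
    no-covers (c ∷ _) = ⊥-elim (no-cover _≼?_ all≼ c)

    -- Without the edge e of u → v there is still a walk from v to u, and it contains no direct step
    -- from v to u, since that step would be e again.
    return : ∀ {u v} → Adjacent n X u v → E.Return _≢_ (Adjacent n X) u v
    return {u} {v} uv =
      Adjacent n (X - e) , [ inj₁ ∘ X-e⊆X , inj₂ ∘ X-e⊆X ]′ ,
      bridgeless e (adjacent⇒link X⊆E uv) v u , λ { vw refl → not-e vw }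
      where
      e = link u v
      X-e⊆X : X - e ⊆ X
      X-e⊆X = p─q⊆p X ⁅ e ⁆
      not-e : ¬ Adjacent n (X - e) v u
      not-e vu = x∉p-x X e (adjacent⇒link (λ x∈ → X⊆E (X-e⊆X x∈)) (swap vu))

    open E _≢_
    open Completeness (Adjacent n X) link (λ uv → adj⊆ uv , all≼ _ _) link-ends
      (λ {u} {v} {w} u≢w u≢v eq → [ u≢v ∘ proj₁ , u≢w ∘ proj₁ ]′ (link-ends {u} {v} {v} {w} eq))
      id return

    F : Full ⊤
    F = spanning (proj₁ (∃-repSet _≼?_)) (proj₂ (∃-repSet _≼?_)) λ y →
      let r , rep-r , _ = ∃-rep _≼?_ y in r , proj₂ (proj₂ (∃-repSet _≼?_) r) rep-r , connected r y

    c = Full.size F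
    es = Edges.edges (Full.used F)

    c≤ : c ≤ ∣ X ∣
    c≤ = ≤-trans (≤-reflexive (sym (Edges.length≡ (Full.used F))))
           (length≤∣∣ (Edges.unique (Full.used F))
             (All.map (λ { (_ , _ , _ , _ , uv , refl) → adjacent⇒link X⊆E uv }) (Edges.all-inside (Full.used F))))

    pick : ∀ {m} → (Fin m → m ≡ n → Affordable _≢_ κ k) → m ≡ n → Affordable _≢_ κ k
    pick {zero}  f eq = inj₁ (sym eq)
    pick {suc m} f eq = f zero eq

    answer : Affordable _≢_ κ k
    answer = pick (λ { a refl → inj₂ (c , a , ≤-trans c≤ (∣p∣≤n X) , Full.reach F ∈⊤ ∈⊤ ,
      ≤-trans (≤-reflexive (cong (_+ c) (trans (sym pairs-count) (no-covers pairs-cover)))) (≤-trans c≤ ∣X∣≤k)) }) refl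

-- The program and the Warshall table

module Warshall {n : ℕ} (A : Fin n → Fin n → Set) where

  -- Walks whose inner vertices are numbered below k, in the form of the recurrence that the program
  -- evaluates.
  Via : ℕ → Fin n → Fin n → Set
  Via zero    u v = A u v ⊎ u ≡ v
  Via (suc k) u v = Via k u v ⊎ ∃[ x ] toℕ x ≡ k × Via k u x × Via k x v

  via-sound : ∀ k {u v} → Via k u v → Star A u v
  via-sound zero    (inj₁ uv)               = uv ◅ ε
  via-sound zero    (inj₂ refl)             = ε
  via-sound (suc k) (inj₁ p)                = via-sound k p
  via-sound (suc k) (inj₂ (x , _ , p , q)) = via-sound k p ◅◅ via-sound k q

  via-base : ∀ k {u v} → A u v ⊎ u ≡ v → Via k u v
  via-base zero    p = p
  via-base (suc k) p = inj₁ (via-base k p)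

  -- A walk that starts at vertex k gains nothing by passing through k: the part after that visit is
  -- enough.
  via-from : ∀ k {u v} → toℕ u ≡ k → Via (suc k) u v → Via k u v
  via-from k u≡k (inj₁ p) = p
  via-from k u≡k (inj₂ (x , x≡k , _ , q)) with toℕ-injective (trans x≡k (sym u≡k))
  ... | refl = q

  via-to : ∀ k {u v} → toℕ v ≡ k → Via (suc k) u v → Via k u v
  via-to k v≡k (inj₁ p) = p
  via-to k v≡k (inj₂ (x , x≡k , p , _)) with toℕ-injective (trans x≡k (sym v≡k))
  ... | refl = p

  via-trans : ∀ k {u a v} → toℕ a < k → Via k u a → Via k a v → Via k u v
  via-trans (suc k) {a = a} a<sk p q with toℕ a ≟ k
  ... | yes a≡k = inj₂ (a , a≡k , via-to k a≡k p , via-from k a≡k q)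
  ... | no a≢k with ≤∧≢⇒< (s≤s⁻¹ a<sk) a≢k
  ...   | a<k with p | q
  ...     | inj₁ p′                    | inj₁ q′                     = inj₁ (via-trans k a<k p′ q′)
  ...     | inj₂ (x , x≡k , p₁ , p₂)   | inj₁ q′                     = inj₂ (x , x≡k , p₁ , via-trans k a<k p₂ q′)
  ...     | inj₁ p′                    | inj₂ (x , x≡k , q₁ , q₂)    = inj₂ (x , x≡k , via-trans k a<k p′ q₁ , q₂)
  ...     | inj₂ (x , x≡k , p₁ , _)    | inj₂ (y , y≡k , _ , q₂)     with toℕ-injective (trans x≡k (sym y≡k))
  ...       | refl = inj₂ (x , x≡k , p₁ , q₂)

  via-complete : ∀ {u v} → Star A u v → Via n u v
  via-complete ε                   = via-base n (inj₂ refl)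
  via-complete (_◅_ {j = x} ux p) = via-trans n (toℕ<n x) (via-base n (inj₁ ux)) (via-complete p)

-- The terms that the program evaluates

infixl 6 _+ₜ_ _-ₜ_
infixl 7 _*ₜ_ _/ₜ_ _%ₜ_
infix  5 _≤ₜ_ _=ₜ_
infixr 4 _∧ₜ_
infixr 3 _∨ₜ_

_+ₜ_ _-ₜ_ _*ₜ_ _/ₜ_ _%ₜ_ _≤ₜ_ _=ₜ_ _∧ₜ_ _∨ₜ_ : Tm → Tm → Tm
a +ₜ b = bin add a b
a -ₜ b = bin sub a b
a *ₜ b = bin mul a b
a /ₜ b = bin div a b
a %ₜ b = a -ₜ b *ₜ (a /ₜ b)

¬ₜ_ : Tm → Tm
¬ₜ a = lit 1 -ₜ a

a ≤ₜ b = ¬ₜ (a -ₜ b)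
a =ₜ b = (a ≤ₜ b) *ₜ (b ≤ₜ a)
a ∧ₜ b = a *ₜ b
a ∨ₜ b = ¬ₜ ((¬ₜ a) *ₜ (¬ₜ b))

∃ₜ : ℕ → Poly → Tm → Tm
∃ₜ x b e = ¬ₜ (¬ₜ (sum x b e))

n̂ : Tm
n̂ = rd (lit 0)

-- Memory: the input, the powers 2ʲ for j ≤ n, the Warshall table, and the
-- table of Reach.
powBase powSize fwBase fwSize dpBase : Tm
powBase = lit 3 +ₜ n̂ *ₜ n̂
powSize = n̂ +ₜ lit 1
fwBase  = powBase +ₜ powSize
fwSize  = n̂ *ₜ (n̂ *ₜ (n̂ +ₜ lit 1))
dpBase  = fwBase +ₜ fwSize

powₜ : Tm → Tm
powₜ a = rd (powBase +ₜ a)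

-- The machine has no exponentiation, so powers are obtained by doubling. At index 0 the first
-- summand is 1 and the factor `lit 1 ≤ₜ var 0` discards the unfilled cell; at other indices the
-- first summand is 0.
powBody : Tm
powBody = (¬ₜ (var 0)) +ₜ (lit 1 ≤ₜ var 0) *ₜ (lit 2 *ₜ powₜ (var 0 -ₜ lit 1))

adjₜ : Tm → Tm → Tm
adjₜ a b = rd (lit 3 +ₜ (n̂ *ₜ a +ₜ b))

arcₜ okₜ : Bool → Tm → Tm → Tm
arcₜ false a b = adjₜ a b
arcₜ true  a b = adjₜ a b ∨ₜ adjₜ b a
okₜ false a b = lit 1
okₜ true  a b = ¬ₜ (a =ₜ b)

fwₜ : Tm → Tm → Tm → Tm
fwₜ k u v = rd (fwBase +ₜ (n̂ *ₜ (n̂ *ₜ k +ₜ u) +ₜ v))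

-- Names 4, 3, 1 hold the stage k and the vertices u, v. At stage 0 `fwNext` may read an unfilled
-- cell, which its guard discards.
fwInit fwNext : Bool → Tm
fwInit und = (var 4 =ₜ lit 0) ∧ₜ (arcₜ und (var 3) (var 1) ∨ₜ (var 3 =ₜ var 1))
fwNext und = (lit 1 ≤ₜ var 4) ∧ₜ
  (fwₜ k (var 3) (var 1) ∨ₜ (fwₜ k (var 3) k ∧ₜ fwₜ k k (var 1)))
  where k = var 4 -ₜ lit 1

fwBody : Bool → Tm
fwBody und =
  let′ 1 (var 0 %ₜ n̂) (let′ 2 (var 0 /ₜ n̂) (let′ 3 (var 2 %ₜ n̂) (let′ 4 (var 2 /ₜ n̂)
  (fwInit und ∨ₜ fwNext und))))

reachₜ simₜ precₜ : Tm → Tm → Tm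
reachₜ u v = fwₜ n̂ u v
simₜ u v   = reachₜ u v ∧ₜ reachₜ v u
precₜ u v  = reachₜ u v ∧ₜ (¬ₜ reachₜ v u)

repₜ : Tm → Tm
repₜ r = ¬ₜ ∃ₜ 11 𝕏 ((lit 1 +ₜ var 11 ≤ₜ r) ∧ₜ simₜ (var 11) r)

coverₜ : Tm → Tm → Tm
coverₜ u v = repₜ u ∧ₜ repₜ v ∧ₜ precₜ u v ∧ₜ (¬ₜ ∃ₜ 10 𝕏 (precₜ u (var 10) ∧ₜ precₜ (var 10) v))

memberₜ : Tm → Tm → Tm
memberₜ v t = (t /ₜ powₜ v) %ₜ lit 2

dpₜ : Tm → Tm → Tm → Tm → Tm
dpₜ c t v w = rd (dpBase +ₜ (n̂ *ₜ (n̂ *ₜ (powₜ n̂ *ₜ c +ₜ t) +ₜ v) +ₜ w))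

dpSize : Tm
dpSize = n̂ *ₜ (n̂ *ₜ (powₜ n̂ *ₜ (n̂ *ₜ n̂ +ₜ lit 1)))

intraₜ : Bool → Tm → Tm → Tm
intraₜ und u v = arcₜ und u v ∧ₜ reachₜ v u

-- Names 6, 5, 3, 1 hold c, the number of T, v and w. Names 10 and 11 are reserved for the
-- quantifiers inside `coverₜ` and `repₜ`, so that nothing is captured.
initₜ : Tm
initₜ = (var 6 =ₜ lit 0) ∧ₜ memberₜ (var 3) (var 5) ∧ₜ memberₜ (var 1) (var 5) ∧ₜ
        (¬ₜ ∃ₜ 7 𝕏 (¬ₜ (memberₜ (var 7) (var 5) =ₜ repₜ (var 7))))

extₜ finₜ dpBody : Bool → Tm
extₜ und = (lit 1 ≤ₜ var 6) ∧ₜ memberₜ (var 3) (var 5) ∧ₜ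
  ∃ₜ 7 𝕏 (intraₜ und (var 7) (var 3) ∧ₜ
          dpₜ (var 6 -ₜ lit 1) (var 5 -ₜ powₜ (var 3)) (var 7) (var 1))
finₜ und = (lit 2 ≤ₜ var 6) ∧ₜ memberₜ (var 3) (var 5) ∧ₜ memberₜ (var 1) (var 5) ∧ₜ
  ∃ₜ 7 𝕏 (memberₜ (var 7) (var 5) ∧ₜ
    ∃ₜ 8 𝕏 (intraₜ und (var 8) (var 7) ∧ₜ
      ∃ₜ 9 𝕏 (intraₜ und (var 7) (var 9) ∧ₜ okₜ und (var 8) (var 9) ∧ₜ
              dpₜ (var 6 -ₜ lit 2) (var 5 -ₜ powₜ (var 7)) (var 8) (var 9))))
dpBody und =
  let′ 1 (var 0 %ₜ n̂) (let′ 2 (var 0 /ₜ n̂) (let′ 3 (var 2 %ₜ n̂) (let′ 4 (var 2 /ₜ n̂)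
  (let′ 5 (var 4 %ₜ powₜ n̂) (let′ 6 (var 4 /ₜ powₜ n̂)
  (initₜ ∨ₜ (extₜ und ∨ₜ finₜ und)))))))

connₜ : Bool → Tm
connₜ false = lit 1
connₜ true  = ¬ₜ ∃ₜ 7 𝕏 (∃ₜ 8 𝕏 (¬ₜ reachₜ (var 7) (var 8)))

κₜ : Tm
κₜ = sum 7 𝕏 (sum 8 𝕏 (coverₜ (var 7) (var 8)))

-- A negative t, recognised by the sign in cell 1, is always refused. Name 12 carries κ.
affordₜ answerₜ : Tm
affordₜ = (n̂ =ₜ lit 0) ∨ₜ
  ∃ₜ 6 (𝕏 ⊗ 𝕏 ⊕ 𝕂 1) (∃ₜ 7 𝕏 (dpₜ (var 6) (powₜ n̂ -ₜ lit 1) (var 7) (var 7) ∧ₜ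
                              (var 12 +ₜ var 6 ≤ₜ rd (lit 2))))
answerₜ = (rd (lit 1) =ₜ lit 0) ∧ₜ let′ 12 κₜ affordₜ

Arcs : Bool → ∀ n → PairSet n → Fin n → Fin n → Set
Arcs false n A = Arc n A
Arcs true  n E = Adjacent n E

OkPair : Bool → ∀ {n} → Fin n → Fin n → Set
OkPair false _ _ = Unit
OkPair true  u w = u ≢ w

P₀ F₀ D₀ : ℕ → ℕ
P₀ n = 3 + n * n
F₀ n = P₀ n + (n + 1)
D₀ n = F₀ n + n * (n * (n + 1))

fwCode : ℕ → ℕ → ℕ → ℕ → ℕ
fwCode n k u v = n * (n * k + u) + v

dpCode : ℕ → ℕ → ℕ → ℕ → ℕ → ℕ
dpCode n c t v w = n * (n * (2 ^ n * c + t) + v) + w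

record Evals (e : Tm) (ρ m : ℕ → ℕ) (v : ℕ) : Set where
  constructor evals
  field
    val≡ : val e ρ m ≡ v

open Evals

record Means (e : Tm) (ρ m : ℕ → ℕ) (P : Set) : Set where
  constructor means
  field
    truth : Truth (val e ρ m) P

open Means

module _ {ρ m : ℕ → ℕ} where

  evals-bin : ∀ {o a b x y} → Evals a ρ m x → Evals b ρ m y → Evals (bin o a b) ρ m (⟦ o ⟧ x y)
  evals-bin (evals refl) (evals refl) = evals refl

  evals-rd : ∀ {a x} → Evals a ρ m x → Evals (rd a) ρ m (m x)
  evals-rd (evals refl) = evals refl

  evals-≡ : ∀ {e x y} → x ≡ y → Evals e ρ m x → Evals e ρ m y
  evals-≡ refl e = e

  evals-% : ∀ {a b k q r} → r < k → Evals a ρ m (k * q + r) → Evals b ρ m k → Evals (a %ₜ b) ρ m r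
  evals-% {k = k} {q} r<k ea eb =
    evals-≡ (mod-code k q r<k) (evals-bin ea (evals-bin eb (evals-bin ea eb)))

  evals-/ : ∀ {a b k q r} → r < k → Evals a ρ m (k * q + r) → Evals b ρ m k → Evals (a /ₜ b) ρ m q
  evals-/ {k = k} {q} r<k ea eb = evals-≡ (div-code k q r<k) (evals-bin ea eb)

  means-let : ∀ {x a e v P} → Evals a ρ m v → Means e (ρ [ x ↦ v ]) m P → Means (let′ x a e) ρ m P
  means-let (evals refl) (means t) = means t

  means-map : ∀ {e P Q} → (P → Q) → (Q → P) → Means e ρ m P → Means e ρ m Q
  means-map f g (means t) = means (truth-map f g t)

  means-∧ : ∀ {a b P Q} → Means a ρ m P → (P → Means b ρ m Q) → Means (a ∧ₜ b) ρ m (P × Q)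
  means-∧ (means t) u = means (truth-× t (λ p → truth (u p)))

  means-∨ : ∀ {a b P Q} → Means a ρ m P → Means b ρ m Q → Means (a ∨ₜ b) ρ m (P ⊎ Q)
  means-∨ (means t) (means u) = means (truth-⊎ t u)

  means-¬ : ∀ {a P} → Means a ρ m P → Means (¬ₜ a) ρ m (¬ P)
  means-¬ (means t) = means (truth-¬ t)

  means-⇔ : ∀ {a b P Q} → Means a ρ m P → Means b ρ m Q → Means (a =ₜ b) ρ m ((P → Q) × (Q → P))
  means-⇔ (means t) (means u) = means (truth-⇔ t u)

  means-≤ : ∀ {a b x y} → Evals a ρ m x → Evals b ρ m y → Means (a ≤ₜ b) ρ m (x ≤ y)
  means-≤ (evals refl) (evals refl) = means (truth-≤ _ _)

  means-≡ : ∀ {a b x y} → Evals a ρ m x → Evals b ρ m y → Means (a =ₜ b) ρ m (x ≡ y)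
  means-≡ {a} {b} (evals refl) (evals refl) = means (truth-≡ (val a ρ m) (val b ρ m))

  means-≡Fin : ∀ {n a b} {u v : Fin n} → Evals a ρ m (toℕ u) → Evals b ρ m (toℕ v) → Means (a =ₜ b) ρ m (u ≡ v)
  means-≡Fin ea eb = means-map toℕ-injective (cong toℕ) (means-≡ ea eb)

  means-∃ : ∀ {n x e} {P : Fin n → Set} → m 0 ≡ n → (∀ i → Means e (ρ [ x ↦ toℕ i ]) m (P i)) →
            Means (∃ₜ x 𝕏 e) ρ m (∃[ i ] P i)
  means-∃ eq t = means (truth-∃Fin eq (λ i → truth (t i)))

  means-cell : ∀ {a x P} → Evals a ρ m x → Truth (m x) P → Means (rd a) ρ m P
  means-cell (evals refl) t = means t

-- The outermost shape of a term bounds its value by 1. A stored value is thus small even at an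
-- index not known to be a code.
record Boolean (e : Tm) : Set where
  field
    ≤1 : ∀ ρ m → val e ρ m ≤ 1

open Boolean

boolean-∨ : ∀ {a b} → Boolean (a ∨ₜ b)
≤1 (boolean-∨ {a} {b}) ρ m = m∸n≤m 1 ((1 ∸ val a ρ m) * (1 ∸ val b ρ m))

boolean-let : ∀ {x a e} → Boolean e → Boolean (let′ x a e)
≤1 (boolean-let B) ρ m = ≤1 B _ m

module Meaning (und : Bool) {n : ℕ} (G : PairSet n) where

  open Condensation (Arcs und n G)
  open Warshall (Arcs und n G)
  open E (OkPair und)

  record Input (m : ℕ → ℕ) : Set where
    field
      order≡ : m 0 ≡ n
      adj    : ∀ u v → Truth (m (3 + (n * toℕ u + toℕ v))) (Arc n G u v)

  open Input

  input-≗ : ∀ {m m′} → (∀ a → a < P₀ n → m′ a ≡ m a) → Input m → Input m′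
  order≡ (input-≗ eq I) = trans (eq 0 (s≤s z≤n)) (order≡ I)
  adj (input-≗ eq I) u v =
    subst (λ x → Truth x (Arc n G u v))
      (sym (eq _ (+-monoʳ-< 3 (code-< n (toℕ<n u) (toℕ<n v))))) (adj I u v)

  Pows : (ℕ → ℕ) → Set
  Pows m = ∀ j → j < n + 1 → m (P₀ n + j) ≡ 2 ^ j

  module _ {m : ℕ → ℕ} (I : Input m) {ρ : ℕ → ℕ} where

    evals-n : Evals n̂ ρ m n
    evals-n = evals (order≡ I)

    evals-powBase : Evals powBase ρ m (P₀ n)
    evals-powBase = evals-bin (evals refl) (evals-bin evals-n evals-n)

    evals-fwBase : Evals fwBase ρ m (F₀ n)
    evals-fwBase = evals-bin evals-powBase (evals-bin evals-n (evals refl))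

    evals-fwSize : Evals fwSize ρ m (n * (n * (n + 1)))
    evals-fwSize = evals-bin evals-n (evals-bin evals-n (evals-bin evals-n (evals refl)))

    evals-dpBase : Evals dpBase ρ m (D₀ n)
    evals-dpBase = evals-bin evals-fwBase evals-fwSize

    means-adj : ∀ {a b u v} → Evals a ρ m (toℕ u) → Evals b ρ m (toℕ v) →
                Means (adjₜ a b) ρ m (Arc n G u v)
    means-adj {u = u} {v} ea eb =
      means-cell (evals-bin (evals refl) (evals-bin (evals-bin evals-n ea) eb)) (adj I u v)

    means-arc : ∀ d {a b u v} → Evals a ρ m (toℕ u) → Evals b ρ m (toℕ v) →
                Means (arcₜ d a b) ρ m (Arcs d n G u v)
    means-arc false ea eb = means-adj ea eb
    means-arc true  ea eb = means-∨ (means-adj ea eb) (means-adj eb ea)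

    means-ok : ∀ d {a b} {u v : Fin n} → Evals a ρ m (toℕ u) → Evals b ρ m (toℕ v) →
               Means (okₜ d a b) ρ m (OkPair d u v)
    means-ok false ea eb = means truth-unit
    means-ok true  ea eb = means-¬ (means-≡Fin ea eb)

    evals-fwCell : ∀ {a b c k u v} → Evals a ρ m k → Evals b ρ m u → Evals c ρ m v →
                   Evals (fwₜ a b c) ρ m (m (F₀ n + fwCode n k u v))
    evals-fwCell ea eb ec = evals-rd (evals-bin evals-fwBase
      (evals-bin (evals-bin evals-n (evals-bin (evals-bin evals-n ea) eb)) ec))

  PowEntry : ℕ → ℕ → Set
  PowEntry i x = x ≡ 2 ^ i

  pow-step : ∀ i m → (∀ j → j < i → PowEntry j (m (P₀ n + j))) → Input m →
             PowEntry i (val powBody (zeros [ 0 ↦ i ]) m)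
  pow-step zero    m prev I = refl
  pow-step (suc i) m prev I rewrite 0∸n≡0 i = begin
      1 * (2 * x)                          ≡⟨ *-identityˡ (2 * x) ⟩
      2 * m (3 + m 0 * m 0 + i)            ≡⟨ cong (λ n → 2 * m (3 + n * n + i)) (order≡ I) ⟩
      2 * m (3 + n * n + i)                ≡⟨ cong (2 *_) (prev i ≤-refl) ⟩
      2 * 2 ^ i                            ∎
    where
    open ≡-Reasoning
    x = m (3 + m 0 * m 0 + i)

  -- The meaning is stated for every way of writing the index as a code, so no inverse of the coding
  -- enters.
  FwEntry : ℕ → ℕ → Set
  FwEntry i x = x ≤ 1 × (∀ k u v → k < n + 1 → i ≡ fwCode n k (toℕ u) (toℕ v) → Truth x (Via k u v))

  fwCode-< : ∀ {k k′ u v} → k < k′ → u < n → v < n → fwCode n k u v < n * (n * k′)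
  fwCode-< k<k′ u<n v<n = code-< n (code-< n k<k′ u<n) v<n

  fw-entry : ∀ k u v m → let i = fwCode n k (toℕ u) (toℕ v) in k < n + 1 →
             (∀ j → j < i → FwEntry j (m (F₀ n + j))) → Input m →
             Means (fwBody und) (zeros [ 0 ↦ i ]) m (Via k u v)
  fw-entry k u v m k≤n prev I =
      means-let (evals-% {q = n * k + toℕ u} (toℕ<n v) (evals refl) (evals-n I))
      (means-let (evals-/ {r = toℕ v} (toℕ<n v) (evals refl) (evals-n I))
      (means-let (evals-% {q = k} (toℕ<n u) (evals refl) (evals-n I))
      (means-let (evals-/ {r = toℕ u} (toℕ<n u) (evals refl) (evals-n I))
      (go k k≤n prev))))
      where
      ρ : ℕ → ℕ → ℕ
      ρ k = zeros [ 0 ↦ fwCode n k (toℕ u) (toℕ v) ] [ 1 ↦ toℕ v ] [ 2 ↦ n * k + toℕ u ] [ 3 ↦ toℕ u ] [ 4 ↦ k ]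
      go : ∀ k → k < n + 1 → (∀ j → j < fwCode n k (toℕ u) (toℕ v) → FwEntry j (m (F₀ n + j))) →
           Means (fwInit und ∨ₜ fwNext und) (ρ k) m (Via k u v)
      go zero k≤n prev = means-map
        [ proj₂ , (λ ()) ∘ proj₁ ]′ (λ p → inj₁ (refl , p))
        (means-∨
          (means-∧ (means-≡ (evals {v = 0} refl) (evals {v = 0} refl)) λ _ →
            means-∨ (means-arc I und (evals refl) (evals refl)) (means-≡Fin (evals refl) (evals refl)))
          -- The guard is false at stage 0, so any meaning may be given to the second factor; `Unit`
          -- is a placeholder.
          (means-∧ {Q = Unit} (means-≤ (evals {v = 1} refl) (evals {v = 0} refl)) λ ()))
      go (suc k) k<n prev = means-map
        [ (λ ()) ∘ proj₁ , proj₂ ]′ (λ p → inj₂ (s≤s z≤n , p))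
        (means-∨
          (means-∧ {Q = Unit} (means-≡ (evals {v = suc k} refl) (evals {v = 0} refl)) λ ())
          (means-∧ (means-≤ (evals {v = 1} refl) (evals {v = suc k} refl)) λ _ →
            means-∨ (look u v (evals refl) (evals refl))
            (means-map (λ (p , q) → x , x≡k , p , q)
                       (λ { (y , y≡k , p , q) → subst (λ y → Via k u y × Via k y v)
                              (toℕ-injective (trans y≡k (sym x≡k))) (p , q) })
              (means-∧ (look u x (evals refl) (evals (sym x≡k))) λ _ →
                        look x v (evals (sym x≡k)) (evals refl)))))
        where
        k<n′ : k < n
        k<n′ = s≤s⁻¹ (subst (2 + k ≤_) (+-comm n 1) k<n)
        x : Fin n
        x = fromℕ< k<n′
        x≡k = toℕ-fromℕ< k<n′
        look : ∀ {a b} u′ v′ → Evals a (ρ (suc k)) m (toℕ u′) → Evals b (ρ (suc k)) m (toℕ v′) →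
               Means (fwₜ (var 4 -ₜ lit 1) a b) (ρ (suc k)) m (Via k u′ v′)
        look u′ v′ ea eb = means (subst (λ x → Truth x (Via k u′ v′))
          (sym (val≡ (evals-fwCell I {ρ = ρ (suc k)} {a = var 4 -ₜ lit 1} {k = k} (evals refl) ea eb)))
          (proj₂ (prev (fwCode n k (toℕ u′) (toℕ v′))
                   (≤-trans (fwCode-< ≤-refl (toℕ<n u′) (toℕ<n v′))
                     (≤-trans (*-monoʳ-≤ n (m≤m+n (n * suc k) (toℕ u))) (m≤m+n _ (toℕ v)))))
             k u′ v′ (<⇒≤ k<n) refl))

  fw-step : ∀ i m → (∀ j → j < i → FwEntry j (m (F₀ n + j))) → Input m →
            FwEntry i (val (fwBody und) (zeros [ 0 ↦ i ]) m)
  fw-step i m prev I =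
    ≤1 boolean (zeros [ 0 ↦ i ]) m , λ { k u v k≤n refl → truth (fw-entry k u v m k≤n prev I) }
    where
    boolean : Boolean (fwBody und)
    boolean = boolean-let (boolean-let (boolean-let (boolean-let boolean-∨)))

-- The table of ears

means-∀ : ∀ {ρ m n x e} {P : Fin n → Set} → m 0 ≡ n → (∀ i → Means e (ρ [ x ↦ toℕ i ]) m (P i)) →
          Means (¬ₜ ∃ₜ x 𝕏 (¬ₜ e)) ρ m (∀ i → P i)
means-∀ eq t = means-map
  (λ ¬∃ i → decidable-stable (truth-dec (truth (t i))) λ ¬p → ¬∃ (i , ¬p))
  (λ p (i , ¬p) → ¬p (p i))
  (means-¬ (means-∃ eq (λ i → means-¬ (t i))))

means-∃< : ∀ {ρ m N x b e} {P : ℕ → Set} → ⟦ b ⟧ₚ (m 0) ≡ N → (∀ i → i < N → Means e (ρ [ x ↦ i ]) m (P i)) →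
           Means (∃ₜ x b e) ρ m (∃[ i ] i < N × P i)
means-∃< refl t = means (truth-∃ _ _ λ i i<N → truth (t i i<N))

listing-sum : ∀ {ρ m n x e} {P : Fin n → Set} → m 0 ≡ n → (∀ i → Means e (ρ [ x ↦ toℕ i ]) m (P i)) →
              Listing P (val (sum x 𝕏 e) ρ m)
listing-sum refl t = listing-Fin _ _ (λ i → truth (t i))

listing-sum₂ : ∀ {ρ m n x e} {B : Set} {P : Fin n → B → Set} → m 0 ≡ n →
               (∀ i → Listing (P i) (val e (ρ [ x ↦ toℕ i ]) m)) → Listing (uncurry P) (val (sum x 𝕏 e) ρ m)
listing-sum₂ refl t = listing-× _ _ t

module Meaning₂ (und : Bool) {n : ℕ} (G : PairSet n) where

  open Condensation (Arcs und n G)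
  open Warshall (Arcs und n G)
  open E (OkPair und)
  open Meaning und {n} G
  open Input

  Reachs : (ℕ → ℕ) → Set
  Reachs m = ∀ u v → Truth (m (F₀ n + fwCode n n (toℕ u) (toℕ v))) (u ≼ v)

  DpEntry : ℕ → ℕ → Set
  DpEntry i x = x ≤ 1 × (∀ c T v w → c ≤ n * n → i ≡ dpCode n c (num T) (toℕ v) (toℕ w) → Truth x (Reach c T v w))

  ConnectedIf : Bool → Set
  ConnectedIf false = Unit
  ConnectedIf true  = ∀ u v → u ≼ v

  dpCode-< : ∀ {c c′ t v w} → c < c′ → t < 2 ^ n → v < n → w < n → dpCode n c t v w < n * (n * (2 ^ n * c′))
  dpCode-< c<c′ t< v<n w<n = code-< n (code-< n (code-< (2 ^ n) c<c′ t<) v<n) w<n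

  dpCode-≥ : ∀ c t v w → n * (n * (2 ^ n * c)) ≤ dpCode n c t v w
  dpCode-≥ c t v w =
    ≤-trans (*-monoʳ-≤ n (≤-trans (*-monoʳ-≤ n (m≤m+n (2 ^ n * c) t)) (m≤m+n _ v))) (m≤m+n _ w)

  module _ {m : ℕ → ℕ} (I : Input m) (pows : Pows m) (reachs : Reachs m) where

    private
      n≡ = order≡ I

    module _ {ρ : ℕ → ℕ} where

      means-reach : ∀ {a b u v} → Evals a ρ m (toℕ u) → Evals b ρ m (toℕ v) → Means (reachₜ a b) ρ m (u ≼ v)
      means-reach {u = u} {v} ea eb = means (subst (λ x → Truth x (u ≼ v))
        (sym (val≡ (evals-fwCell I (evals-n I) ea eb))) (reachs u v))

      means-sim : ∀ {a b u v} → Evals a ρ m (toℕ u) → Evals b ρ m (toℕ v) → Means (simₜ a b) ρ m (u ~ v)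
      means-sim ea eb = means-∧ (means-reach ea eb) λ _ → means-reach eb ea

      means-prec : ∀ {a b u v} → Evals a ρ m (toℕ u) → Evals b ρ m (toℕ v) → Means (precₜ a b) ρ m (u ≺ v)
      means-prec ea eb = means-∧ (means-reach ea eb) λ _ → means-¬ (means-reach eb ea)

      means-intra : ∀ {a b u v} → Evals a ρ m (toℕ u) → Evals b ρ m (toℕ v) →
                    Means (intraₜ und a b) ρ m (Intra u v)
      means-intra ea eb = means-∧ (means-arc I und ea eb) λ _ → means-reach eb ea

      evals-pow : ∀ {a j} → j < n + 1 → Evals a ρ m j → Evals (powₜ a) ρ m (2 ^ j)
      evals-pow j<n ea = evals-≡ (pows _ j<n) (evals-rd (evals-bin (evals-powBase I) ea))

      evals-powFin : ∀ {a} (v : Fin n) → Evals a ρ m (toℕ v) → Evals (powₜ a) ρ m (2 ^ toℕ v)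
      evals-powFin v = evals-pow (≤-trans (toℕ<n v) (m≤m+n n 1))

      evals-2^n : Evals (powₜ n̂) ρ m (2 ^ n)
      evals-2^n = evals-pow (≤-reflexive (+-comm 1 n)) (evals-n I)

      means-member : ∀ {a t v T} → Evals a ρ m (toℕ v) → Evals t ρ m (num T) → Means (memberₜ a t) ρ m (v ∈ T)
      means-member {a} {t} {v} {T} ea et = means (subst (λ x → Truth x (v ∈ T)) (sym (val≡ e)) (truth-bit T v))
        where
        q = ⟦ div ⟧ (num T) (2 ^ toℕ v)
        e : Evals (memberₜ a t) ρ m (q ∸ 2 * ⟦ div ⟧ q 2)
        e = evals-bin eq (evals-bin (evals refl) (evals-bin eq (evals refl)))
          where eq = evals-bin {o = div} et (evals-powFin v ea)

      evals-dpCell : ∀ {a b c d k t u v} → Evals a ρ m k → Evals b ρ m t → Evals c ρ m u → Evals d ρ m v →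
                     Evals (dpₜ a b c d) ρ m (m (D₀ n + dpCode n k t u v))
      evals-dpCell ea eb ec ed = evals-rd (evals-bin (evals-dpBase I)
        (evals-bin (evals-bin (evals-n I) (evals-bin (evals-bin (evals-n I)
          (evals-bin (evals-bin evals-2^n ea) eb)) ec)) ed))

    means-rep : ∀ {ρ r u} → (∀ i → Evals r (ρ [ 11 ↦ i ]) m (toℕ u)) → Means (repₜ r) ρ m (Rep u)
    means-rep er = means-map (λ ¬∃ x x<u x~u → ¬∃ (x , x<u , x~u)) (λ rep (x , x<u , x~u) → rep x x<u x~u)
      (means-¬ (means-∃ n≡ λ x → means-∧ (means-≤ (evals refl) (er _)) λ _ → means-sim (evals refl) (er _)))

    means-cover : ∀ {ρ u v} → ρ 7 ≡ toℕ u → ρ 8 ≡ toℕ v → Means (coverₜ (var 7) (var 8)) ρ m (Cover u v)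
    means-cover {ρ} {u} {v} e₇ e₈ =
      means-∧ (means-rep λ _ → evals e₇) λ _ → means-∧ (means-rep λ _ → evals e₈) λ _ →
      means-∧ (means-prec (evals e₇) (evals e₈)) λ _ →
      means-¬ (means-∃ n≡ λ w → means-∧ (means-prec (evals e₇) (evals refl)) λ _ → means-prec (evals refl) (evals e₈))

    covers-listing : ∀ {ρ} → Listing (uncurry Cover) (val κₜ ρ m)
    covers-listing {ρ} =
      listing-sum₂ {ρ} {m} {x = 7} {e = sum 8 𝕏 (coverₜ (var 7) (var 8))} n≡ λ u →
      listing-sum {ρ [ 7 ↦ toℕ u ]} {m} {x = 8} {e = coverₜ (var 7) (var 8)} n≡ λ v → means-cover refl refl

    dp-entry : ∀ c T v w → let i = dpCode n c (num T) (toℕ v) (toℕ w) in c ≤ n * n →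
               (∀ j → j < i → DpEntry j (m (D₀ n + j))) →
               Means (dpBody und) (zeros [ 0 ↦ i ]) m (Reach c T v w)
    dp-entry c T v w c≤ prev =
      means-let (evals-% {q = n * (2 ^ n * c + num T) + toℕ v} (toℕ<n w) (evals refl) (evals-n I))
      (means-let (evals-/ {r = toℕ w} (toℕ<n w) (evals refl) (evals-n I))
      (means-let (evals-% {q = 2 ^ n * c + num T} (toℕ<n v) (evals refl) (evals-n I))
      (means-let (evals-/ {r = toℕ v} (toℕ<n v) (evals refl) (evals-n I))
      (means-let (evals-% {q = c} (num< T) (evals refl) evals-2^n)
      (means-let (evals-/ {r = num T} (num< T) (evals refl) evals-2^n)
      (means-map to from
        (means-∨ m-init (means-∨ m-ext m-fin))))))))
      where
      ρ : ℕ → ℕ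
      ρ = zeros [ 0 ↦ dpCode n c (num T) (toℕ v) (toℕ w) ] [ 1 ↦ toℕ w ]
                [ 2 ↦ n * (2 ^ n * c + num T) + toℕ v ] [ 3 ↦ toℕ v ] [ 4 ↦ 2 ^ n * c + num T ]
                [ 5 ↦ num T ] [ 6 ↦ c ]

      Init′ Ext′ Fin′ : ℕ → Set
      Init′ c = c ≡ 0 × v ∈ T × w ∈ T × IsRepSet T
      Ext′  c = 1 ≤ c × v ∈ T × ∃[ u ] Intra u v × Reach (c ∸ 1) (T - v) u w
      Fin′  c = 2 ≤ c × v ∈ T × w ∈ T × ∃[ x ] x ∈ T × ∃[ u ] Intra u x × ∃[ y ] Intra x y × OkPair und u y ×
                Reach (c ∸ 2) (T - x) u y

      to : ∀ {c} → Init′ c ⊎ (Ext′ c ⊎ Fin′ c) → Reach c T v w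
      to (inj₁ (refl , v∈ , w∈ , isRep)) = init isRep v∈ w∈
      to (inj₂ (inj₁ (s≤s _ , v∈ , u , uv , r))) = ext v∈ uv r
      to (inj₂ (inj₂ (s≤s (s≤s _) , v∈ , w∈ , x , x∈ , u , ux , y , xy , ok , r))) = fin v∈ w∈ x∈ ux xy ok r

      from : ∀ {c} → Reach c T v w → Init′ c ⊎ (Ext′ c ⊎ Fin′ c)
      from (init isRep v∈ w∈)        = inj₁ (refl , v∈ , w∈ , isRep)
      from (ext v∈ uv r)             = inj₂ (inj₁ (s≤s z≤n , v∈ , _ , uv , r))
      from (fin v∈ w∈ x∈ ux xy ok r) = inj₂ (inj₂ (s≤s (s≤s z≤n) , v∈ , w∈ , _ , x∈ , _ , ux , _ , xy , ok , r))

      member : ∀ {ρ′} {a u} → ρ′ 5 ≡ num T → Evals a ρ′ m (toℕ u) → Means (memberₜ a (var 5)) ρ′ m (u ∈ T)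
      member e₅ ea = means-member ea (evals e₅)

      -- Fewer arcs mean a smaller leading digit, so the entry read here precedes the current one
      -- and is already correct.
      look : ∀ {ρ′ k x u y a t b d} → suc k ≤ c → Evals a ρ′ m (c ∸ suc k) → x ∈ T →
             Evals t ρ′ m (num T) → Evals b ρ′ m (toℕ x) → Evals d ρ′ m (toℕ u) → ∀ {e} → Evals e ρ′ m (toℕ y) →
             Means (dpₜ a (t -ₜ powₜ b) d e) ρ′ m (Reach (c ∸ suc k) (T - x) u y)
      look {k = k} {x} {u} {y} k<c ea x∈ et eb ed ee = means (subst (λ z → Truth z (Reach (c ∸ suc k) (T - x) u y))
        (sym (val≡ (evals-dpCell ea (evals-≡ (sym (num-remove x∈)) (evals-bin {o = sub} et (evals-powFin x eb))) ed ee)))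
        (proj₂ (prev (dpCode n (c ∸ suc k) (num (T - x)) (toℕ u) (toℕ y))
                 (<-≤-trans (dpCode-< (∸-monoʳ-< (s≤s z≤n) k<c) (num< (T - x)) (toℕ<n u) (toℕ<n y))
                            (dpCode-≥ c (num T) (toℕ v) (toℕ w))))
           (c ∸ suc k) (T - x) u y (≤-trans (m∸n≤m c (suc k)) c≤) refl))

      m-init : Means initₜ ρ m (Init′ c)
      m-init = means-∧ (means-≡ (evals refl) (evals refl)) λ _ → means-∧ (member refl (evals refl)) λ _ →
        means-∧ (member refl (evals refl)) λ _ →
        means-∀ n≡ λ j → means-⇔ (member refl (evals refl)) (means-rep λ _ → evals refl)

      m-ext : Means (extₜ und) ρ m (Ext′ c)
      m-ext = means-∧ (means-≤ (evals refl) (evals refl)) λ 1≤c → means-∧ (member refl (evals refl)) λ v∈ →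
        means-∃ n≡ λ u → means-∧ (means-intra (evals refl) (evals refl)) λ _ →
        look 1≤c (evals refl) v∈ (evals refl) (evals refl) (evals refl) (evals refl)

      m-fin : Means (finₜ und) ρ m (Fin′ c)
      m-fin = means-∧ (means-≤ (evals refl) (evals refl)) λ 2≤c → means-∧ (member refl (evals refl)) λ _ →
        means-∧ (member refl (evals refl)) λ _ →
        means-∃ n≡ λ x → means-∧ (member refl (evals refl)) λ x∈ →
        means-∃ n≡ λ u → means-∧ (means-intra (evals refl) (evals refl)) λ _ →
        means-∃ n≡ λ y → means-∧ (means-intra (evals refl) (evals refl)) λ _ →
        means-∧ (means-ok I und (evals refl) (evals refl)) λ _ →
        look 2≤c (evals refl) x∈ (evals refl) (evals refl) (evals refl) (evals refl)

    means-conn : ∀ conn {ρ} → Means (connₜ conn) ρ m (ConnectedIf conn)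
    means-conn false = means truth-unit
    means-conn true  = means-map
      (λ ¬∃ u v → decidable-stable (truth-dec (reachs u v)) λ ¬r → ¬∃ (u , v , ¬r))
      (λ all (u , v , ¬r) → ¬r (all u v))
      (means-¬ (means-∃ n≡ λ u → means-∃ n≡ λ v → means-¬ (means-reach (evals refl) (evals refl))))

    Entries : Set
    Entries = ∀ c T v w → c ≤ n * n → Truth (m (D₀ n + dpCode n c (num T) (toℕ v) (toℕ w))) (Reach c T v w)

    means-afford : ∀ {ρ κ k} → Entries → ρ 12 ≡ κ → m 2 ≡ k → Means affordₜ ρ m (Affordable (OkPair und) κ k)
    means-afford {ρ} {κ} {k} entries e₁₂ e₂ = means-∨ (means-≡ (evals-n I) (evals refl))
      (means-map
        (λ (c , c< , a , r , c≤) → c , a , s≤s⁻¹ (subst (c <_) (+-comm (n * n) 1) c<) , r , c≤)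
        (λ (c , a , c≤ , r , κ+c≤) → c , subst (c <_) (+-comm 1 (n * n)) (s≤s c≤) , a , r , κ+c≤)
        (means-∃< {b = 𝕏 ⊗ 𝕏 ⊕ 𝕂 1} (cong (λ n → n * n + 1) n≡) λ c c< → means-∃ n≡ λ a →
          means-∧ (goalCell c a (s≤s⁻¹ (subst (c <_) (+-comm (n * n) 1) c<)) (evals refl) (evals refl)) λ _ →
          means-≤ (evals-bin (evals e₁₂) (evals refl)) (evals e₂)))
      where
      goalCell : ∀ {ρ a₁ a₂} c a → c ≤ n * n → Evals a₁ ρ m c → Evals a₂ ρ m (toℕ a) →
             Means (dpₜ a₁ (powₜ n̂ -ₜ lit 1) a₂ a₂) ρ m (Reach c ⊤ a a)
      goalCell c a c≤ ec ea = means (subst (λ x → Truth x (Reach c ⊤ a a))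
        (sym (val≡ (evals-dpCell ec (evals-≡ (sym (num-⊤ n)) (evals-bin {o = sub} {b = lit 1} evals-2^n (evals refl))) ea ea)))
        (entries c ⊤ a a c≤))

    means-answer : ∀ conn {ρ sgn k} → Entries → m 1 ≡ sgn → m 2 ≡ k →
                   Means (connₜ conn ∧ₜ answerₜ) ρ m
                     (ConnectedIf conn × sgn ≡ 0 × Affordable (OkPair und) (val κₜ ρ m) k)
    means-answer conn {ρ} entries e₁ e₂ =
      means-∧ (means-conn conn) λ _ → means-∧ (means-≡ (evals e₁) (evals refl)) λ _ →
      means-let (evals {v = val κₜ ρ m} refl) (means-afford entries refl e₂)

  dp-step : ∀ i m → (∀ j → j < i → DpEntry j (m (D₀ n + j))) → Input m → Pows m → Reachs m →
            DpEntry i (val (dpBody und) (zeros [ 0 ↦ i ]) m)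
  dp-step i m prev I pows reachs =
    ≤1 boolean (zeros [ 0 ↦ i ]) m , λ { c T v w c≤ refl → truth (dp-entry I pows reachs c T v w c≤ prev) }
    where
    boolean : Boolean (dpBody und)
    boolean = boolean-let (boolean-let (boolean-let (boolean-let (boolean-let (boolean-let boolean-∨)))))

-- Running the program

m≤m*e : ∀ {n} m → m ≤ m * 2 ^ n
m≤m*e {n} m = m≤m*n m (2 ^ n) {{m^n≢0 2 n}}

scale : ∀ {n a b A B} → a ≤ A * 2 ^ n → b ≤ B * 2 ^ n → a + b ≤ (A + B) * 2 ^ n
scale {n} {A = A} {B} a≤ b≤ = ≤-trans (+-mono-≤ a≤ b≤) (≤-reflexive (sym (*-distribʳ-+ (2 ^ n) A B)))

scale-fill : ∀ {n N Q} C I → N ≤ Q * 2 ^ n → C + N * I ≤ (C + Q * I) * 2 ^ n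
scale-fill {n} {N} {Q} C I N≤ = scale {n} {A = C} {B = Q * I} (m≤m*e {n} C) (begin
    N * I               ≤⟨ *-monoˡ-≤ I N≤ ⟩
    Q * 2 ^ n * I       ≡⟨ *-assoc Q (2 ^ n) I ⟩
    Q * (2 ^ n * I)     ≡⟨ cong (Q *_) (*-comm (2 ^ n) I) ⟩
    Q * (I * 2 ^ n)     ≡⟨ *-assoc Q I (2 ^ n) ⟨
    Q * I * 2 ^ n       ∎)
  where open ≤-Reasoning

-- Without abstraction the cost polynomials of the concrete program would be
-- unfolded, and their normal forms are huge.
abstract

  fillProgram : Tm → Tm → Tm → Cmd
  fillProgram = fill

  termProgram : Tm → Cmd
  termProgram = comp 1 zeros

  fillBound : Tm → Tm → Tm → ℕ → ℕ → ℕ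
  fillBound base size body N z = ⟦ fillCost base size body ⟧ₚ z + N * ⟦ fillIterCost base size body ⟧ₚ z

  fillPoly : Tm → Tm → Tm → Poly → Poly
  fillPoly base size body q = fillCost base size body ⊕ q ⊗ fillIterCost base size body

  termPoly : Tm → Poly
  termPoly e = cost e noBits

  fill-runs : ∀ {base size body z m₀ B N Q} → MemOK z m₀ → Evals base zeros m₀ B → Evals size zeros m₀ N → 0 < B →
    Steps body z B N Q m₀ → ∀ r → r 0 ≡ 0 →
    ∃[ r′ ] ∃[ m′ ] Runs (fillProgram base size body) r m₀ r′ m′ (fillBound base size body N z)
      × Table z B Q m₀ N m′ × r′ 0 ≡ 0
  fill-runs {base} {size} {body} ok (evals refl) (evals refl) 0<B step = fill-correct base size body ok 0<B step

  fillBound-≤ : ∀ base size body q {n N z} → N ≤ ⟦ q ⟧ₚ z * 2 ^ n →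
                fillBound base size body N z ≤ ⟦ fillPoly base size body q ⟧ₚ z * 2 ^ n
  fillBound-≤ base size body q {n} {z = z} =
    scale-fill {n} {Q = ⟦ q ⟧ₚ z} (⟦ fillCost base size body ⟧ₚ z) (⟦ fillIterCost base size body ⟧ₚ z)

  term-runs : ∀ e {z m r} → MemOK z m → r 0 ≡ 0 →
              ∃[ r′ ] Runs (termProgram e) r m r′ m (⟦ termPoly e ⟧ₚ z) × r′ 1 ≡ val e zeros m
  term-runs e ok r0 =
    let r′ , runs , _ , eq = comp-correct e {β = noBits} ok (mkEnv λ _ → s≤s z≤n , r0) (λ _ → z≤n)
    in r′ , runs , eq

program : Bool → Bool → Cmd
program und conn =
    fillProgram powBase powSize powBody
  ⨾ fillProgram fwBase fwSize (fwBody und)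
  ⨾ fillProgram dpBase dpSize (dpBody und)
  ⨾ termProgram (connₜ conn ∧ₜ answerₜ)
  ⨾ 0 ≔ reg 1

programPoly : Bool → Bool → Poly
programPoly und conn =
  fillPoly powBase powSize powBody (𝕏 ⊕ 𝕂 1) ⊕
  (fillPoly fwBase fwSize (fwBody und) (𝕏 ⊗ (𝕏 ⊗ (𝕏 ⊕ 𝕂 1))) ⊕
  (fillPoly dpBase dpSize (dpBody und) (𝕏 ⊗ (𝕏 ⊗ (𝕏 ⊗ 𝕏 ⊕ 𝕂 1))) ⊕
  (termPoly (connₜ conn ∧ₜ answerₜ) ⊕ 𝕂 2)))

module Run (und conn : Bool) {n : ℕ} (G : PairSet n) where

  open Condensation (Arcs und n G)
  open Warshall (Arcs und n G)
  open Meaning und {n} G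
  open Meaning₂ und {n} G
  open Input

  -- Besides the answer, the run yields what the graph theorems take as input: decidability of
  -- reachability, read from the Warshall table, and the covering pairs counted by κ.
  Outcome : ℕ → ℕ → ℕ → Set
  Outcome sgn abs x = (∀ u v → Dec (u ≼ v)) × ∃[ κ ] Listing (uncurry Cover) κ ×
    Truth x (ConnectedIf conn × sgn ≡ 0 × Affordable (OkPair und) κ abs)

  module _ {z : ℕ} {m₀ : ℕ → ℕ} (ok₀ : MemOK z m₀) (n≤z : n ≤ z) (I₀ : Input m₀) where

    P₀≤F₀ : P₀ n ≤ F₀ n
    P₀≤F₀ = m≤m+n (P₀ n) (n + 1)

    F₀≤D₀ : F₀ n ≤ D₀ n
    F₀≤D₀ = m≤m+n (F₀ n) _

    1≤2^z : 1 ≤ 2 ^ z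
    1≤2^z = m^n>0 2 z

    Pows-≗ : ∀ {m m′} → (∀ a → a < F₀ n → m′ a ≡ m a) → Pows m → Pows m′
    Pows-≗ eq pows j j< = trans (eq _ (+-monoʳ-< (P₀ n) j<)) (pows j j<)

    Reachs-≗ : ∀ {m m′} → (∀ a → a < D₀ n → m′ a ≡ m a) → Reachs m → Reachs m′
    Reachs-≗ eq reachs u v = subst (λ x → Truth x (u ≼ v))
      (sym (eq _ (+-monoʳ-< (F₀ n) (fwCode-< (≤-reflexive (+-comm 1 n)) (toℕ<n u) (toℕ<n v))))) (reachs u v)

    below-P₀ : ∀ {B Q m i m′} → P₀ n ≤ B → Table z B Q m i m′ → Input m → Input m′
    below-P₀ P₀≤B tab = input-≗ (λ a a< → below tab a (<-≤-trans a< P₀≤B))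

    powPhase : ∃[ r ] ∃[ m ] Runs (fillProgram powBase powSize powBody) zeros m₀ r m
                               (fillBound powBase powSize powBody (n + 1) z)
               × Table z (P₀ n) PowEntry m₀ (n + 1) m × r 0 ≡ 0
    powPhase = fill-runs ok₀ (evals-powBase I₀) (evals-bin {o = add} {b = lit 1} (evals-n I₀) (evals refl)) (s≤s z≤n)
      (λ i m i<N tab →
        let v≡ = pow-step i m (entry tab) (below-P₀ ≤-refl tab I₀) in
        v≡ , ≤-trans (≤-reflexive v≡) (2^-mono (≤-trans (s≤s⁻¹ (subst (i <_) (+-comm n 1) i<N)) n≤z)))
      zeros refl

    fwPhase : ∀ {m₁ r₁} → MemOK z m₁ → Input m₁ → r₁ 0 ≡ 0 →
              ∃[ r ] ∃[ m ] Runs (fillProgram fwBase fwSize (fwBody und)) r₁ m₁ r m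
                              (fillBound fwBase fwSize (fwBody und) (n * (n * (n + 1))) z)
              × Table z (F₀ n) FwEntry m₁ (n * (n * (n + 1))) m × r 0 ≡ 0
    fwPhase {r₁ = r₁} ok₁ I₁ r₁0 = fill-runs ok₁ (evals-fwBase I₁) (evals-fwSize I₁) (s≤s z≤n)
      (λ i m i<N tab →
        let e = fw-step i m (entry tab) (below-P₀ P₀≤F₀ tab I₁) in
        e , ≤-trans (proj₁ e) 1≤2^z)
      r₁ r₁0

    fw-reachs : ∀ {m₁ m} → Table z (F₀ n) FwEntry m₁ (n * (n * (n + 1))) m → Reachs m
    fw-reachs tab u v = truth-map (via-sound n) via-complete
      (proj₂ (entry tab (fwCode n n (toℕ u) (toℕ v)) (fwCode-< n<n+1 (toℕ<n u) (toℕ<n v))) n u v n<n+1 refl)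
      where
      n<n+1 : n < n + 1
      n<n+1 = ≤-reflexive (+-comm 1 n)

    dpPhase : ∀ {m₂ r₂} → MemOK z m₂ → Input m₂ → Pows m₂ → Reachs m₂ → r₂ 0 ≡ 0 →
              ∃[ r ] ∃[ m ] Runs (fillProgram dpBase dpSize (dpBody und)) r₂ m₂ r m
                              (fillBound dpBase dpSize (dpBody und) (n * (n * (2 ^ n * (n * n + 1)))) z)
              × Table z (D₀ n) DpEntry m₂ (n * (n * (2 ^ n * (n * n + 1)))) m × r 0 ≡ 0
    dpPhase {r₂ = r₂} ok₂ I₂ pows₂ reachs₂ r₂0 = fill-runs ok₂ (evals-dpBase I₂) size (s≤s z≤n)
      (λ i m i<N tab →
        let e = dp-step i m (entry tab) (below-P₀ (≤-trans P₀≤F₀ F₀≤D₀) tab I₂)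
                  (Pows-≗ (λ a a< → below tab a (<-≤-trans a< F₀≤D₀)) pows₂)
                  (Reachs-≗ (below tab) reachs₂) in
        e , ≤-trans (proj₁ e) 1≤2^z)
      r₂ r₂0
      where
      size : Evals dpSize zeros _ (n * (n * (2 ^ n * (n * n + 1))))
      size = evals-bin (evals-n I₂) (evals-bin (evals-n I₂) (evals-bin (evals-2^n I₂ pows₂ reachs₂)
               (evals-bin (evals-bin (evals-n I₂) (evals-n I₂)) (evals refl))))

    dp-entries : ∀ {m₂ m} (I : Input m) (pows : Pows m) (reachs : Reachs m) →
                 Table z (D₀ n) DpEntry m₂ (n * (n * (2 ^ n * (n * n + 1)))) m → Entries I pows reachs
    dp-entries _ _ _ tab c T v w c≤ = proj₂ (entry tab _
      (dpCode-< (≤-trans (s≤s c≤) (≤-reflexive (+-comm 1 (n * n)))) (num< T) (toℕ<n v) (toℕ<n w))) c T v w c≤ refl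

    -- Only the ear table has exponentially many entries; the other phases are multiplied by 2ⁿ just
    -- to share one bound.
    total : ∀ {k} → k ≤ fillBound powBase powSize powBody (n + 1) z
                      + (fillBound fwBase fwSize (fwBody und) (n * (n * (n + 1))) z
                      + (fillBound dpBase dpSize (dpBody und) (n * (n * (2 ^ n * (n * n + 1)))) z
                      + (⟦ termPoly (connₜ conn ∧ₜ answerₜ) ⟧ₚ z + 2))) →
            k ≤ ⟦ programPoly und conn ⟧ₚ z * 2 ^ n
    total k≤ = ≤-trans k≤
      (scale {n} {A = p₁} {B = p₂ + (p₃ + p₄)}
        (fillBound-≤ powBase powSize powBody (𝕏 ⊕ 𝕂 1) {n}
          (≤-trans (poly-mono (𝕏 ⊕ 𝕂 1) n≤z) (m≤m*e {n} (z + 1))))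
      (scale {n} {A = p₂} {B = p₃ + p₄}
        (fillBound-≤ fwBase fwSize (fwBody und) (𝕏 ⊗ (𝕏 ⊗ (𝕏 ⊕ 𝕂 1))) {n}
          (≤-trans (poly-mono (𝕏 ⊗ (𝕏 ⊗ (𝕏 ⊕ 𝕂 1))) n≤z) (m≤m*e {n} (z * (z * (z + 1))))))
      (scale {n} {A = p₃} {B = p₄}
        (fillBound-≤ dpBase dpSize (dpBody und) (𝕏 ⊗ (𝕏 ⊗ (𝕏 ⊗ 𝕏 ⊕ 𝕂 1))) {n} N₃≤)
      (m≤m*e {n} p₄))))
      where
      p₁ p₂ p₃ p₄ : ℕ
      p₁ = ⟦ fillPoly powBase powSize powBody (𝕏 ⊕ 𝕂 1) ⟧ₚ z
      p₂ = ⟦ fillPoly fwBase fwSize (fwBody und) (𝕏 ⊗ (𝕏 ⊗ (𝕏 ⊕ 𝕂 1))) ⟧ₚ z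
      p₃ = ⟦ fillPoly dpBase dpSize (dpBody und) (𝕏 ⊗ (𝕏 ⊗ (𝕏 ⊗ 𝕏 ⊕ 𝕂 1))) ⟧ₚ z
      p₄ = ⟦ termPoly (connₜ conn ∧ₜ answerₜ) ⟧ₚ z + 2
      N₃≤ : n * (n * (2 ^ n * (n * n + 1))) ≤ z * (z * (z * z + 1)) * 2 ^ n
      N₃≤ = begin
        n * (n * (2 ^ n * (n * n + 1)))     ≡⟨ cong (λ x → n * (n * x)) (*-comm (2 ^ n) (n * n + 1)) ⟩
        n * (n * ((n * n + 1) * 2 ^ n))     ≡⟨ cong (n *_) (*-assoc n (n * n + 1) (2 ^ n)) ⟨
        n * (n * (n * n + 1) * 2 ^ n)       ≡⟨ *-assoc n (n * (n * n + 1)) (2 ^ n) ⟨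
        n * (n * (n * n + 1)) * 2 ^ n       ≤⟨ *-monoˡ-≤ (2 ^ n) (poly-mono (𝕏 ⊗ (𝕏 ⊗ (𝕏 ⊗ 𝕏 ⊕ 𝕂 1))) n≤z) ⟩
        z * (z * (z * z + 1)) * 2 ^ n       ∎
        where open ≤-Reasoning

    run : ∃[ s ] ∃[ k ] ⟨ program und conn , ⟪ zeros , m₀ ⟫ ⟩⇓ s ∣ k ×
          k ≤ ⟦ programPoly und conn ⟧ₚ z * 2 ^ n × Outcome (m₀ 1) (m₀ 2) (regs s 0)
    run with powPhase
    ... | r₁ , m₁ , run₁ , tab₁ , r₁0 with fwPhase {r₁ = r₁} (ok tab₁) (below-P₀ ≤-refl tab₁ I₀) r₁0
    ... | r₂ , m₂ , run₂ , tab₂ , r₂0 = result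
      where
      I₂ : Input m₂
      I₂ = below-P₀ P₀≤F₀ tab₂ (below-P₀ ≤-refl tab₁ I₀)
      pows₂ : Pows m₂
      pows₂ = Pows-≗ (below tab₂) (entry tab₁)
      result : ∃[ s ] ∃[ k ] ⟨ program und conn , ⟪ zeros , m₀ ⟫ ⟩⇓ s ∣ k ×
               k ≤ ⟦ programPoly und conn ⟧ₚ z * 2 ^ n × Outcome (m₀ 1) (m₀ 2) (regs s 0)
      result with dpPhase {r₂ = r₂} (ok tab₂) I₂ pows₂ (fw-reachs tab₂) r₂0
      ... | r₃ , m₃ , run₃ , tab₃ , r₃0 with term-runs (connₜ conn ∧ₜ answerₜ) {r = r₃} (ok tab₃) r₃0
      ... | r₄ , run₄ , r₄1 =
        _ , proj₁ runs , proj₁ (proj₂ runs) , total (proj₂ (proj₂ runs)) ,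
        (λ u v → truth-dec (reachs₃ u v)) , _ , covers-listing I₃ pows₃ reachs₃ {zeros} , answer
        where
        I₃ : Input m₃
        I₃ = below-P₀ (≤-trans P₀≤F₀ F₀≤D₀) tab₃ I₂
        pows₃ : Pows m₃
        pows₃ = Pows-≗ (λ a a< → below tab₃ a (<-≤-trans a< F₀≤D₀)) pows₂
        reachs₃ : Reachs m₃
        reachs₃ = Reachs-≗ (below tab₃) (fw-reachs tab₂)
        same : ∀ a → a < P₀ n → m₃ a ≡ m₀ a
        same a a< = trans (below tab₃ a (<-≤-trans a< (≤-trans P₀≤F₀ F₀≤D₀)))
                   (trans (below tab₂ a (<-≤-trans a< P₀≤F₀)) (below tab₁ a a<))
        Holds : Set
        Holds = ConnectedIf conn × m₀ 1 ≡ 0 × Affordable (OkPair und) (val κₜ zeros m₃) (m₀ 2)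
        answer : Truth (r₄ 1) Holds
        answer = subst (λ x → Truth x Holds) (sym r₄1)
          (truth (means-answer I₃ pows₃ reachs₃ conn {zeros} (dp-entries I₃ pows₃ reachs₃ tab₃)
            (same 1 (s≤s (s≤s z≤n))) (same 2 (s≤s (s≤s (s≤s z≤n))))))
        -- The last command copies 0 or 1, which is paid for by the `𝕂 2` in `programPoly`.
        len≤1 : len (r₄ 1) ≤ 1
        len≤1 = len≤ {w = 0} (truth-≤1 answer)
        runs = runs-seq run₁ (runs-seq run₂ (runs-seq run₃ (runs-seq run₄ (runs-reg {0} {reg 1} len≤1 len≤1))))

-- The three problems

n<2^len : ∀ n → n < 2 ^ len n
n<2^len n = ≰⇒> λ 2^≤n →
  1+n≰n (≤-trans (≤-reflexive (sym (⌊log₂[2^n]⌋≡n (len n)))) (⌊log₂⌋-mono-≤ 2^≤n))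

nth≤ : ∀ xs i → nth xs i ≤ 2 ^ inputSize xs
nth≤ []       i       = z≤n
nth≤ (x ∷ xs) zero    = ≤-trans (<⇒≤ (n<2^len x)) (2^-mono (m≤m+n (len x) (inputSize xs)))
nth≤ (x ∷ xs) (suc i) = ≤-trans (nth≤ xs i) (2^-mono (m≤n+m (inputSize xs) (len x)))

length≤inputSize : ∀ xs → length xs ≤ inputSize xs
length≤inputSize []       = z≤n
length≤inputSize (x ∷ xs) = +-mono-≤ {1} {len x} (s≤s z≤n) (length≤inputSize xs)

truth-nth : ∀ {N} (G : Subset N) e → Truth (nth (map bit (toList G)) (toℕ e)) (e ∈ G)
truth-nth (true ∷ G)  zero    = inj₁ (refl , here)
truth-nth (false ∷ G) zero    = inj₂ (refl , λ ())
truth-nth (b ∷ G)     (suc e) = truth-map there drop-there (truth-nth G e)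

n≤n*n : ∀ n → n ≤ n * n
n≤n*n zero      = z≤n
n≤n*n n@(suc _) = m≤m*n n n

-- Each of the n² matrix cells contributes at least 1 to the input size; so n itself, and not only
-- its bit length, is bounded by it.
order≤ : ∀ n sgn abs (G : PairSet n) → n ≤ suc (inputSize (n ∷ sgn ∷ abs ∷ map bit (toList G)))
order≤ n sgn abs G = begin
    n                                             ≤⟨ n≤n*n n ⟩
    n * n                                         ≡⟨ length-toList G ⟨
    length (toList G)                             ≡⟨ length-map bit (toList G) ⟨
    length (map bit (toList G))                   ≤⟨ m≤n+m _ 3 ⟩
    length xs                                     ≤⟨ length≤inputSize xs ⟩
    inputSize xs                                  ≤⟨ n≤1+n _ ⟩
    suc (inputSize xs)                            ∎
  where
  open ≤-Reasoning
  xs = n ∷ sgn ∷ abs ∷ map bit (toList G)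

module _ (und conn : Bool) (n : ℕ) (G : PairSet n) (t : ℤ) where

  open Condensation (Arcs und n G)
  open Meaning₂ und {n} G using (ConnectedIf)

  Verdict : ℕ → Set
  Verdict κ = ConnectedIf conn × ∃[ k ] t ≡ ℤ.+ k × Affordable (OkPair und) κ k

  Decided : Set
  Decided =
    (∀ u v → Dec (u ≼ v)) × ∃[ κ ] Listing (uncurry Cover) κ ×
    ∃[ s ] ∃[ k ] ⟨ program und conn , initial (encodeGraph n G t) ⟩⇓ s ∣ k × Answers (Verdict κ) s ×
      k ≤ ⟦ programPoly und conn ⟧ₚ (suc (inputSize (encodeGraph n G t))) * 2 ^ n

ListRun : Bool → Bool → ∀ n → PairSet n → ℕ → ℕ → Set
ListRun und conn n G sgn abs =
  let xs = n ∷ sgn ∷ abs ∷ map bit (toList G) in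
  ∃[ s ] ∃[ k ] ⟨ program und conn , initial xs ⟩⇓ s ∣ k ×
    k ≤ ⟦ programPoly und conn ⟧ₚ (suc (inputSize xs)) * 2 ^ n × Run.Outcome und conn {n} G sgn abs (regs s 0)

run-list : ∀ und conn n (G : PairSet n) sgn abs → ListRun und conn n G sgn abs
run-list und conn n G sgn abs = Run.run und conn {n} G
  (record { cell  = λ a → ≤-trans (nth≤ xs a) (2^-mono (n≤1+n (inputSize xs)))
          ; cell₀ = order≤ n sgn abs G })
  (order≤ n sgn abs G)
  (record { order≡ = refl
          ; adj    = λ u v → subst (λ i → Truth (nth (map bit (toList G)) i) (Arc n G u v))
                               (toℕ-combine u v) (truth-nth G (combine u v)) })
  where xs = n ∷ sgn ∷ abs ∷ map bit (toList G)

decided : ∀ und conn n (G : PairSet n) t → Decided und conn n G t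
decided und conn n G (ℤ.+ k) = conclude (run-list und conn n G 0 k)
  where
  conclude : ListRun und conn n G 0 k → Decided und conn n G (ℤ.+ k)
  conclude (s , j , run , j≤ , ≼? , κ , L , ans) =
    ≼? , κ , L , s , j , run ,
    truth-map (λ (c , _ , a) → c , k , refl , a) (λ { (c , _ , refl , a) → c , refl , a }) ans , j≤
decided und conn n G -[1+ k ] = conclude (run-list und conn n G 1 (suc k))
  where
  conclude : ListRun und conn n G 1 (suc k) → Decided und conn n G -[1+ k ]
  conclude (s , j , run , j≤ , ≼? , κ , L , ans) =
    ≼? , κ , L , s , j , run , truth-map (λ { (_ , () , _) }) (λ { (_ , _ , () , _) }) ans , j≤

budget : ∀ {m t} → ℤ.+ m ℤ.≤ t → ∃[ k ] t ≡ ℤ.+ k × m ≤ k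
budget {t = ℤ.+ k} m≤t = k , refl , drop‿+≤+ m≤t

solvable : ∀ und conn {Inst : Set} (n : Inst → ℕ) (G : ∀ x → PairSet (n x)) (t : Inst → ℤ) (Yes : Inst → Set) →
  (∀ x → (≼? : ∀ u v → Dec (Condensation._≼_ (Arcs und (n x) (G x)) u v)) →
         ∀ κ → Listing (uncurry (Condensation.Cover (Arcs und (n x) (G x)))) κ →
         (Verdict und conn (n x) (G x) (t x) κ → Yes x) × (Yes x → Verdict und conn (n x) (G x) (t x) κ)) →
  SolvableInTimeO* (2 ^_) (record { Instance = Inst ; order = n ; encode = λ x → encodeGraph (n x) (G x) (t x) ; Yes = Yes })
solvable und conn n G t Yes iff =
  let c , d , poly≤ = poly-bound (programPoly und conn) in
  program und conn , c , d , λ x → conclude c d poly≤ x (decided und conn (n x) (G x) (t x))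
  where
  conclude : ∀ c d → (∀ z → 1 ≤ z → ⟦ programPoly und conn ⟧ₚ z ≤ c * z ^ d) →
    ∀ x → Decided und conn (n x) (G x) (t x) →
    ∃[ s ] ∃[ k ] ⟨ program und conn , initial (encodeGraph (n x) (G x) (t x)) ⟩⇓ s ∣ k × Answers (Yes x) s ×
      k ≤ c * suc (inputSize (encodeGraph (n x) (G x) (t x))) ^ d * 2 ^ n x
  conclude c d poly≤ x (≼? , κ , L , s , k , run , ans , k≤) =
    s , k , run , truth-map (proj₁ (iff x ≼? κ L)) (proj₂ (iff x ≼? κ L)) ans ,
    ≤-trans k≤ (*-monoˡ-≤ (2 ^ n x) (poly≤ _ (s≤s z≤n)))

-- In a strongly connected digraph the equivalent subgraphs are the strongly connected ones, so the
-- procedure for MEG is run together with a connectivity test.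
solvable-SCSpS : SolvableInTimeO* (2 ^_) SCSpS
solvable-SCSpS = solvable false true n A t (Problem.Yes SCSpS) λ x ≼? κ L →
  (λ { (all≼ , k , t≡ , aff) → let X , X⊆A , ∣X∣≤k , equiv = MEGraph.sound (A x) ≼? L aff in
       X , X⊆A , subst (ℤ.+ ∣ X ∣ ℤ.≤_) (sym t≡) (ℤ.+≤+ ∣X∣≤k) , λ u v → equiv u v (all≼ u v) }) ,
  (λ { (X , X⊆A , X≤t , conn) → let k , t≡ , ∣X∣≤k = budget X≤t in
       (λ u v → star-map X⊆A (conn u v)) , k , t≡ ,
       MEGraph.complete (A x) ≼? L X⊆A ∣X∣≤k (λ u v _ → conn u v) })
  where open DigraphInstance

solvable-MEG : SolvableInTimeO* (2 ^_) MEG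
solvable-MEG = solvable false false n A t (Problem.Yes MEG) λ x ≼? κ L →
  (λ { (_ , k , t≡ , aff) → let X , X⊆A , ∣X∣≤k , equiv = MEGraph.sound (A x) ≼? L aff in
       X , X⊆A , subst (ℤ.+ ∣ X ∣ ℤ.≤_) (sym t≡) (ℤ.+≤+ ∣X∣≤k) , equiv }) ,
  (λ { (X , X⊆A , X≤t , equiv) → let k , t≡ , ∣X∣≤k = budget X≤t in
       tt , k , t≡ , MEGraph.complete (A x) ≼? L X⊆A ∣X∣≤k equiv })
  where open DigraphInstance

solvable-2-ECSS : SolvableInTimeO* (2 ^_) 2-ECSS
solvable-2-ECSS = solvable true true n E t (Problem.Yes 2-ECSS) λ x ≼? κ L →
  (λ { (all≼ , k , t≡ , aff) →
       let X , X⊆E , ∣X∣≤k , conn = 2ECSSGraph.sound (E x) (isEdgeSet x) ≼? L aff all≼ in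
       X , X⊆E , subst (ℤ.+ ∣ X ∣ ℤ.≤_) (sym t≡) (ℤ.+≤+ ∣X∣≤k) , conn }) ,
  (λ { (X , X⊆E , X≤t , conn) →
       let k , t≡ , ∣X∣≤k = budget X≤t
           aff , all≼ = 2ECSSGraph.complete (E x) (isEdgeSet x) ≼? L X⊆E ∣X∣≤k conn in
       all≼ , k , t≡ , aff })
  where open GraphInstance

corollary2 : SolvableInTimeO* (λ n → 2 ^ n) SCSpS × SolvableInTimeO* (λ n → 2 ^ n) MEG × SolvableInTimeO* (λ n → 2 ^ n) 2-ECSS
corollary2 = solvable-SCSpS , solvable-MEG , solvable-2-ECSS
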